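{- Let $S\subset\mathbb{N}\setminus\{1\}$ satisfy $1\le |S|\le 3$, and assume that $\operatorname{lcm}(S)$ has at most two distinct prime factors. Then $\mathrm{MIN}(S)=\mathrm{FIB}(S)$.
   Context: $\mathbb{N}=\{1,2,\dots\}$, $\mathbb{N}_0=\mathbb{N}\cup\{0\}$. For a finite nonempty set $A\subset\mathbb{N}_0$, its mask polynomial is $A(X)=\sum_{a\in A}X^a$. $\Phi_s(X)$ denotes the $s$-th cyclotomic polynomial. $\operatorname{lcm}(S)$ is the least common multiple of the elements of $S$. For a finite nonempty $S\subset\mathbb{N}\setminus\{1\}$, $\mathrm{MIN}(S)$ is the minimum of $|A|$ over all finite nonempty sets $A\subset\mathbb{N}_0$ such that $\Phi_s(X)\mid A(X)$ for all $s\in S$. For $N\in\mathbb{N}$ and a prime $p\mid N$, let $F^N_p(X)=\Phi_p(X^{N/p})=1+X^{N/p}+\dots+X^{(p-1)N/p}$. A finite nonempty set $A\subset\mathbb{N}_0$ is fibered on scale $N$ if there is a prime $p\mid N$ such that $F^N_p(X)\mid A(X)$ modulo $X^N-1$, i.e. $A(X)\equiv Q(X)F^N_p(X) \bmod (X^N-1)$ for some polynomial $Q$ with integer coefficients (since $F_p^N(X)\mid X^N-1$, this is equivalent to $F^N_p(X)\mid A(X)$). $\mathrm{FIB}(S)$ is the smallest size of a finite nonempty set $A\subset\mathbb{N}_0$ that is fibered on each scale $s\in S$ (the prime $p$ may depend on $s$). -}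

module Defs where

open import Algebra.Bundles.Raw using (RawMagma)
open import Data.Bool using (if_then_else_)
open import Data.Integer as ℤ using (ℤ; 0ℤ; 1ℤ; -1ℤ)
open import Data.List using (List; []; _∷_; length; map; foldr; filter; upTo)
open import Data.List.Membership.Propositional using (_∈_)
open import Data.List.Relation.Unary.All using (all?)
open import Data.List.Relation.Unary.Unique.Propositional using (Unique)
open import Data.Nat using (ℕ; zero; suc; _≤_)
open import Data.Nat.Divisibility using (_∣_; _∣?_; quotient)
open import Data.Nat.LCM using (lcm)
open import Data.Nat.Primality using (Prime; prime?)
open import Data.Product using (Σ-syntax; ∃-syntax; _×_; _,_; proj₁)
open import Level using (0ℓ)
open import Relation.Binary.PropositionalEquality using (_≡_)
open import Relation.Nullary using (does)
open import Relation.Nullary.Decidable using (_×-dec_)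
import Algebra.Definitions.RawMagma as RawMagmaDefinitions

infix  4 _≈_ _≡_mod_ _∈ₛ_ MIN_≔_ FIB_≔_
infixl 6 _+ₚ_ _-ₚ_
infixl 7 _*ₚ_ _·_
infixl 8 _⟨X^_⟩

-- ℤ[X]: coefficient lists, constant term first.  Trailing zeros are allowed,
-- so equality is _≈_ and not _≡_.

Poly : Set
Poly = List ℤ

coeff : Poly → ℕ → ℤ
coeff []      _       = 0ℤ
coeff (a ∷ P) zero    = a
coeff (a ∷ P) (suc n) = coeff P n

_≈_ : Poly → Poly → Set
P ≈ Q = ∀ n → coeff P n ≡ coeff Q n

_+ₚ_ : Poly → Poly → Poly
[]      +ₚ Q       = Q
(a ∷ P) +ₚ []      = a ∷ P
(a ∷ P) +ₚ (b ∷ Q) = (a ℤ.+ b) ∷ (P +ₚ Q)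

_·_ : ℤ → Poly → Poly
c · P = map (c ℤ.*_) P

_-ₚ_ : Poly → Poly → Poly
P -ₚ Q = P +ₚ (-1ℤ · Q)

_*ₚ_ : Poly → Poly → Poly
[]      *ₚ Q = []
(a ∷ P) *ₚ Q = (a · Q) +ₚ (0ℤ ∷ (P *ₚ Q))

1ₚ : Poly
1ₚ = 1ℤ ∷ []

X^_ : ℕ → Poly
X^ zero  = 1ₚ
X^ suc n = 0ℤ ∷ (X^ n)

-- P ⟨X^ k ⟩ is the substitution P(X^k).
_⟨X^_⟩ : Poly → ℕ → Poly
[]      ⟨X^ k ⟩ = []
(a ∷ P) ⟨X^ k ⟩ = (a ∷ []) +ₚ ((X^ k) *ₚ (P ⟨X^ k ⟩))

*ₚ-rawMagma : RawMagma 0ℓ 0ℓ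
*ₚ-rawMagma = record { Carrier = Poly ; _≈_ = _≈_ ; _∙_ = _*ₚ_ }

open RawMagmaDefinitions *ₚ-rawMagma public using () renaming (_∣_ to infix 4 _∣ₚ_)

_≡_mod_ : Poly → Poly → Poly → Set
P ≡ Q mod M = M ∣ₚ (P -ₚ Q)

-- The degree; 0 for the zero polynomial.
degree : Poly → ℕ
degree []      = 0
degree (a ∷ P) = if does (all? (ℤ._≟ 0ℤ) P) then 0 else suc (degree P)

-- Long division of P by D, returning (quotient , remainder).  It is meaningful
-- for monic D: if P = Q D + R with deg R < deg D, then a + X P is
-- X Q D + (a + X R), and a + X R has degree at most deg D.
divMod : Poly → Poly → Poly × Poly
divMod []      D = [] , []
divMod (a ∷ P) D =
  let (Q , R) = divMod P D
      c       = coeff (a ∷ R) (degree D)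
  in (c ∷ Q) , ((a ∷ R) -ₚ (c · D))

-- The cyclotomic polynomials, by the recursion
--   Φ n = (X^n − 1) / ∏ { Φ d ∣ d divides n, d < n }    (n ≥ 1),
-- where the division is exact and the divisor is monic.
-- ∏Φ n k is the product of Φ d over the divisors d of n with 1 ≤ d ≤ k.
-- The value Φ 0 is irrelevant.
mutual
  Φ : ℕ → Poly
  Φ zero    = 1ₚ
  Φ (suc n) = proj₁ (divMod ((X^ suc n) -ₚ 1ₚ) (∏Φ (suc n) n))

  ∏Φ : ℕ → ℕ → Poly
  ∏Φ n zero    = 1ₚ
  ∏Φ n (suc k) = if does (suc k ∣? n) then Φ (suc k) *ₚ ∏Φ n k else ∏Φ n k

record FiniteSet : Set where
  field
    elements : List ℕ
    unique   : Unique elements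

open FiniteSet public

∣_∣ : FiniteSet → ℕ
∣ A ∣ = length (elements A)

_∈ₛ_ : ℕ → FiniteSet → Set
n ∈ₛ A = n ∈ elements A

maskPoly : FiniteSet → Poly
maskPoly A = foldr (λ a P → (X^ a) +ₚ P) [] (elements A)

lcmₛ : FiniteSet → ℕ
lcmₛ S = foldr lcm 1 (elements S)

-- Intended for n ≥ 1, where every divisor of n is at most n.
primeDivisors : ℕ → List ℕ
primeDivisors n = filter (λ p → prime? p ×-dec (p ∣? n)) (upTo (suc n))

-- F^N_p(X) = Φ_p(X^{N/p}).
F : (N p : ℕ) → p ∣ N → Poly
F N p p∣N = Φ p ⟨X^ quotient p∣N ⟩

FiberedOn : ℕ → FiniteSet → Set
FiberedOn N A =
  ∃[ p ] Prime p × (Σ[ p∣N ∈ p ∣ N ] ∃[ Q ]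
    maskPoly A ≡ Q *ₚ F N p p∣N mod ((X^ N) -ₚ 1ₚ))

-- The minimum of ∣ A ∣ over the nonempty finite A ⊂ ℕ₀ satisfying P exists
-- and equals m.
IsMinimumSize : (FiniteSet → Set) → ℕ → Set
IsMinimumSize P m =
    (∃[ A ] 1 ≤ ∣ A ∣ × P A × ∣ A ∣ ≡ m)
  × (∀ A → 1 ≤ ∣ A ∣ → P A → m ≤ ∣ A ∣)

-- MIN(S) = m and FIB(S) = m, as relations between S and m.
MIN_≔_ : FiniteSet → ℕ → Set
MIN S ≔ m = IsMinimumSize (λ A → ∀ s → s ∈ₛ S → Φ s ∣ₚ maskPoly A) m

FIB_≔_ : FiniteSet → ℕ → Set
FIB S ≔ m = IsMinimumSize (λ A → ∀ s → s ∈ₛ S → FiberedOn s A) m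

{-# OPTIONS --safe #-}

-- Let p ≠ q be primes such that every prime dividing lcm(S) is p or q.  Choose finite sets E
-- and G of exponents such that each p^a q^b in S has 0 < a ∈ E or 0 < b ∈ G.  A sumset of
-- progressions, one per element of E and G, spread out modulo a common multiple of S, is then
-- fibered on all scales in S and has p^|E| q^|G| elements.
-- Conversely, let Φ_s ∣ A for all s ∈ S.  For s = p^a q^b this gives an exchange identity:
-- Σ_{n ∈ A} (g(n + p^(a-1)) − g(n)) (h(n + q^(b-1)) − h(n)) = 0 for g of period p^a and h of
-- period q^b.  If moreover A is not equidistributed at p^a, i.e. Φ_{p^a} ∤ A, then A meets all q
-- classes of the base-q digit with weight q^(b-1); the smallest class has at most |A|/q elements
-- and inherits the conditions with larger q-exponents.  Since |S| ≤ 3, induction on |S| yields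
-- E and G with p^|E| q^|G| ≤ |A|, unless S consists of one scale equidistributed in the direction
-- p only, one in the direction q only and one in neither.  In that case congruences modulo p
-- and q between the sizes of digit classes give p² q ≤ |A| or p q² ≤ |A|.
module Submission where

open import Defs
open import Algebra.Bundles using (CommutativeRing)
open import Algebra.Definitions.RawMagma *ₚ-rawMagma using (_∣ʳ_)
open import Data.Bool using (Bool; true; false)
open import Data.Empty using (⊥-elim)
open import Data.Integer as ℤ using (ℤ; 0ℤ; 1ℤ; -1ℤ)
import Data.Integer.Divisibility.Signed as ℤᵈ
import Data.Integer.Properties as ℤₚ
import Data.Integer.Tactic.RingSolver as ℤ-Solver
open import Data.List using (List; []; _∷_; _++_; length; map; filter; filterᵇ; foldr; upTo)
open import Data.List.Membership.Propositional using (_∈_; _∉_; lose)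
open import Data.List.Membership.Propositional.Properties using (∈-map⁺; ∈-map⁻; ∈-filter⁺; ∈-filter⁻; ∈-upTo⁺)
import Data.List.Properties as Listₚ
open import Data.List.Relation.Binary.Permutation.Propositional using (_↭_; ↭-refl; ↭-sym; ↭-trans; ↭-prep; ↭-swap)
open import Data.List.Relation.Binary.Permutation.Propositional.Properties using (All-resp-↭; ↭-length)
open import Data.List.Relation.Unary.All as All using (All; []; _∷_; all?)
import Data.List.Relation.Unary.All.Properties as Allₚ
open import Data.List.Relation.Unary.AllPairs using (AllPairs; []; _∷_)
open import Data.List.Relation.Unary.Any using (here; there)
open import Data.List.Relation.Unary.Unique.Propositional using (Unique)
import Data.List.Relation.Unary.Unique.Propositional.Properties as Uniqueₚ
open import Data.Maybe using (Maybe; just; nothing)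
open import Data.Nat as ℕ using (ℕ; zero; suc; z≤n; s≤s; _≤_; _<_; _+_; _*_; _^_; _∸_; _⊔_; _/_; _%_; _≡ᵇ_; NonZero)
open import Data.Nat.Coprimality using (Coprime; coprime-Bézout; coprime-divisor; coprime-factors) renaming (sym to coprime-sym)
open import Data.Nat.Divisibility
import Data.Nat.DivMod as DM
open import Data.Nat.GCD using (module Bézout)
open import Data.Nat.Induction using (<-wellFounded)
open import Data.Nat.LCM using (lcm; m∣lcm[m,n]; n∣lcm[m,n]; lcm-least)
open import Data.Nat.Primality using (Prime; prime?; prime[2]; euclidsLemma; prime⇒nonZero; prime⇒nonTrivial; prime⇒irreducible)
open import Data.Nat.Primality.Factorisation using (factorise)
import Data.Nat.Properties as ℕₚ
open import Data.Nat.Tactic.RingSolver using (solve-∀)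
open import Data.Product using (_×_; _,_; proj₁; proj₂; ∃-syntax)
open import Data.Sum using (_⊎_; inj₁; inj₂; [_,_]′; map₁; map₂; reduce) renaming (map to map-⊎)
open import Induction.WellFounded using (Acc; acc)
open import Level using (0ℓ)
open import Relation.Binary.Definitions using (tri<; tri≈; tri>)
open import Relation.Binary.PropositionalEquality
import Relation.Binary.Reasoning.Setoid as SetoidReasoning
open import Relation.Nullary using (¬_; Dec; yes; no; contradiction)
open import Relation.Nullary.Decidable using (¬?; _×-dec_; dec-true; dec-false; from-yes)
open import Data.List.Membership.DecPropositional ℕ._≟_ using (_∈?_)
open import Tactic.RingSolver.Core.AlmostCommutativeRing using (fromCommutativeRing)
import Tactic.RingSolver.NonReflective as NonReflective

-- No roots of unity occur. A polynomial is tested by pairing it with integer-valued functions; a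
-- factor X^k - 1 then acts as a difference operator, and X^n - 1 annihilates everything of period
-- n. For n = p q m the exchange identity comes from Φ_n (X^(pm) - 1)(X^(qm) - 1) = (X^n - 1)(X^m -
-- 1).
--
-- The obstacle is that the exchange identity forces equidistribution in neither direction, so it is
-- not determined which prime should pay for a scale p^a q^b. Passing to a smallest digit class
-- gains a factor p, but it requires all scales still in play to be treated in the same direction,
-- since conditions survive only at exponents of p above the chosen digit. A scale equidistributed
-- in neither direction meets all classes in both, so it can follow whatever the others need; only
-- two opposite demands from the remaining scales block the step. In the blocked case everything
-- depends on whether the equidistributed levels are finer or coarser than the exponents of the
-- third scale.
--
-- If every scale is equidistributed in some direction, p^|E| q^|G| even divides |A|.

-- The ring ℤ[X]

-- ⟪ P , f ⟫ = Σ Pₙ f(n).  Polynomials are equal iff all these pairings agree,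
-- and multiplication by X^k becomes a shift of f.
⟪_,_⟫ : Poly → (ℕ → ℤ) → ℤ
⟪ []    , f ⟫ = 0ℤ
⟪ a ∷ P , f ⟫ = a ℤ.* f 0 ℤ.+ ⟪ P , (λ n → f (suc n)) ⟫

pair-cong : ∀ P {f g} → (∀ n → f n ≡ g n) → ⟪ P , f ⟫ ≡ ⟪ P , g ⟫
pair-cong []      e = refl
pair-cong (a ∷ P) e = cong₂ (λ x y → a ℤ.* x ℤ.+ y) (e 0) (pair-cong P (λ n → e (suc n)))

pair-0ˡ : ∀ P f → P ≈ [] → ⟪ P , f ⟫ ≡ 0ℤ
pair-0ˡ []      f e = refl
pair-0ˡ (a ∷ P) f e rewrite e 0 | pair-0ˡ P (λ n → f (suc n)) (λ n → e (suc n)) = refl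

pair-congˡ : ∀ P Q f → P ≈ Q → ⟪ P , f ⟫ ≡ ⟪ Q , f ⟫
pair-congˡ []      Q       f e = sym (pair-0ˡ Q f (λ n → sym (e n)))
pair-congˡ (a ∷ P) []      f e = pair-0ˡ (a ∷ P) f e
pair-congˡ (a ∷ P) (b ∷ Q) f e =
  cong₂ (λ x y → x ℤ.* f 0 ℤ.+ y) (e 0) (pair-congˡ P Q _ (λ n → e (suc n)))

pair-0ʳ : ∀ P f → (∀ n → f n ≡ 0ℤ) → ⟪ P , f ⟫ ≡ 0ℤ
pair-0ʳ []      f e = refl
pair-0ʳ (a ∷ P) f e rewrite e 0 | pair-0ʳ P (λ n → f (suc n)) (λ n → e (suc n)) =
  cong (ℤ._+ 0ℤ) (ℤₚ.*-zeroʳ a)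

pair-+ʳ : ∀ P f g → ⟪ P , (λ n → f n ℤ.+ g n) ⟫ ≡ ⟪ P , f ⟫ ℤ.+ ⟪ P , g ⟫
pair-+ʳ []      f g = refl
pair-+ʳ (a ∷ P) f g rewrite pair-+ʳ P (λ n → f (suc n)) (λ n → g (suc n)) = lem a (f 0) (g 0) _ _
  where
  lem : ∀ a x y u v → a ℤ.* (x ℤ.+ y) ℤ.+ (u ℤ.+ v) ≡ a ℤ.* x ℤ.+ u ℤ.+ (a ℤ.* y ℤ.+ v)
  lem = ℤ-Solver.solve-∀

pair-*ʳ : ∀ P c f → ⟪ P , (λ n → c ℤ.* f n) ⟫ ≡ c ℤ.* ⟪ P , f ⟫
pair-*ʳ []      c f = sym (ℤₚ.*-zeroʳ c)
pair-*ʳ (a ∷ P) c f rewrite pair-*ʳ P c (λ n → f (suc n)) = lem a c (f 0) _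
  where
  lem : ∀ a c x u → a ℤ.* (c ℤ.* x) ℤ.+ c ℤ.* u ≡ c ℤ.* (a ℤ.* x ℤ.+ u)
  lem = ℤ-Solver.solve-∀

pair-+ˡ : ∀ P Q f → ⟪ P +ₚ Q , f ⟫ ≡ ⟪ P , f ⟫ ℤ.+ ⟪ Q , f ⟫
pair-+ˡ []      Q       f = sym (ℤₚ.+-identityˡ _)
pair-+ˡ (a ∷ P) []      f = sym (ℤₚ.+-identityʳ _)
pair-+ˡ (a ∷ P) (b ∷ Q) f rewrite pair-+ˡ P Q (λ n → f (suc n)) = lem a b (f 0) _ _
  where
  lem : ∀ a b x u v → (a ℤ.+ b) ℤ.* x ℤ.+ (u ℤ.+ v) ≡ a ℤ.* x ℤ.+ u ℤ.+ (b ℤ.* x ℤ.+ v)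
  lem = ℤ-Solver.solve-∀

pair-·ˡ : ∀ c P f → ⟪ c · P , f ⟫ ≡ c ℤ.* ⟪ P , f ⟫
pair-·ˡ c []      f = sym (ℤₚ.*-zeroʳ c)
pair-·ˡ c (a ∷ P) f rewrite pair-·ˡ c P (λ n → f (suc n)) = lem a c (f 0) _
  where
  lem : ∀ a c x u → c ℤ.* a ℤ.* x ℤ.+ c ℤ.* u ≡ c ℤ.* (a ℤ.* x ℤ.+ u)
  lem = ℤ-Solver.solve-∀

pair-*ₚ : ∀ P Q f → ⟪ P *ₚ Q , f ⟫ ≡ ⟪ P , (λ k → ⟪ Q , (λ l → f (k ℕ.+ l)) ⟫) ⟫
pair-*ₚ []      Q f = refl
pair-*ₚ (a ∷ P) Q f = begin
  ⟪ (a · Q) +ₚ (0ℤ ∷ (P *ₚ Q)) , f ⟫             ≡⟨ pair-+ˡ (a · Q) _ f ⟩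
  ⟪ a · Q , f ⟫ ℤ.+ (0ℤ ℤ.* f 0 ℤ.+ ⟪ P *ₚ Q , (λ n → f (suc n)) ⟫)
      ≡⟨ cong₂ ℤ._+_ (pair-·ˡ a Q f) (ℤₚ.+-identityˡ ⟪ P *ₚ Q , (λ n → f (suc n)) ⟫) ⟩
  a ℤ.* ⟪ Q , f ⟫ ℤ.+ ⟪ P *ₚ Q , (λ n → f (suc n)) ⟫ ≡⟨ cong (ℤ._+_ (a ℤ.* ⟪ Q , f ⟫)) (pair-*ₚ P Q _) ⟩
  _ ∎
  where open ≡-Reasoning

pair-swap : ∀ P Q (f : ℕ → ℕ → ℤ) →
  ⟪ P , (λ k → ⟪ Q , f k ⟫) ⟫ ≡ ⟪ Q , (λ l → ⟪ P , (λ k → f k l) ⟫) ⟫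
pair-swap []      Q f = sym (pair-0ʳ Q _ (λ _ → refl))
pair-swap (a ∷ P) Q f rewrite pair-swap P Q (λ k → f (suc k)) =
  sym (trans (pair-+ʳ Q _ _) (cong (ℤ._+ ⟪ Q , _ ⟫) (pair-*ʳ Q a (f 0))))

pair-X^ : ∀ k f → ⟪ X^ k , f ⟫ ≡ f k
pair-X^ zero    f = trans (ℤₚ.+-identityʳ _) (ℤₚ.*-identityˡ _)
pair-X^ (suc k) f = trans (ℤₚ.+-identityˡ _) (pair-X^ k _)

δ : ℕ → ℕ → ℤ
δ zero    zero    = 1ℤ
δ zero    (suc n) = 0ℤ
δ (suc m) zero    = 0ℤ
δ (suc m) (suc n) = δ m n

pair-δ : ∀ P n → ⟪ P , δ n ⟫ ≡ coeff P n
pair-δ []      n       = refl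
pair-δ (a ∷ P) zero    = trans (cong₂ ℤ._+_ (ℤₚ.*-identityʳ a) (pair-0ʳ P _ (λ _ → refl)))
  (ℤₚ.+-identityʳ a)
pair-δ (a ∷ P) (suc n) = trans (cong₂ ℤ._+_ (ℤₚ.*-zeroʳ a) (pair-δ P n)) (ℤₚ.+-identityˡ _)

infix 4 _≋_

-- A record, unlike _≈_, lets P and Q be inferred from a proof of P ≋ Q.
record _≋_ (P Q : Poly) : Set where
  constructor pairwise
  field pair-≡ : ∀ f → ⟪ P , f ⟫ ≡ ⟪ Q , f ⟫

open _≋_ public

≋⇒≈ : ∀ {P Q} → P ≋ Q → P ≈ Q
≋⇒≈ {P} {Q} e n = trans (sym (pair-δ P n)) (trans (pair-≡ e (δ n)) (pair-δ Q n))

≈⇒≋ : ∀ P Q → P ≈ Q → P ≋ Q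
≈⇒≋ P Q e = pairwise λ f → pair-congˡ P Q f e

-ₚ_ : Poly → Poly
-ₚ P = -1ℤ · P

*ₚ-comm : ∀ P Q → P *ₚ Q ≋ Q *ₚ P
*ₚ-comm P Q = pairwise λ f → begin
  ⟪ P *ₚ Q , f ⟫                                ≡⟨ pair-*ₚ P Q f ⟩
  ⟪ P , (λ k → ⟪ Q , (λ l → f (k ℕ.+ l)) ⟫) ⟫     ≡⟨ pair-swap P Q _ ⟩
  ⟪ Q , (λ l → ⟪ P , (λ k → f (k ℕ.+ l)) ⟫) ⟫
      ≡⟨ pair-cong Q (λ l → pair-cong P (λ k → cong f (ℕₚ.+-comm k l))) ⟩
  ⟪ Q , (λ l → ⟪ P , (λ k → f (l ℕ.+ k)) ⟫) ⟫     ≡⟨ pair-*ₚ Q P f ⟨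
  ⟪ Q *ₚ P , f ⟫                                ∎
  where open ≡-Reasoning

*ₚ-congʳ : ∀ {P Q} R → P ≋ Q → P *ₚ R ≋ Q *ₚ R
*ₚ-congʳ {P} {Q} R e = pairwise λ f → trans (pair-*ₚ P R f) (trans (pair-≡ e _) (sym (pair-*ₚ Q R f)))

*ₚ-congˡ : ∀ R {P Q} → P ≋ Q → R *ₚ P ≋ R *ₚ Q
*ₚ-congˡ R {P} {Q} e = pairwise λ f →
  trans (pair-*ₚ R P f) (trans (pair-cong R (λ k → pair-≡ e _)) (sym (pair-*ₚ R Q f)))

*ₚ-assoc : ∀ P Q R → (P *ₚ Q) *ₚ R ≋ P *ₚ (Q *ₚ R)
*ₚ-assoc P Q R = pairwise λ f → begin
  ⟪ (P *ₚ Q) *ₚ R , f ⟫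
    ≡⟨ pair-*ₚ (P *ₚ Q) R f ⟩
  ⟪ P *ₚ Q , (λ k → ⟪ R , (λ l → f (k ℕ.+ l)) ⟫) ⟫
    ≡⟨ pair-*ₚ P Q _ ⟩
  ⟪ P , (λ i → ⟪ Q , (λ j → ⟪ R , (λ l → f (i ℕ.+ j ℕ.+ l)) ⟫) ⟫) ⟫
    ≡⟨ pair-cong P (λ i → pair-cong Q (λ j → pair-cong R (λ l → cong f (ℕₚ.+-assoc i j l)))) ⟩
  ⟪ P , (λ i → ⟪ Q , (λ j → ⟪ R , (λ l → f (i ℕ.+ (j ℕ.+ l))) ⟫) ⟫) ⟫
    ≡⟨ pair-cong P (λ i → pair-*ₚ Q R _) ⟨
  ⟪ P , (λ i → ⟪ Q *ₚ R , (λ j → f (i ℕ.+ j)) ⟫) ⟫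
    ≡⟨ pair-*ₚ P (Q *ₚ R) f ⟨
  ⟪ P *ₚ (Q *ₚ R) , f ⟫ ∎
  where open ≡-Reasoning

*ₚ-distribˡ : ∀ P Q R → P *ₚ (Q +ₚ R) ≋ P *ₚ Q +ₚ P *ₚ R
*ₚ-distribˡ P Q R = pairwise λ f → begin
  ⟪ P *ₚ (Q +ₚ R) , f ⟫
    ≡⟨ pair-*ₚ P (Q +ₚ R) f ⟩
  ⟪ P , (λ k → ⟪ Q +ₚ R , (λ l → f (k ℕ.+ l)) ⟫) ⟫
    ≡⟨ pair-cong P (λ k → pair-+ˡ Q R _) ⟩
  ⟪ P , (λ k → ⟪ Q , (λ l → f (k ℕ.+ l)) ⟫ ℤ.+ ⟪ R , (λ l → f (k ℕ.+ l)) ⟫) ⟫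
    ≡⟨ pair-+ʳ P _ _ ⟩
  ⟪ P , (λ k → ⟪ Q , (λ l → f (k ℕ.+ l)) ⟫) ⟫ ℤ.+ ⟪ P , (λ k → ⟪ R , (λ l → f (k ℕ.+ l)) ⟫) ⟫
    ≡⟨ cong₂ ℤ._+_ (pair-*ₚ P Q f) (pair-*ₚ P R f) ⟨
  ⟪ P *ₚ Q , f ⟫ ℤ.+ ⟪ P *ₚ R , f ⟫
    ≡⟨ pair-+ˡ (P *ₚ Q) (P *ₚ R) f ⟨
  ⟪ (P *ₚ Q) +ₚ (P *ₚ R) , f ⟫ ∎
  where open ≡-Reasoning

*ₚ-identityˡ : ∀ P → 1ₚ *ₚ P ≋ P
*ₚ-identityˡ P = pairwise λ f → trans (pair-*ₚ 1ₚ P f) (pair-X^ 0 (λ k → ⟪ P , (λ l → f (k ℕ.+ l)) ⟫))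

≋-refl : ∀ {P} → P ≋ P
≋-refl = pairwise λ f → refl

≋-sym : ∀ {P Q} → P ≋ Q → Q ≋ P
≋-sym e = pairwise λ f → sym (pair-≡ e f)

≋-trans : ∀ {P Q R} → P ≋ Q → Q ≋ R → P ≋ R
≋-trans e e′ = pairwise λ f → trans (pair-≡ e f) (pair-≡ e′ f)

+ₚ-cong : ∀ {P P′ Q Q′} → P ≋ P′ → Q ≋ Q′ → P +ₚ Q ≋ P′ +ₚ Q′
+ₚ-cong {P} {P′} {Q} {Q′} e e′ = pairwise λ f →
  trans (pair-+ˡ P Q f) (trans (cong₂ ℤ._+_ (pair-≡ e f) (pair-≡ e′ f)) (sym (pair-+ˡ P′ Q′ f)))

polyRing : CommutativeRing 0ℓ 0ℓ
polyRing = record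
  { Carrier = Poly ; _≈_ = _≋_ ; _+_ = _+ₚ_ ; _*_ = _*ₚ_ ; -_ = -ₚ_ ; 0# = [] ; 1# = 1ₚ
  ; isCommutativeRing = record
    { isRing = record
      { +-isAbelianGroup = record
        { isGroup = record
          { isMonoid = record
            { isSemigroup = record
              { isMagma = record
                { isEquivalence = record { refl = ≋-refl ; sym = ≋-sym ; trans = ≋-trans }
                ; ∙-cong = +ₚ-cong }
              ; assoc = λ P Q R → pairwise λ f →
                  trans (pair-+ˡ (P +ₚ Q) R f)
                  (trans (cong (ℤ._+ ⟪ R , f ⟫) (pair-+ˡ P Q f))
                  (trans (ℤₚ.+-assoc ⟪ P , f ⟫ ⟪ Q , f ⟫ ⟪ R , f ⟫)
                  (sym (trans (pair-+ˡ P (Q +ₚ R) f) (cong (ℤ._+_ ⟪ P , f ⟫) (pair-+ˡ Q R f)))))) }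
            ; identity = (λ P → ≋-refl) ,
                  (λ P → pairwise λ f → trans (pair-+ˡ P [] f) (ℤₚ.+-identityʳ _)) }
          ; inverse = (λ P → pairwise λ f → trans (pair-+ˡ (-ₚ P) P f)
                        (trans (cong (ℤ._+ ⟪ P , f ⟫) (pair-·ˡ -1ℤ P f)) (negˡ ⟪ P , f ⟫)))
                    , (λ P → pairwise λ f → trans (pair-+ˡ P (-ₚ P) f)
                        (trans (cong (ℤ._+_ ⟪ P , f ⟫) (pair-·ˡ -1ℤ P f)) (negʳ ⟪ P , f ⟫)))
          ; ⁻¹-cong = λ {P} {Q} e → pairwise λ f →
              trans (pair-·ˡ -1ℤ P f) (trans (cong (-1ℤ ℤ.*_) (pair-≡ e f)) (sym (pair-·ˡ -1ℤ Q f))) }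
        ; comm = λ P Q → pairwise λ f →
              trans (pair-+ˡ P Q f) (trans (ℤₚ.+-comm ⟪ P , f ⟫ ⟪ Q , f ⟫) (sym (pair-+ˡ Q P f))) }
      ; *-cong = λ {P} {P′} {Q} {Q′} e e′ → ≋-trans (*ₚ-congʳ Q e) (*ₚ-congˡ P′ e′)
      ; *-assoc = *ₚ-assoc
      ; *-identity = *ₚ-identityˡ , (λ P → ≋-trans (*ₚ-comm P 1ₚ) (*ₚ-identityˡ P))
      ; distrib = *ₚ-distribˡ , (λ P Q R → ≋-trans (*ₚ-comm (Q +ₚ R) P)
          (≋-trans (*ₚ-distribˡ P Q R) (+ₚ-cong (*ₚ-comm P Q) (*ₚ-comm P R)))) }
    ; *-comm = *ₚ-comm } }
  where
  negˡ : ∀ x → -1ℤ ℤ.* x ℤ.+ x ≡ 0ℤ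
  negˡ = ℤ-Solver.solve-∀
  negʳ : ∀ x → x ℤ.+ -1ℤ ℤ.* x ≡ 0ℤ
  negʳ = ℤ-Solver.solve-∀

open CommutativeRing polyRing public using () renaming (setoid to polySetoid)

All-0⇒≈[] : ∀ P → All (_≡ 0ℤ) P → P ≈ []
All-0⇒≈[] []      []       n       = refl
All-0⇒≈[] (a ∷ P) (z ∷ zs) zero    = z
All-0⇒≈[] (a ∷ P) (z ∷ zs) (suc n) = All-0⇒≈[] P zs n

0≟ₚ : ∀ P → Maybe ([] ≋ P)
0≟ₚ P with all? (ℤ._≟ 0ℤ) P
... | yes z = just (≋-sym (≈⇒≋ P [] (All-0⇒≈[] P z)))
... | no _  = nothing

open NonReflective (fromCommutativeRing polyRing 0≟ₚ) public
  using (Κ; _⊕_; _⊗_; ⊝_) renaming (solve to ringₚ; _⊜_ to infix 4 _⊜_)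


-ₚ-cong : ∀ {P Q} → P ≋ Q → -ₚ P ≋ -ₚ Q
-ₚ-cong {P} {Q} e = pairwise λ f →
  trans (pair-·ˡ -1ℤ P f) (trans (cong (-1ℤ ℤ.*_) (pair-≡ e f)) (sym (pair-·ˡ -1ℤ Q f)))

≋-reflexive : ∀ {P Q} → P ≡ Q → P ≋ Q
≋-reflexive refl = ≋-refl

-- Monic polynomials and exact division

coeff-+ : ∀ P Q n → coeff (P +ₚ Q) n ≡ coeff P n ℤ.+ coeff Q n
coeff-+ []      Q       n       = sym (ℤₚ.+-identityˡ _)
coeff-+ (a ∷ P) []      n       = sym (ℤₚ.+-identityʳ _)
coeff-+ (a ∷ P) (b ∷ Q) zero    = refl
coeff-+ (a ∷ P) (b ∷ Q) (suc n) = coeff-+ P Q n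

coeff-· : ∀ c P n → coeff (c · P) n ≡ c ℤ.* coeff P n
coeff-· c []      n       = sym (ℤₚ.*-zeroʳ c)
coeff-· c (a ∷ P) zero    = refl
coeff-· c (a ∷ P) (suc n) = coeff-· c P n

-- c = 0 is allowed, so d need not be the degree of P.
record Lead (c : ℤ) (d : ℕ) (P : Poly) : Set where
  constructor lead
  field
    top   : coeff P d ≡ c
    above : ∀ n → d < n → coeff P n ≡ 0ℤ

open Lead public

Monic : ℕ → Poly → Set
Monic = Lead 1ℤ

lead-resp : ∀ {c d P Q} → P ≋ Q → Lead c d P → Lead c d Q
lead-resp e (lead t a) = lead (trans (sym (≋⇒≈ e _)) t) (λ n lt → trans (sym (≋⇒≈ e n)) (a n lt))

lead-* : ∀ {c d e} P Q → Lead c d P → Monic e Q → Lead c (d ℕ.+ e) (P *ₚ Q)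
lead-* []      Q (lead refl _) m = lead refl (λ _ _ → refl)
lead-* {d = zero} {e} (a ∷ P) Q (lead refl ab) m = lead
  (trans (coeff≡ e) (trans (cong (a ℤ.*_) (top m)) (ℤₚ.*-identityʳ a)))
  (λ n lt → trans (coeff≡ n) (trans (cong (a ℤ.*_) (above m n lt)) (ℤₚ.*-zeroʳ a)))
  where
  P*Q≋0 : P *ₚ Q ≋ []
  P*Q≋0 = *ₚ-congʳ Q (≈⇒≋ P [] (λ n → ab (suc n) (s≤s z≤n)))
  shifted : ∀ n → coeff (0ℤ ∷ (P *ₚ Q)) n ≡ 0ℤ
  shifted zero    = refl
  shifted (suc n) = ≋⇒≈ P*Q≋0 n
  coeff≡ : ∀ n → coeff ((a ∷ P) *ₚ Q) n ≡ a ℤ.* coeff Q n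
  coeff≡ n = trans (coeff-+ (a · Q) _ n) (trans (cong₂ ℤ._+_ (coeff-· a Q n) (shifted n))
    (ℤₚ.+-identityʳ _))
lead-* {d = suc d} {e} (a ∷ P) Q (lead refl ab) m = lead
  (trans (coeff≡ _ (ℕₚ.m≤n+m e d)) (top rec))
  (λ { (suc n) (s≤s lt) → trans (coeff≡ n (ℕₚ.≤-trans (ℕₚ.m≤n+m e d) (ℕₚ.<⇒≤ lt))) (above rec n lt) })
  where
  rec = lead-* P Q (lead refl (λ n lt → ab (suc n) (s≤s lt))) m
  coeff≡ : ∀ n → e ≤ n → coeff ((a ∷ P) *ₚ Q) (suc n) ≡ coeff (P *ₚ Q) n
  coeff≡ n e≤n = trans (coeff-+ (a · Q) _ (suc n))
    (trans (cong (ℤ._+ coeff (P *ₚ Q) n) (trans (coeff-· a Q (suc n))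
      (trans (cong (a ℤ.*_) (above m (suc n) (s≤s e≤n))) (ℤₚ.*-zeroʳ a)))) (ℤₚ.+-identityˡ _))

-- Trailing zeros are allowed, so the true leading coefficient has to be searched for and cannot be
-- read off the length of the list.
zero⊎lead : ∀ P → P ≋ [] ⊎ (∃[ c ] ∃[ d ] (c ≢ 0ℤ) × Lead c d P)
zero⊎lead [] = inj₁ ≋-refl
zero⊎lead (a ∷ P) with zero⊎lead P
... | inj₂ (c , d , c≢0 , l) =
    inj₂ (c , suc d , c≢0 , lead (top l) λ { (suc n) (s≤s lt) → above l n lt })
... | inj₁ P≋0 with a ℤ.≟ 0ℤ
...   | yes refl = inj₁ (≈⇒≋ (a ∷ P) [] λ { zero → refl ; (suc n) → ≋⇒≈ P≋0 n })
...   | no a≢0   = inj₂ (a , 0 , a≢0 , lead refl λ { (suc n) _ → ≋⇒≈ P≋0 n })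

lead-unique : ∀ {c c′ d d′ P} → c ≢ 0ℤ → c′ ≢ 0ℤ → Lead c d P → Lead c′ d′ P → d ≡ d′
lead-unique {d = d} {d′} c≢0 c′≢0 l l′ with ℕₚ.<-cmp d d′
... | tri< d<d′ _ _ = contradiction (trans (sym (top l′)) (above l d′ d<d′)) c′≢0
... | tri≈ _ eq _   = eq
... | tri> _ _ d′<d = contradiction (trans (sym (top l)) (above l′ d d′<d)) c≢0

1≢0 : 1ℤ ≢ 0ℤ
1≢0 ()

monic-cancel : ∀ {N e} P Q → Monic N (P *ₚ Q) → Monic e Q → ∃[ d ] Monic d P
monic-cancel P Q mN mQ with zero⊎lead P
... | inj₁ P≋0 = contradiction (trans (sym (top mN)) (≋⇒≈ (*ₚ-congʳ Q P≋0) _)) 1≢0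
... | inj₂ (c , d , c≢0 , l) with lead-unique c≢0 1≢0 (lead-* P Q l mQ) mN
...   | refl = d , lead (trans (top l) (trans (sym (top (lead-* P Q l mQ))) (top mN))) (above l)

*ₚ-zero-cancelʳ : ∀ {e} P Q → Monic e Q → P *ₚ Q ≋ [] → P ≋ []
*ₚ-zero-cancelʳ P Q mQ z with zero⊎lead P
... | inj₁ P≋0 = P≋0
... | inj₂ (c , d , c≢0 , l) = contradiction (trans (sym (top (lead-* P Q l mQ))) (≋⇒≈ z _)) c≢0

-ₚ≋0⇒≋ : ∀ {P Q} → P -ₚ Q ≋ [] → P ≋ Q
-ₚ≋0⇒≋ {P} {Q} e = begin
  P              ≈⟨ ringₚ 2 (λ x y → x ⊜ (x ⊕ (⊝ y)) ⊕ y) ≋-refl P Q ⟩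
  P -ₚ Q +ₚ Q    ≈⟨ +ₚ-cong e (≋-refl {Q}) ⟩
  Q              ∎
  where open SetoidReasoning polySetoid

*ₚ-cancelʳ : ∀ {e} P Q R → Monic e R → P *ₚ R ≋ Q *ₚ R → P ≋ Q
*ₚ-cancelʳ P Q R mR eq = -ₚ≋0⇒≋ (*ₚ-zero-cancelʳ (P -ₚ Q) R mR (begin
  (P -ₚ Q) *ₚ R          ≈⟨ ringₚ 3 (λ p q r → (p ⊕ (⊝ q)) ⊗ r ⊜ p ⊗ r ⊕ (⊝ (q ⊗ r))) ≋-refl P Q R ⟩
  P *ₚ R -ₚ Q *ₚ R       ≈⟨ +ₚ-cong eq ≋-refl ⟩
  Q *ₚ R -ₚ Q *ₚ R       ≈⟨ ringₚ 1 (λ x → x ⊕ (⊝ x) ⊜ Κ []) ≋-refl (Q *ₚ R) ⟩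
  []                     ∎))
  where open SetoidReasoning polySetoid

≈[]⇒All-0 : ∀ P → P ≈ [] → All (_≡ 0ℤ) P
≈[]⇒All-0 []      z = []
≈[]⇒All-0 (a ∷ P) z = z 0 ∷ ≈[]⇒All-0 P (λ n → z (suc n))

degree-monic : ∀ {d} D → Monic d D → degree D ≡ d
degree-monic []            (lead () _)
degree-monic {zero} (a ∷ P) m
  rewrite dec-true (all? (ℤ._≟ 0ℤ) P) (≈[]⇒All-0 P (λ n → above m (suc n) (s≤s z≤n))) = refl
degree-monic {suc d} (a ∷ P) m
  rewrite dec-false (all? (ℤ._≟ 0ℤ) P) (λ z → 1≢0 (trans (sym (top m)) (All-0⇒≈[] P z d))) =
  cong suc (degree-monic P (lead (top m) (λ n lt → above m (suc n) (s≤s lt))))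

∷-cong : ∀ {a b P Q} → a ≡ b → P ≋ Q → (a ∷ P) ≋ (b ∷ Q)
∷-cong {a} refl e = pairwise λ f → cong (λ z → a ℤ.* f 0 ℤ.+ z) (pair-≡ e (λ n → f (suc n)))

divMod-spec : ∀ {d} D → Monic d D → ∀ P →
  P ≋ proj₁ (divMod P D) *ₚ D +ₚ proj₂ (divMod P D) × (∀ n → d ≤ n → coeff (proj₂ (divMod P D)) n ≡ 0ℤ)
divMod-spec D m [] = ≋-refl , (λ _ _ → refl)
divMod-spec {d} D m (a ∷ P) with divMod P D | divMod-spec D m P
... | Q , R | P≋ , R< rewrite degree-monic D m = eq , small
  where
  c = coeff (a ∷ R) d
  eq : (a ∷ P) ≋ (c ∷ Q) *ₚ D +ₚ ((a ∷ R) -ₚ c · D)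
  eq = begin
    a ∷ P                                                 ≈⟨ ∷-cong (sym (ℤₚ.+-identityˡ a)) P≋ ⟩
    (0ℤ ∷ (Q *ₚ D)) +ₚ (a ∷ R)
        ≈⟨ ringₚ 3 (λ x y z → x ⊕ y ⊜ (z ⊕ x) ⊕ (y ⊕ (⊝ z))) ≋-refl (0ℤ ∷ (Q *ₚ D)) (a ∷ R) (c · D) ⟩
    c · D +ₚ (0ℤ ∷ (Q *ₚ D)) +ₚ ((a ∷ R) -ₚ c · D)         ∎
    where open SetoidReasoning polySetoid
  coeff≡ : ∀ n → coeff ((a ∷ R) -ₚ c · D) n ≡ coeff (a ∷ R) n ℤ.+ -1ℤ ℤ.* (c ℤ.* coeff D n)
  coeff≡ n = trans (coeff-+ (a ∷ R) (-ₚ (c · D)) n)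
    (cong (λ z → coeff (a ∷ R) n ℤ.+ z)
    (trans (coeff-· -1ℤ (c · D) n) (cong (-1ℤ ℤ.*_) (coeff-· c D n))))
  neg : ∀ x → x ℤ.+ -1ℤ ℤ.* (x ℤ.* 1ℤ) ≡ 0ℤ
  neg = ℤ-Solver.solve-∀
  neg0 : ∀ x → 0ℤ ℤ.+ -1ℤ ℤ.* (x ℤ.* 0ℤ) ≡ 0ℤ
  neg0 = ℤ-Solver.solve-∀
  small : ∀ n → d ≤ n → coeff ((a ∷ R) -ₚ c · D) n ≡ 0ℤ
  small n d≤n with ℕₚ.m≤n⇒m<n∨m≡n d≤n
  ... | inj₂ refl = trans (coeff≡ n) (trans (cong (λ x → c ℤ.+ -1ℤ ℤ.* (c ℤ.* x)) (top m)) (neg c))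
  small (suc n) _ | inj₁ (s≤s d≤n) =
    trans (coeff≡ (suc n))
      (trans (cong₂ (λ x y → x ℤ.+ -1ℤ ℤ.* (c ℤ.* y)) (R< n d≤n) (above m (suc n) (s≤s d≤n))) (neg0 c))

-- The remainder is (Q - Q′) D. If Q and Q′ differed, its leading term would sit in degree at least
-- d, since D is monic; but the remainder has no coefficients there.
divMod-exact : ∀ {d} P Q D → Monic d D → Q *ₚ D ≋ P → proj₁ (divMod P D) ≋ Q
divMod-exact {d} P Q D m eq with divMod P D | divMod-spec D m P
... | Q′ , R | P≋ , R< with zero⊎lead (Q -ₚ Q′)
...   | inj₁ z = ≋-sym (-ₚ≋0⇒≋ z)
...   | inj₂ (c , e , c≢0 , l) = contradiction (trans (sym (top l*)) (R< (e ℕ.+ d) (ℕₚ.m≤n+m d e))) c≢0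
  where
  open SetoidReasoning polySetoid
  l* : Lead c (e ℕ.+ d) R
  l* = lead-resp (begin
    (Q -ₚ Q′) *ₚ D
        ≈⟨ ringₚ 3 (λ q q′ e → (q ⊕ (⊝ q′)) ⊗ e ⊜ q ⊗ e ⊕ (⊝ (q′ ⊗ e))) ≋-refl Q Q′ D ⟩
    Q *ₚ D -ₚ Q′ *ₚ D             ≈⟨ +ₚ-cong (≋-trans eq P≋) ≋-refl ⟩
    Q′ *ₚ D +ₚ R -ₚ Q′ *ₚ D       ≈⟨ ringₚ 2 (λ x y → x ⊕ y ⊕ (⊝ x) ⊜ y) ≋-refl (Q′ *ₚ D) R ⟩
    R ∎) (lead-* (Q -ₚ Q′) D l m)

-- The polynomials X^k - 1 and geometric sums

U : ℕ → Poly
U k = (X^ k) -ₚ 1ₚ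

X^-lead : ∀ k → Monic k (X^ k)
X^-lead zero    = lead refl λ { (suc n) _ → refl }
X^-lead (suc k) = lead (top (X^-lead k)) λ { (suc n) (s≤s lt) → above (X^-lead k) n lt }

U-monic : ∀ k → 1 ≤ k → Monic k (U k)
U-monic (suc k) _ =
  lead (trans (eq k) (top (X^-lead k))) λ { (suc n) (s≤s lt) → trans (eq n) (above (X^-lead k) n lt) }
  where
  eq : ∀ n → coeff ((X^ k) +ₚ []) n ≡ coeff (X^ k) n
  eq n = trans (coeff-+ (X^ k) [] n) (ℤₚ.+-identityʳ _)

X^-+ : ∀ a b → X^ (a ℕ.+ b) ≋ (X^ a) *ₚ (X^ b)
X^-+ a b = pairwise λ f → trans (pair-X^ (a ℕ.+ b) f)
  (sym (trans (pair-*ₚ (X^ a) (X^ b) f) (trans (pair-X^ a _) (pair-X^ b _))))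

-- The quotient (X^(nk) - 1)/(X^k - 1), which is also the mask polynomial of an n-term progression
-- with difference k.
geom : ℕ → ℕ → Poly
geom k zero    = []
geom k (suc n) = 1ₚ +ₚ (X^ k) *ₚ geom k n

U-+ : ∀ a b → U (a ℕ.+ b) ≋ U a +ₚ (X^ a) *ₚ U b
U-+ a b = begin
  (X^ (a ℕ.+ b)) -ₚ 1ₚ
    ≈⟨ +ₚ-cong (X^-+ a b) ≋-refl ⟩
  (X^ a) *ₚ (X^ b) -ₚ 1ₚ
    ≈⟨ ringₚ 3 (λ x y o → x ⊗ y ⊕ (⊝ o) ⊜ ((x ⊗ o) ⊕ (⊝ o)) ⊕ x ⊗ (y ⊕ (⊝ o))) ≋-refl (X^ a) (X^ b) 1ₚ ⟩
  ((X^ a) *ₚ 1ₚ -ₚ 1ₚ) +ₚ (X^ a) *ₚ U b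
    ≈⟨ +ₚ-cong (+ₚ-cong (≋-trans (*ₚ-comm (X^ a) 1ₚ) (*ₚ-identityˡ _)) ≋-refl) ≋-refl ⟩
  U a +ₚ (X^ a) *ₚ U b ∎
  where open SetoidReasoning polySetoid

geom-U : ∀ k n → geom k n *ₚ U k ≋ U (n ℕ.* k)
geom-U k zero    = pairwise λ f → refl
geom-U k (suc n) = begin
  (1ₚ +ₚ (X^ k) *ₚ geom k n) *ₚ U k
    ≈⟨ ringₚ 4 (λ o x g u → (o ⊕ x ⊗ g) ⊗ u ⊜ o ⊗ u ⊕ x ⊗ (g ⊗ u)) ≋-refl 1ₚ (X^ k) (geom k n) (U k) ⟩
  1ₚ *ₚ U k +ₚ (X^ k) *ₚ (geom k n *ₚ U k)
    ≈⟨ +ₚ-cong (*ₚ-identityˡ (U k)) (*ₚ-congˡ (X^ k) (geom-U k n)) ⟩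
  U k +ₚ (X^ k) *ₚ U (n ℕ.* k)
    ≈⟨ U-+ k (n ℕ.* k) ⟨
  U (k ℕ.+ n ℕ.* k) ∎
  where open SetoidReasoning polySetoid

∣ₚ-intro : ∀ {P R} Q → Q *ₚ P ≋ R → P ∣ₚ R
∣ₚ-intro Q e = record { quotient = Q ; equality = ≋⇒≈ e }

∣ₚ-elim : ∀ {P R} → P ∣ₚ R → ∃[ Q ] Q *ₚ P ≋ R
∣ₚ-elim {P} {R} d = _∣ʳ_.quotient d , ≈⇒≋ (_∣ʳ_.quotient d *ₚ P) R (_∣ʳ_.equality d)

-- Cyclotomic polynomials Φ n for n with at most two prime factors

U-cong : ∀ {a b} → a ≡ b → U a ≋ U b
U-cong refl = ≋-refl

prime-factor : ∀ e → 1 < e → ∃[ r ] Prime r × r ∣ e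
prime-factor e 1<e with factorise e {{ℕ.>-nonZero (ℕₚ.<-trans ℕ.z<s 1<e)}}
... | record { factors = [] ; isFactorisation = refl } = contradiction 1<e (ℕₚ.<-irrefl refl)
... | record { factors = r ∷ rs ; isFactorisation = eq ; factorsPrime = pr ∷ _ } =
  r , pr , subst (r ∣_) (sym eq) (m∣m*n _)

primes-coprime : ∀ {p q} → Prime p → Prime q → p ≢ q → Coprime p q
primes-coprime pp pq p≢q (d∣p , d∣q) with prime⇒irreducible pp d∣p
... | inj₁ d≡1  = d≡1
... | inj₂ refl with prime⇒irreducible pq d∣q
...   | inj₁ d≡1 = d≡1
...   | inj₂ p≡q = contradiction p≡q p≢q

-- With x a = 1 + y b (Bézout), U m = U (x a m) − X^m U (y b m) is a combination of
-- U (a m) and U (b m), both of which divide U (a b m).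
U-product-divides′ : ∀ a b m x y → 1 + y * b ≡ x * a →
  ∃[ Ψ ] Ψ *ₚ (U (a * m) *ₚ U (b * m)) ≋ U (a * (b * m)) *ₚ U m
U-product-divides′ a b m x y eq = Va *ₚ Ga -ₚ (X^ m) *ₚ (Gb *ₚ Vb) , (begin
  (Va *ₚ Ga -ₚ (X^ m) *ₚ (Gb *ₚ Vb)) *ₚ (A *ₚ B)
    ≈⟨ ringₚ 7 (λ v g x h w a b → (v ⊗ g ⊕ (⊝ (x ⊗ (h ⊗ w)))) ⊗ (a ⊗ b)
                                 ⊜ (v ⊗ b) ⊗ (g ⊗ a) ⊕ (⊝ (x ⊗ ((w ⊗ a) ⊗ (h ⊗ b))))) ≋-refl Va Ga
                                   (X^ m) Gb Vb A B ⟩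
  (Va *ₚ B) *ₚ (Ga *ₚ A) -ₚ (X^ m) *ₚ ((Vb *ₚ A) *ₚ (Gb *ₚ B))
    ≈⟨ minus-cong (mul-cong (geom-U (b * m) a) (geom-U (a * m) x))
         (*ₚ-congˡ (X^ m) (mul-cong (≋-trans (geom-U (a * m) b) (U-cong (swap a b m)))
           (geom-U (b * m) y))) ⟩
  N *ₚ U (x * (a * m)) -ₚ (X^ m) *ₚ (N *ₚ U (y * (b * m)))
    ≈⟨ minus-cong (*ₚ-congˡ N (≋-trans (U-cong eq′) (U-+ m (y * (b * m))))) ≋-refl ⟩
  N *ₚ (U m +ₚ (X^ m) *ₚ U (y * (b * m))) -ₚ (X^ m) *ₚ (N *ₚ U (y * (b * m)))
    ≈⟨ ringₚ 4 (λ n u x w → n ⊗ (u ⊕ x ⊗ w) ⊕ (⊝ (x ⊗ (n ⊗ w))) ⊜ n ⊗ u) ≋-refl N (U m) (X^ m)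
        (U (y * (b * m))) ⟩
  N *ₚ U m ∎)
  where
  open SetoidReasoning polySetoid
  A = U (a * m)
  B = U (b * m)
  N = U (a * (b * m))
  Va = geom (b * m) a
  Vb = geom (a * m) b
  Ga = geom (a * m) x
  Gb = geom (b * m) y
  swap : ∀ a b m → b * (a * m) ≡ a * (b * m)
  swap = solve-∀
  eq′ : x * (a * m) ≡ m + y * (b * m)
  eq′ = trans (sym (ℕₚ.*-assoc x a m)) (trans (cong (_* m) (sym eq)) (cong (m +_) (ℕₚ.*-assoc y b m)))
  mul-cong : ∀ {P P′ Q Q′} → P ≋ P′ → Q ≋ Q′ → P *ₚ Q ≋ P′ *ₚ Q′
  mul-cong {P′ = P′} {Q} e e′ = ≋-trans (*ₚ-congʳ Q e) (*ₚ-congˡ P′ e′)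
  minus-cong : ∀ {P P′ Q Q′} → P ≋ P′ → Q ≋ Q′ → P -ₚ Q ≋ P′ -ₚ Q′
  minus-cong e e′ = +ₚ-cong e (-ₚ-cong e′)

U-product-divides : ∀ a b m → Coprime a b →
  ∃[ Ψ ] Ψ *ₚ (U (a * m) *ₚ U (b * m)) ≋ U (a * (b * m)) *ₚ U m
U-product-divides a b m c with coprime-Bézout c
... | Bézout.+- x y eq = U-product-divides′ a b m x y eq
... | Bézout.-+ x y eq =
  let Ψ , e = U-product-divides′ b a m y x eq
  in Ψ , (begin
    Ψ *ₚ (U (a * m) *ₚ U (b * m)) ≈⟨ *ₚ-congˡ Ψ (*ₚ-comm (U (a * m)) (U (b * m))) ⟩
    Ψ *ₚ (U (b * m) *ₚ U (a * m)) ≈⟨ e ⟩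
    U (b * (a * m)) *ₚ U m        ≈⟨ *ₚ-congʳ (U m) (U-cong (swap a b m)) ⟩
    U (a * (b * m)) *ₚ U m        ∎)
  where
  open SetoidReasoning polySetoid
  swap : ∀ a b m → b * (a * m) ≡ a * (b * m)
  swap = solve-∀

∏Φ-∣ : ∀ n k → suc k ∣ n → ∏Φ n (suc k) ≡ Φ (suc k) *ₚ ∏Φ n k
∏Φ-∣ n k d rewrite dec-true (suc k ∣? n) d = refl

∏Φ-∤ : ∀ n k → suc k ∤ n → ∏Φ n (suc k) ≡ ∏Φ n k
∏Φ-∤ n k d rewrite dec-false (suc k ∣? n) d = refl

∏Φ-beyond : ∀ n t → 1 ≤ n → ∏Φ n (t + n) ≡ ∏Φ n n
∏Φ-beyond n zero    1≤n = refl
∏Φ-beyond n (suc t) 1≤n = trans (∏Φ-∤ n (t + n) (>⇒∤ {{ℕ.>-nonZero 1≤n}} (s≤s (ℕₚ.m≤n+m n t))))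
  (∏Φ-beyond n t 1≤n)

∏Φ-≥ : ∀ {n k} → 1 ≤ n → n ≤ k → ∏Φ n k ≡ ∏Φ n n
∏Φ-≥ {n} {k} 1≤n n≤k = trans (cong (∏Φ n) (sym (ℕₚ.m∸n+n≡m n≤k))) (∏Φ-beyond n (k ∸ n) 1≤n)

-- `Φ n` is defined by a long division, which carries no information until the divisor is known to
-- be monic and to divide X^n - 1. Any exact quotient Q certifies this.
Φ-spec : ∀ {d} n′ → let n = suc n′ in Monic d (∏Φ n n′) → ∀ Q → Q *ₚ ∏Φ n n′ ≋ U n →
  Φ n *ₚ ∏Φ n n′ ≋ U n × ∏Φ n n ≋ U n
Φ-spec n′ m Q eq = spec , ≋-trans (≋-reflexive (∏Φ-∣ (suc n′) n′ ∣-refl)) spec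
  where
  spec : Φ (suc n′) *ₚ ∏Φ (suc n′) n′ ≋ U (suc n′)
  spec = ≋-trans (*ₚ-congʳ _ (divMod-exact (U (suc n′)) Q (∏Φ (suc n′) n′) m eq)) eq

OnlyPrimes : ℕ → ℕ → ℕ → Set
OnlyPrimes p q n = ∀ r → Prime r → r ∣ n → r ≡ p ⊎ r ≡ q

-- Take for r a prime factor of n / d, which exceeds 1.
proper-divisor : ∀ {d n} → 1 ≤ n → d < n → d ∣ n → ∃[ r ] Prime r × ∃[ m ] (n ≡ r * m × d ∣ m)
proper-divisor {d} {n} 1≤n d<n (divides zero refl) = contradiction 1≤n λ ()
proper-divisor {d} {n} 1≤n d<n (divides 1 refl) =
  contradiction d<n (ℕₚ.<-irrefl (sym (ℕₚ.+-identityʳ d)))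
proper-divisor {d} {n} 1≤n d<n (divides (suc (suc e)) refl) with prime-factor (suc (suc e))
  (s≤s (s≤s z≤n))
... | r , pr , divides k eq = r , pr , k * d , trans (cong (_* d) (trans eq (ℕₚ.*-comm k r)))
    (ℕₚ.*-assoc r k d) , n∣m*n k

-- Inclusion–exclusion: the divisors of n other than n are those of n/p together with
-- those of n/q, and the common ones are the divisors of n/(pq).
∏Φ-incl-excl : ∀ {p q m} → Prime p → Prime q → p ≢ q → 1 ≤ m → OnlyPrimes p q (p * (q * m)) →
  ∀ k → k < p * (q * m) →
  ∏Φ (p * (q * m)) k *ₚ ∏Φ m k ≋ ∏Φ (p * m) k *ₚ ∏Φ (q * m) k
∏Φ-incl-excl pp pq p≢q 1≤m only zero k< = ≋-refl
∏Φ-incl-excl {p} {q} {m} pp pq p≢q 1≤m only (suc k) k< = step (suc k ∣? p * m) (suc k ∣? q * m)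
  where
  open SetoidReasoning polySetoid
  n = p * (q * m)
  instance
    nzp = prime⇒nonZero pp
    nzq = prime⇒nonZero pq
  IH = ∏Φ-incl-excl pp pq p≢q 1≤m only k (ℕₚ.<-trans (ℕₚ.n<1+n k) k<)
  d = suc k
  n≡ : n ≡ q * (p * m)
  n≡ = swap p q m
    where
    swap : ∀ p q m → p * (q * m) ≡ q * (p * m)
    swap = solve-∀
  up : d ∣ p * m → d ∣ n
  up d∣ = ∣-trans d∣ (subst (p * m ∣_) (sym n≡) (n∣m*n q))
  uq : d ∣ q * m → d ∣ n
  uq d∣ = ∣-trans d∣ (n∣m*n p)
  -- A divisor d < n divides n / r for some prime r, and r can only be p or q.
  d∤n : d ∤ p * m → d ∤ q * m → d ∤ n
  d∤n dp dq d∣n with proper-divisor (ℕₚ.≤-trans (s≤s z≤n) k<) k< d∣n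
  ... | r , pr , m′ , eq , d∣m′ with only r pr (subst (r ∣_) (sym eq) (m∣m*n m′))
  ...   | inj₁ refl = dq (subst (d ∣_) (ℕₚ.*-cancelˡ-≡ m′ (q * m) p (sym eq)) d∣m′)
  ...   | inj₂ refl = dp (subst (d ∣_) (ℕₚ.*-cancelˡ-≡ m′ (p * m) q (trans (sym eq) n≡)) d∣m′)
  step : Dec (d ∣ p * m) → Dec (d ∣ q * m) →
    ∏Φ n (suc k) *ₚ ∏Φ m (suc k) ≋ ∏Φ (p * m) (suc k) *ₚ ∏Φ (q * m) (suc k)
  step (yes dp) (yes dq)
    rewrite ∏Φ-∣ n k (up dp) | ∏Φ-∣ m k (coprime-factors (primes-coprime pp pq p≢q) (dp , dq))
          | ∏Φ-∣ (p * m) k dp | ∏Φ-∣ (q * m) k dq = begin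
      (Φ d *ₚ ∏Φ n k) *ₚ (Φ d *ₚ ∏Φ m k)
        ≈⟨ ringₚ 3 (λ f x y → (f ⊗ x) ⊗ (f ⊗ y) ⊜ f ⊗ f ⊗ (x ⊗ y)) ≋-refl (Φ d) (∏Φ n k) (∏Φ m k) ⟩
      Φ d *ₚ Φ d *ₚ (∏Φ n k *ₚ ∏Φ m k)
        ≈⟨ *ₚ-congˡ (Φ d *ₚ Φ d) IH ⟩
      Φ d *ₚ Φ d *ₚ (∏Φ (p * m) k *ₚ ∏Φ (q * m) k)
        ≈⟨ ringₚ 3 (λ f x y → f ⊗ f ⊗ (x ⊗ y) ⊜ (f ⊗ x) ⊗ (f ⊗ y)) ≋-refl (Φ d) (∏Φ (p * m) k)
            (∏Φ (q * m) k) ⟩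
      (Φ d *ₚ ∏Φ (p * m) k) *ₚ (Φ d *ₚ ∏Φ (q * m) k) ∎
  step (yes dp) (no dq)
    rewrite ∏Φ-∣ n k (up dp) | ∏Φ-∤ m k (λ dm → dq (∣-trans dm (n∣m*n q)))
          | ∏Φ-∣ (p * m) k dp | ∏Φ-∤ (q * m) k dq = begin
      (Φ d *ₚ ∏Φ n k) *ₚ ∏Φ m k        ≈⟨ *ₚ-assoc (Φ d) (∏Φ n k) (∏Φ m k) ⟩
      Φ d *ₚ (∏Φ n k *ₚ ∏Φ m k)        ≈⟨ *ₚ-congˡ (Φ d) IH ⟩
      Φ d *ₚ (∏Φ (p * m) k *ₚ ∏Φ (q * m) k) ≈⟨ *ₚ-assoc (Φ d) (∏Φ (p * m) k) (∏Φ (q * m) k) ⟨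
      (Φ d *ₚ ∏Φ (p * m) k) *ₚ ∏Φ (q * m) k ∎
  step (no dp) (yes dq)
    rewrite ∏Φ-∣ n k (uq dq) | ∏Φ-∤ m k (λ dm → dp (∣-trans dm (n∣m*n p)))
          | ∏Φ-∤ (p * m) k dp | ∏Φ-∣ (q * m) k dq = begin
      (Φ d *ₚ ∏Φ n k) *ₚ ∏Φ m k        ≈⟨ *ₚ-assoc (Φ d) (∏Φ n k) (∏Φ m k) ⟩
      Φ d *ₚ (∏Φ n k *ₚ ∏Φ m k)        ≈⟨ *ₚ-congˡ (Φ d) IH ⟩
      Φ d *ₚ (∏Φ (p * m) k *ₚ ∏Φ (q * m) k)
        ≈⟨ ringₚ 3 (λ f x y → f ⊗ (x ⊗ y) ⊜ x ⊗ (f ⊗ y)) ≋-refl (Φ d) (∏Φ (p * m) k) (∏Φ (q * m) k) ⟩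
      ∏Φ (p * m) k *ₚ (Φ d *ₚ ∏Φ (q * m) k) ∎
  step (no dp) (no dq)
    rewrite ∏Φ-∤ n k (d∤n dp dq) | ∏Φ-∤ m k (λ dm → dp (∣-trans dm (n∣m*n p)))
          | ∏Φ-∤ (p * m) k dp | ∏Φ-∤ (q * m) k dq = IH

-- A proper divisor divides n / r for some prime r, and here r must be p.
∏Φ-prime-power : ∀ {p m} → Prime p → 1 ≤ m → OnlyPrimes p p (p * m) → ∀ k → k < p * m →
  ∏Φ (p * m) k ≡ ∏Φ m k
∏Φ-prime-power pp 1≤m only zero k< = refl
∏Φ-prime-power {p} {m} pp 1≤m only (suc k) k< = step (suc k ∣? m)
  where
  IH = ∏Φ-prime-power pp 1≤m only k (ℕₚ.<-trans (ℕₚ.n<1+n k) k<)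
  d∤n : suc k ∤ m → suc k ∤ p * m
  d∤n d∤m d∣n with proper-divisor (ℕₚ.≤-trans (s≤s z≤n) k<) k< d∣n
  ... | r , pr , m′ , eq , d∣m′ with reduce (only r pr (subst (r ∣_) (sym eq) (m∣m*n m′)))
  ...   | refl = d∤m (subst (suc k ∣_) (ℕₚ.*-cancelˡ-≡ m′ m p {{prime⇒nonZero pp}} (sym eq)) d∣m′)
  step : Dec (suc k ∣ m) → ∏Φ (p * m) (suc k) ≡ ∏Φ m (suc k)
  step (yes d∣m) = trans (∏Φ-∣ (p * m) k (∣-trans d∣m (n∣m*n p)))
    (trans (cong (Φ (suc k) *ₚ_) IH) (sym (∏Φ-∣ m k d∣m)))
  step (no d∤m) = trans (∏Φ-∤ (p * m) k (d∤n d∤m)) (trans IH (sym (∏Φ-∤ m k d∤m)))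

*-pos : ∀ {m n} → 1 ≤ m → 1 ≤ n → 1 ≤ m * n
*-pos 1≤m 1≤n = ℕₚ.*-mono-≤ 1≤m 1≤n

^-pos : ∀ {m} n → 1 ≤ m → 1 ≤ m ^ n
^-pos zero    1≤m = s≤s z≤n
^-pos (suc n) 1≤m = *-pos 1≤m (^-pos n 1≤m)

prime-pos : ∀ {p} → Prime p → 1 ≤ p
prime-pos pp = ℕ.>-nonZero⁻¹ _ {{prime⇒nonZero pp}}

prime>1 : ∀ {p} → Prime p → 1 < p
prime>1 pp = ℕ.nonTrivial⇒n>1 _ {{prime⇒nonTrivial pp}}

m<n*m : ∀ {m n} → 1 ≤ m → 1 < n → m < n * m
m<n*m {m} {n} 1≤m 1<n = subst (m <_) (ℕₚ.*-comm m n) (ℕₚ.m<m*n m n {{ℕ.>-nonZero 1≤m}} 1<n)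

-- The classical identity that the Φ_d with d dividing n multiply to X^n - 1. It is carried along
-- because the next cyclotomic polynomial is defined through it.
Full-Φ : ℕ → Set
Full-Φ n = ∏Φ n n ≋ U n

Φ-one-prime : ∀ {p m} → Prime p → 1 ≤ m → OnlyPrimes p p (p * m) → Full-Φ m →
  Φ (p * m) *ₚ U m ≋ U (p * m) × Full-Φ (p * m)
Φ-one-prime {p} {m} pp 1≤m only full = go (p * m) refl
  where
  open SetoidReasoning polySetoid
  -- The index is generalised so that it can be matched as `suc n′`, the form on which `Φ` unfolds.
  go : ∀ n → n ≡ p * m → Φ n *ₚ U m ≋ U n × Full-Φ n
  go zero    n≡ = contradiction (subst (1 ≤_) (sym n≡) (*-pos (prime-pos pp) 1≤m)) λ ()
  go (suc n′) n≡ =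
    let Q≋ : geom m p *ₚ ∏Φ (suc n′) n′ ≋ U (suc n′)
        Q≋ = ≋-trans (*ₚ-congˡ (geom m p) D≋) (≋-trans (geom-U m p) (U-cong (sym n≡)))
        e , f = Φ-spec n′ (lead-resp (≋-sym D≋) (U-monic m 1≤m)) (geom m p) Q≋
    in ≋-trans (*ₚ-congˡ (Φ (suc n′)) (≋-sym D≋)) e , f
    where
    m≤n′ : m ≤ n′
    m≤n′ = ℕₚ.≤-pred (subst (m <_) (sym n≡) (m<n*m 1≤m (prime>1 pp)))
    D≋ : ∏Φ (suc n′) n′ ≋ U m
    D≋ = begin
      ∏Φ (suc n′) n′ ≈⟨ ≋-reflexive (cong (λ z → ∏Φ z n′) n≡) ⟩
      ∏Φ (p * m) n′  ≈⟨ ≋-reflexive (∏Φ-prime-power pp 1≤m only n′ (subst (n′ <_) n≡ (ℕₚ.n<1+n n′))) ⟩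
      ∏Φ m n′        ≈⟨ ≋-reflexive (∏Φ-≥ 1≤m m≤n′) ⟩
      ∏Φ m m         ≈⟨ full ⟩
      U m            ∎

-- Let D be the product of the Φ_d over the proper divisors d of n. Inclusion-exclusion gives D (X^m
-- - 1) = (X^(pm) - 1)(X^(qm) - 1). Hence D is monic, and `U-product-divides` becomes an exact
-- division of X^n - 1 by D once X^m - 1 is cancelled.
Φ-two-primes : ∀ {p q m} → Prime p → Prime q → p ≢ q → 1 ≤ m → OnlyPrimes p q (p * (q * m)) →
  Full-Φ m → Full-Φ (p * m) → Full-Φ (q * m) →
  Φ (p * (q * m)) *ₚ (U (p * m) *ₚ U (q * m)) ≋ U (p * (q * m)) *ₚ U m × Full-Φ (p * (q * m))
    × Φ (p * (q * m)) ∣ₚ U (p * (q * m))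
Φ-two-primes {p} {q} {m} pp pq p≢q 1≤m only fm fp fq = go (p * (q * m)) refl
  where
  open SetoidReasoning polySetoid
  1≤pm = *-pos (prime-pos pp) 1≤m
  1≤qm = *-pos (prime-pos pq) 1≤m
  go : ∀ n → n ≡ p * (q * m) → Φ n *ₚ (U (p * m) *ₚ U (q * m)) ≋ U n *ₚ U m × Full-Φ n × Φ n ∣ₚ U n
  go zero    n≡ = contradiction (subst (1 ≤_) (sym n≡) (*-pos (prime-pos pp) 1≤qm)) λ ()
  go (suc n′) n≡ =
    (begin
      Φ n *ₚ (U (p * m) *ₚ U (q * m))  ≈⟨ *ₚ-congˡ (Φ n) D*U ⟨
      Φ n *ₚ (D *ₚ U m)                ≈⟨ *ₚ-assoc (Φ n) D (U m) ⟨
      (Φ n *ₚ D) *ₚ U m                ≈⟨ *ₚ-congʳ (U m) (proj₁ spec) ⟩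
      U n *ₚ U m                       ∎)
    , proj₂ spec
    , ∣ₚ-intro D (≋-trans (*ₚ-comm D (Φ n)) (proj₁ spec))
    where
    n = suc n′
    D = ∏Φ n n′
    pm≤ : p * m ≤ n′
    pm≤ = ℕₚ.≤-pred (subst (p * m <_) (trans (swap q p m) (sym n≡)) (m<n*m 1≤pm (prime>1 pq)))
      where
      swap : ∀ q p m → q * (p * m) ≡ p * (q * m)
      swap = solve-∀
    qm≤ : q * m ≤ n′
    qm≤ = ℕₚ.≤-pred (subst (q * m <_) (sym n≡) (m<n*m 1≤qm (prime>1 pp)))
    m≤ : m ≤ n′
    m≤ = ℕₚ.≤-trans (ℕₚ.m≤n*m m p {{prime⇒nonZero pp}}) pm≤
    D*U : D *ₚ U m ≋ U (p * m) *ₚ U (q * m)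
    D*U = begin
      D *ₚ U m
        ≈⟨ *ₚ-congˡ D fm ⟨
      D *ₚ ∏Φ m m
        ≈⟨ ≋-reflexive (cong₂ _*ₚ_ (cong (λ z → ∏Φ z n′) n≡) (sym (∏Φ-≥ 1≤m m≤))) ⟩
      ∏Φ (p * (q * m)) n′ *ₚ ∏Φ m n′
        ≈⟨ ∏Φ-incl-excl pp pq p≢q 1≤m only n′ (subst (n′ <_) n≡ (ℕₚ.n<1+n n′)) ⟩
      ∏Φ (p * m) n′ *ₚ ∏Φ (q * m) n′
        ≈⟨ ≋-reflexive (cong₂ _*ₚ_ (∏Φ-≥ 1≤pm pm≤) (∏Φ-≥ 1≤qm qm≤)) ⟩
      ∏Φ (p * m) (p * m) *ₚ ∏Φ (q * m) (q * m)
        ≈⟨ ≋-trans (*ₚ-congʳ _ fp) (*ₚ-congˡ (U (p * m)) fq) ⟩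
      U (p * m) *ₚ U (q * m) ∎
    monicD = monic-cancel D (U m)
      (lead-resp (≋-sym D*U) (lead-* (U (p * m)) (U (q * m)) (U-monic (p * m) 1≤pm)
        (U-monic (q * m) 1≤qm)))
      (U-monic m 1≤m)
    quot = U-product-divides p q m (primes-coprime pp pq p≢q)
    Ψ = proj₁ quot
    ΨD : Ψ *ₚ D ≋ U n
    ΨD = *ₚ-cancelʳ (Ψ *ₚ D) (U n) (U m) (U-monic m 1≤m) (begin
      (Ψ *ₚ D) *ₚ U m                 ≈⟨ *ₚ-assoc Ψ D (U m) ⟩
      Ψ *ₚ (D *ₚ U m)                 ≈⟨ *ₚ-congˡ Ψ D*U ⟩
      Ψ *ₚ (U (p * m) *ₚ U (q * m))   ≈⟨ proj₂ quot ⟩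
      U (p * (q * m)) *ₚ U m          ≈⟨ *ₚ-congʳ (U m) (U-cong (sym n≡)) ⟩
      U n *ₚ U m                      ∎)
    spec = Φ-spec n′ (proj₂ monicD) Ψ ΨD

prime-∣-^ : ∀ {r p} → Prime r → Prime p → ∀ i → r ∣ p ^ i → r ≡ p
prime-∣-^ pr pp zero    d = contradiction (∣1⇒≡1 d) (λ r≡1 → ℕₚ.<-irrefl (sym r≡1) (prime>1 pr))
prime-∣-^ {r} {p} pr pp (suc i) d with euclidsLemma p (p ^ i) pr d
... | inj₂ d′ = prime-∣-^ pr pp i d′
... | inj₁ d′ with prime⇒irreducible pp d′
...   | inj₁ r≡1 = contradiction r≡1 (λ r≡1 → ℕₚ.<-irrefl (sym r≡1) (prime>1 pr))
...   | inj₂ r≡p = r≡p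

onlyPrimes : ∀ {p q} → Prime p → Prime q → ∀ i j → OnlyPrimes p q (p ^ i * q ^ j)
onlyPrimes {p} {q} pp pq i j r pr d with euclidsLemma (p ^ i) (q ^ j) pr d
... | inj₁ d′ = inj₁ (prime-∣-^ pr pp i d′)
... | inj₂ d′ = inj₂ (prime-∣-^ pr pq j d′)

Full-Φ-1 : Full-Φ 1
Full-Φ-1 = ≈⇒≋ (∏Φ 1 1) (U 1) λ { 0 → refl ; 1 → refl ; (suc (suc n)) → refl }

Full-Φ-^ : ∀ {p} → Prime p → ∀ i → Full-Φ (p ^ i)
Full-Φ-^ pp zero    = Full-Φ-1
Full-Φ-^ {p} pp (suc i) =
  proj₂ (Φ-one-prime pp (^-pos i (prime-pos pp)) (λ r pr d → inj₁ (prime-∣-^ pr pp (suc i) d))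
    (Full-Φ-^ pp i))

module _ {p q : ℕ} (pp : Prime p) (pq : Prime q) (p≢q : p ≢ q) where

  private
    regroup : ∀ i j → p ^ suc i * q ^ suc j ≡ p * (q * (p ^ i * q ^ j))
    regroup i j = lem p q (p ^ i) (q ^ j)
      where
      lem : ∀ p q x y → p * x * (q * y) ≡ p * (q * (x * y))
      lem = solve-∀

  onlyPrimes-both : ∀ i j → OnlyPrimes p q (p * (q * (p ^ i * q ^ j)))
  onlyPrimes-both i j = subst (OnlyPrimes p q) (regroup i j) (onlyPrimes pp pq (suc i) (suc j))

  Full-Φ-^^ : ∀ i j → Full-Φ (p ^ i * q ^ j)
  Φ-^^ : ∀ i j → let m = p ^ i * q ^ j ; n = p * (q * m) in
    Φ n *ₚ (U (p * m) *ₚ U (q * m)) ≋ U n *ₚ U m × Full-Φ n × Φ n ∣ₚ U n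

  Full-Φ-^^ zero    j       = subst Full-Φ (sym (ℕₚ.+-identityʳ (q ^ j))) (Full-Φ-^ pq j)
  Full-Φ-^^ (suc i) zero    = subst Full-Φ (sym (ℕₚ.*-identityʳ (p ^ suc i))) (Full-Φ-^ pp (suc i))
  Full-Φ-^^ (suc i) (suc j) = subst Full-Φ (sym (regroup i j)) (proj₁ (proj₂ (Φ-^^ i j)))

  Φ-^^ i j = Φ-two-primes pp pq p≢q (*-pos (^-pos i (prime-pos pp)) (^-pos j (prime-pos pq)))
    (onlyPrimes-both i j)
    (Full-Φ-^^ i j)
    (subst Full-Φ (ℕₚ.*-assoc p (p ^ i) (q ^ j)) (Full-Φ-^^ (suc i) j))
    (subst Full-Φ (swap (p ^ i) q (q ^ j)) (Full-Φ-^^ i (suc j)))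
    where
    swap : ∀ x q y → x * (q * y) ≡ q * (x * y)
    swap = solve-∀

-- Exchange identities from cyclotomic divisibility

mask : List ℕ → Poly
mask = foldr (λ a P → (X^ a) +ₚ P) []

∑ : List ℕ → (ℕ → ℤ) → ℤ
∑ A f = foldr (λ a s → f a ℤ.+ s) 0ℤ A

pair-mask : ∀ A f → ⟪ mask A , f ⟫ ≡ ∑ A f
pair-mask []      f = refl
pair-mask (a ∷ A) f = trans (pair-+ˡ (X^ a) (mask A) f) (cong₂ ℤ._+_ (pair-X^ a f) (pair-mask A f))

infix 4 _Periodic_

_Periodic_ : ℕ → (ℕ → ℤ) → Set
m Periodic f = ∀ n → f (n + m) ≡ f n

periodic-* : ∀ {m f} t → m Periodic f → (t * m) Periodic f
periodic-* {f = f} zero    per n = cong f (ℕₚ.+-identityʳ n)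
periodic-* {m} {f} (suc t) per n =
  trans (cong f (sym (ℕₚ.+-assoc n m (t * m)))) (trans (periodic-* t per (n + m)) (per n))

Δ : ℕ → (ℕ → ℤ) → ℕ → ℤ
Δ k f n = f (n + k) ℤ.- f n

-- The bridge from divisibility to sums: a factor X^k - 1 of the polynomial moves to the test
-- function as a difference.
pair-U : ∀ P k f → ⟪ P *ₚ U k , f ⟫ ≡ ⟪ P , Δ k f ⟫
pair-U P k f = trans (pair-*ₚ P (U k) f) (pair-cong P λ n →
  trans (pair-+ˡ (X^ k) (-ₚ 1ₚ) _) (cong₂ ℤ._+_ (pair-X^ k _)
    (trans (lem (f (n + 0))) (cong (λ z → ℤ.- f z) (ℕₚ.+-identityʳ n)))))
  where
  lem : ∀ x → -1ℤ ℤ.* 1ℤ ℤ.* x ℤ.+ 0ℤ ≡ ℤ.- x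
  lem = ℤ-Solver.solve-∀

pair-U-periodic : ∀ P n f → n Periodic f → ⟪ P *ₚ U n , f ⟫ ≡ 0ℤ
pair-U-periodic P n f per =
  trans (pair-U P n f) (pair-0ʳ P _ (λ k → trans (cong (ℤ._- f k) (per k)) (ℤₚ.+-inverseʳ (f k))))

-- The exponent is shifted: this concerns p^(i+1). With g the indicator of a residue class it says
-- that the residues r and r - p^i modulo p^(i+1) occur equally often in A, so each class modulo p^i
-- is divided evenly.
Equidistributed : ℕ → ℕ → List ℕ → Set
Equidistributed p i A = ∀ g → (p ^ suc i) Periodic g → ∑ A (Δ (p ^ i) g) ≡ 0ℤ

Exchange : ℕ → ℕ → ℕ → ℕ → List ℕ → Set
Exchange p q i j A = ∀ g h → (p ^ suc i) Periodic g → (q ^ suc j) Periodic h →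
  ∑ A (λ n → Δ (p ^ i) g n ℤ.* Δ (q ^ j) h n) ≡ 0ℤ

-- Multiplying by X^(p^i) - 1 completes Φ to X^(p^(i+1)) - 1, which annihilates every g of that
-- period.
Φ∣⇒equidistributed : ∀ {p i A} → Φ (p ^ suc i) *ₚ U (p ^ i) ≋ U (p ^ suc i) →
  Φ (p ^ suc i) ∣ₚ mask A → Equidistributed p i A
Φ∣⇒equidistributed {p} {i} {A} eq div g per with ∣ₚ-elim div
... | Q , Q≋ = begin
  ∑ A (Δ k g)                     ≡⟨ pair-mask A _ ⟨
  ⟪ mask A , Δ k g ⟫              ≡⟨ pair-≡ Q≋ _ ⟨
  ⟪ Q *ₚ Φ n , Δ k g ⟫            ≡⟨ pair-U (Q *ₚ Φ n) k g ⟨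
  ⟪ Q *ₚ Φ n *ₚ U k , g ⟫         ≡⟨ pair-≡ (≋-trans (*ₚ-assoc Q (Φ n) (U k)) (*ₚ-congˡ Q eq)) g ⟩
  ⟪ Q *ₚ U n , g ⟫                ≡⟨ pair-U-periodic Q n g per ⟩
  0ℤ                              ∎
  where
  open ≡-Reasoning
  n = p ^ suc i
  k = p ^ i

inverse-mod : ∀ p a → 1 < p → Coprime a p → ∃[ t ] ∃[ w ] t * a ≡ 1 + w * p
inverse-mod p a 1<p c with coprime-Bézout c
... | Bézout.+- x y eq = x , y , sym eq
inverse-mod 1 a (s≤s ()) c | Bézout.-+ x y eq
inverse-mod (suc (suc p)) a _ c | Bézout.-+ x zero eq = contradiction eq λ ()
inverse-mod (suc (suc p)) a _ c | Bézout.-+ x (suc y) eq =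
  -- Bézout in this form makes -x the inverse of `a`. Modulo the modulus `2 + p` it is represented
  -- by x times `1 + p`.
  x * suc p , y + p * suc y , ℕₚ.+-cancelʳ-≡ (suc p) _ _
    (trans (l x p a) (trans (cong (suc p *_) eq) (r p y)))
  where
  l : ∀ x p a → x * (1 + p) * a + (1 + p) ≡ (1 + p) * (1 + x * a)
  l = solve-∀
  r : ∀ p y → (1 + p) * ((1 + y) * (2 + p)) ≡ 1 + (y + p * (1 + y)) * (2 + p) + (1 + p)
  r = solve-∀

coprime-^ : ∀ {p q} → Prime p → Prime q → p ≢ q → ∀ j → Coprime (q ^ j) p
coprime-^ {p} {q} pp pq p≢q j {d} (d∣q^j , d∣p) with d ℕ.≟ 1
... | yes d≡1 = d≡1
... | no d≢1 with prime⇒irreducible pp d∣p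
...   | inj₁ d≡1 = d≡1
...   | inj₂ refl = contradiction (prime-∣-^ pp pq j d∣q^j) p≢q

-- Multiplying by (X^a - 1)(X^b - 1), with a a multiple of q m and b a multiple of p m, completes
-- Φ_n to a multiple of X^n - 1, which annihilates the product g h. The multiples are chosen so that
-- a is p^i modulo p^(i+1) and 0 modulo q^(j+1), and symmetrically for b. Thus the difference by a
-- acts on g alone and the difference by b on h alone.
Φ∣⇒exchange : ∀ {p q} → Prime p → Prime q → p ≢ q → ∀ i j {A} →
  let m = p ^ i * q ^ j ; n = p * (q * m) in
  Φ n *ₚ (U (p * m) *ₚ U (q * m)) ≋ U n *ₚ U m → Φ n ∣ₚ mask A → Exchange p q i j A
Φ∣⇒exchange {p} {q} pp pq p≢q i j {A} eq div g h perg perh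
  with ∣ₚ-elim div | inverse-mod p (q ^ suc j) (prime>1 pp) (coprime-^ pp pq p≢q (suc j))
     | inverse-mod q (p ^ suc i) (prime>1 pq) (coprime-^ pq pp (λ e → p≢q (sym e)) (suc i))
... | Q , Q≋ | t , w , teq | u , v , ueq = begin
  ∑ A (λ n → Δ (p ^ i) g n ℤ.* Δ (q ^ j) h n)
    ≡⟨ pair-mask A _ ⟨
  ⟪ mask A , (λ n → Δ (p ^ i) g n ℤ.* Δ (q ^ j) h n) ⟫
    ≡⟨ pair-cong (mask A) expand ⟨
  ⟪ mask A , Δ a (Δ b f) ⟫
    ≡⟨ pair-U (mask A) a (Δ b f) ⟨
  ⟪ mask A *ₚ U a , Δ b f ⟫
    ≡⟨ pair-U (mask A *ₚ U a) b f ⟨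
  ⟪ mask A *ₚ U a *ₚ U b , f ⟫
    ≡⟨ pair-≡ poly f ⟩
  ⟪ Q *ₚ (Ga *ₚ Gb) *ₚ U m *ₚ U n , f ⟫
    ≡⟨ pair-U-periodic (Q *ₚ (Ga *ₚ Gb) *ₚ U m) n f perf ⟩
  0ℤ ∎
  where
  open ≡-Reasoning
  m = p ^ i * q ^ j
  n = p * (q * m)
  a = t * (q * m)
  b = u * (p * m)
  Ga = geom (q * m) t
  Gb = geom (p * m) u
  f : ℕ → ℤ
  f x = g x ℤ.* h x

  poly : mask A *ₚ U a *ₚ U b ≋ Q *ₚ (Ga *ₚ Gb) *ₚ U m *ₚ U n
  poly = R.begin
    mask A *ₚ U a *ₚ U b
      R.≈⟨ *ₚ-congʳ (U b) (*ₚ-congʳ (U a) Q≋) ⟨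
    Q *ₚ Φ n *ₚ U a *ₚ U b
      R.≈⟨ *ₚ-congʳ (U b) (*ₚ-congˡ (Q *ₚ Φ n) (geom-U (q * m) t)) ⟨
    Q *ₚ Φ n *ₚ (Ga *ₚ U (q * m)) *ₚ U b
      R.≈⟨ *ₚ-congˡ (Q *ₚ Φ n *ₚ (Ga *ₚ U (q * m))) (geom-U (p * m) u) ⟨
    Q *ₚ Φ n *ₚ (Ga *ₚ U (q * m)) *ₚ (Gb *ₚ U (p * m))
      R.≈⟨ ringₚ 6 (λ Q F a x b y → Q ⊗ F ⊗ (a ⊗ x) ⊗ (b ⊗ y) ⊜ Q ⊗ (a ⊗ b) ⊗ (F ⊗ (y ⊗ x))) ≋-refl
           Q (Φ n) Ga (U (q * m)) Gb (U (p * m)) ⟩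
    Q *ₚ (Ga *ₚ Gb) *ₚ (Φ n *ₚ (U (p * m) *ₚ U (q * m)))
      R.≈⟨ *ₚ-congˡ (Q *ₚ (Ga *ₚ Gb)) eq ⟩
    Q *ₚ (Ga *ₚ Gb) *ₚ (U n *ₚ U m)
      R.≈⟨ ringₚ 3 (λ x y z → x ⊗ (y ⊗ z) ⊜ x ⊗ z ⊗ y) ≋-refl (Q *ₚ (Ga *ₚ Gb)) (U n) (U m) ⟩
    Q *ₚ (Ga *ₚ Gb) *ₚ U m *ₚ U n R.∎
    where module R = SetoidReasoning polySetoid

  perf : n Periodic f
  perf x = cong₂ ℤ._*_
    (trans (cong (λ z → g (x + z)) (lem₁ p q (p ^ i) (q ^ j))) (periodic-* (q * q ^ j) perg x))
    (trans (cong (λ z → h (x + z)) (lem₂ p q (p ^ i) (q ^ j))) (periodic-* (p * p ^ i) perh x))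
    where
    lem₁ : ∀ p q x y → p * (q * (x * y)) ≡ q * y * (p * x)
    lem₁ = solve-∀
    lem₂ : ∀ p q x y → p * (q * (x * y)) ≡ p * x * (q * y)
    lem₂ = solve-∀

  a≡ : a ≡ p ^ i + w * p ^ suc i
  a≡ = trans (lem t q (p ^ i) (q ^ j)) (trans (cong (p ^ i *_) teq) (lem′ (p ^ i) w p))
    where
    lem : ∀ t q x y → t * (q * (x * y)) ≡ x * (t * (q * y))
    lem = solve-∀
    lem′ : ∀ x w p → x * (1 + w * p) ≡ x + w * (p * x)
    lem′ = solve-∀
  b≡ : b ≡ q ^ j + v * q ^ suc j
  b≡ = trans (lem u p (p ^ i) (q ^ j)) (trans (cong (q ^ j *_) ueq) (lem′ (q ^ j) v q))
    where
    lem : ∀ t p x y → t * (p * (x * y)) ≡ y * (t * (p * x))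
    lem = solve-∀
    lem′ : ∀ x w p → x * (1 + w * p) ≡ x + w * (p * x)
    lem′ = solve-∀
  g-a : ∀ x → g (x + a) ≡ g (x + p ^ i)
  g-a x = trans (cong g (trans (cong (x +_) a≡) (sym (ℕₚ.+-assoc x _ _))))
    (periodic-* w perg (x + p ^ i))
  h-b : ∀ x → h (x + b) ≡ h (x + q ^ j)
  h-b x = trans (cong h (trans (cong (x +_) b≡) (sym (ℕₚ.+-assoc x _ _))))
    (periodic-* v perh (x + q ^ j))
  h-a : ∀ x → h (x + a) ≡ h x
  h-a x = trans (cong (λ z → h (x + z)) (lem t q (p ^ i) (q ^ j))) (periodic-* (t * p ^ i) perh x)
    where
    lem : ∀ t q x y → t * (q * (x * y)) ≡ t * x * (q * y)
    lem = solve-∀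
  g-b : ∀ x → g (x + b) ≡ g x
  g-b x = trans (cong (λ z → g (x + z)) (lem u p (p ^ i) (q ^ j))) (periodic-* (u * q ^ j) perg x)
    where
    lem : ∀ t p x y → t * (p * (x * y)) ≡ t * y * (p * x)
    lem = solve-∀

  expand : ∀ x → Δ a (Δ b f) x ≡ Δ (p ^ i) g x ℤ.* Δ (q ^ j) h x
  expand x = trans
    (cong₂ ℤ._-_ (cong₂ ℤ._-_
        (cong₂ ℤ._*_ (trans (g-b (x + a)) (g-a x))
          (trans (h-b (x + a)) (trans (cong h (swap x a (q ^ j))) (h-a (x + q ^ j)))))
        (cong₂ ℤ._*_ (g-a x) (h-a x)))
      (cong₂ ℤ._-_ (cong₂ ℤ._*_ (g-b x) (h-b x)) refl))
    (lem (g (x + p ^ i)) (g x) (h (x + q ^ j)) (h x))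
    where
    swap : ∀ x a y → x + a + y ≡ x + y + a
    swap = solve-∀
    lem : ∀ g′ g h′ h → g′ ℤ.* h′ ℤ.- g′ ℤ.* h ℤ.- (g ℤ.* h′ ℤ.- g ℤ.* h) ≡ (g′ ℤ.- g) ℤ.* (h′ ℤ.- h)
    lem = ℤ-Solver.solve-∀

-- Substitution of X^k and fiber polynomials

pair-⟨X^⟩ : ∀ P k f → ⟪ P ⟨X^ k ⟩ , f ⟫ ≡ ⟪ P , (λ n → f (n * k)) ⟫
pair-⟨X^⟩ []      k f = refl
pair-⟨X^⟩ (a ∷ P) k f = begin
  ⟪ (a ∷ []) +ₚ (X^ k) *ₚ P ⟨X^ k ⟩ , f ⟫
    ≡⟨ pair-+ˡ (a ∷ []) ((X^ k) *ₚ P ⟨X^ k ⟩) f ⟩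
  a ℤ.* f 0 ℤ.+ 0ℤ ℤ.+ ⟪ (X^ k) *ₚ P ⟨X^ k ⟩ , f ⟫
    ≡⟨ cong₂ ℤ._+_ (ℤₚ.+-identityʳ (a ℤ.* f 0)) (trans (pair-*ₚ (X^ k) (P ⟨X^ k ⟩) f) (pair-X^ k _)) ⟩
  a ℤ.* f 0 ℤ.+ ⟪ P ⟨X^ k ⟩ , (λ l → f (k + l)) ⟫
    ≡⟨ cong (λ z → a ℤ.* f 0 ℤ.+ z) (pair-⟨X^⟩ P k (λ l → f (k + l))) ⟩
  a ℤ.* f 0 ℤ.+ ⟪ P , (λ n → f (suc n * k)) ⟫ ∎
  where open ≡-Reasoning

⟨X^⟩-cong : ∀ {P Q} k → P ≋ Q → P ⟨X^ k ⟩ ≋ Q ⟨X^ k ⟩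
⟨X^⟩-cong {P} {Q} k e = pairwise λ f →
  trans (pair-⟨X^⟩ P k f) (trans (pair-≡ e _) (sym (pair-⟨X^⟩ Q k f)))

⟨X^⟩-* : ∀ P Q k → (P *ₚ Q) ⟨X^ k ⟩ ≋ P ⟨X^ k ⟩ *ₚ Q ⟨X^ k ⟩
⟨X^⟩-* P Q k = pairwise λ f → begin
  ⟪ (P *ₚ Q) ⟨X^ k ⟩ , f ⟫
    ≡⟨ pair-⟨X^⟩ (P *ₚ Q) k f ⟩
  ⟪ P *ₚ Q , (λ n → f (n * k)) ⟫
    ≡⟨ pair-*ₚ P Q _ ⟩
  ⟪ P , (λ a → ⟪ Q , (λ b → f ((a + b) * k)) ⟫) ⟫
    ≡⟨ pair-cong P (λ a → pair-cong Q λ b → cong f (ℕₚ.*-distribʳ-+ k a b)) ⟩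
  ⟪ P , (λ a → ⟪ Q , (λ b → f (a * k + b * k)) ⟫) ⟫
    ≡⟨ pair-cong P (λ a → pair-⟨X^⟩ Q k _) ⟨
  ⟪ P , (λ a → ⟪ Q ⟨X^ k ⟩ , (λ b → f (a * k + b)) ⟫) ⟫
    ≡⟨ pair-⟨X^⟩ P k _ ⟨
  ⟪ P ⟨X^ k ⟩ , (λ a → ⟪ Q ⟨X^ k ⟩ , (λ b → f (a + b)) ⟫) ⟫
    ≡⟨ pair-*ₚ (P ⟨X^ k ⟩) (Q ⟨X^ k ⟩) f ⟨
  ⟪ P ⟨X^ k ⟩ *ₚ Q ⟨X^ k ⟩ , f ⟫ ∎
  where open ≡-Reasoning

U-⟨X^⟩ : ∀ r k → U r ⟨X^ k ⟩ ≋ U (r * k)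
U-⟨X^⟩ r k = pairwise λ f → trans (pair-⟨X^⟩ (U r) k f)
  (trans (pair-+ˡ (X^ r) (-ₚ 1ₚ) _)
    (trans (cong₂ ℤ._+_ (trans (pair-X^ r _) (sym (pair-X^ (r * k) f))) refl)
    (sym (pair-+ˡ (X^ (r * k)) (-ₚ 1ₚ) f))))

Φ-⟨X^⟩-U : ∀ {r} → Prime r → ∀ k → Φ r ⟨X^ k ⟩ *ₚ U k ≋ U (r * k)
Φ-⟨X^⟩-U {r} pr k = begin
  Φ r ⟨X^ k ⟩ *ₚ U k
      ≈⟨ *ₚ-congˡ (Φ r ⟨X^ k ⟩) (≋-trans (U-⟨X^⟩ 1 k) (U-cong (ℕₚ.*-identityˡ k))) ⟨
  Φ r ⟨X^ k ⟩ *ₚ U 1 ⟨X^ k ⟩   ≈⟨ ⟨X^⟩-* (Φ r) (U 1) k ⟨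
  (Φ r *ₚ U 1) ⟨X^ k ⟩         ≈⟨ ⟨X^⟩-cong k Φr ⟩
  U r ⟨X^ k ⟩                  ≈⟨ U-⟨X^⟩ r k ⟩
  U (r * k)                    ∎
  where
  open SetoidReasoning polySetoid
  Φr : Φ r *ₚ U 1 ≋ U r
  Φr = subst (λ z → Φ z *ₚ U 1 ≋ U z) (ℕₚ.*-identityʳ r)
    (proj₁ (Φ-one-prime pr (s≤s z≤n) (λ s ps d → inj₁ (prime-∣-^ ps pr 1 d)) Full-Φ-1))

F-U : ∀ {N r} → Prime r → (d : r ∣ N) → F N r d *ₚ U (quotient d) ≋ U N
F-U {N} {r} pr d =
  ≋-trans (Φ-⟨X^⟩-U pr (quotient d))
  (U-cong (trans (ℕₚ.*-comm r (quotient d)) (sym (m∣n⇒n≡quotient*m d))))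

-- Φ_s divides both the modulus X^s - 1 and every fiber polynomial on scale s, hence everything
-- congruent to a multiple of the latter.
fibered⇒Φ∣ : ∀ {s A} → Φ s ∣ₚ U s → (∀ {r} → Prime r → (d : r ∣ s) → Φ s ∣ₚ F s r d) →
  FiberedOn s A → Φ s ∣ₚ maskPoly A
fibered⇒Φ∣ {s} {A} ΦU ΦF (r , pr , d , Q , mod) with ∣ₚ-elim ΦU | ∣ₚ-elim (ΦF pr d) | ∣ₚ-elim mod
... | V , V≋ | W , W≋ | R , R≋ = ∣ₚ-intro (R *ₚ V +ₚ Q *ₚ W) (begin
  (R *ₚ V +ₚ Q *ₚ W) *ₚ Φ s
    ≈⟨ ringₚ 5 (λ r v q w f → (r ⊗ v ⊕ q ⊗ w) ⊗ f ⊜ r ⊗ (v ⊗ f) ⊕ q ⊗ (w ⊗ f)) ≋-refl R V Q W (Φ s) ⟩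
  R *ₚ (V *ₚ Φ s) +ₚ Q *ₚ (W *ₚ Φ s)
    ≈⟨ +ₚ-cong (*ₚ-congˡ R V≋) (*ₚ-congˡ Q W≋) ⟩
  R *ₚ U s +ₚ Q *ₚ F s r d
    ≈⟨ +ₚ-cong R≋ ≋-refl ⟩
  (maskPoly A -ₚ Q *ₚ F s r d) +ₚ Q *ₚ F s r d
    ≈⟨ ringₚ 2 (λ a b → (a ⊕ (⊝ b)) ⊕ b ⊜ a) ≋-refl (maskPoly A) (Q *ₚ F s r d) ⟩
  maskPoly A ∎)
  where open SetoidReasoning polySetoid

Φ∣F-one-prime : ∀ {p m r} → Prime p → 1 ≤ m → OnlyPrimes p p (p * m) → Φ (p * m) *ₚ U m ≋ U (p * m) →
  Prime r → (d : r ∣ p * m) → Φ (p * m) ∣ₚ F (p * m) r d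
Φ∣F-one-prime {p} {m} {r} pp 1≤m only eq pr d with reduce (only r pr d)
... | refl = ∣ₚ-intro 1ₚ
    (≋-trans (*ₚ-identityˡ (Φ (p * m))) (*ₚ-cancelʳ (Φ (p * m)) (F (p * m) p d) (U m) (U-monic m 1≤m)
  (≋-trans eq (≋-sym (≋-trans (*ₚ-congˡ (F (p * m) p d) (U-cong m≡)) (F-U pr d))))))
  where
  m≡ : m ≡ quotient d
  m≡ = ℕₚ.*-cancelˡ-≡ m (quotient d) p {{prime⇒nonZero pp}}
    (trans (m∣n⇒n≡quotient*m d) (ℕₚ.*-comm (quotient d) p))

Φ∣F-two-primes : ∀ {p q m r} → Prime p → Prime q → 1 ≤ m → let n = p * (q * m) in OnlyPrimes p q n →
  Φ n *ₚ (U (p * m) *ₚ U (q * m)) ≋ U n *ₚ U m → Prime r → (d : r ∣ n) → Φ n ∣ₚ F n r d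
Φ∣F-two-primes {p} {q} {m} {r} pp pq 1≤m only eq pr d = by (only r pr d)
  where
  open SetoidReasoning polySetoid
  n = p * (q * m)
  k = quotient d
  n≡ : n ≡ r * k
  n≡ = trans (m∣n⇒n≡quotient*m d) (ℕₚ.*-comm k r)
  -- Both calls take r′ = r. As F is (X^n - 1)/(X^k - 1), the identity for Φ_n leaves (X^(rm) -
  -- 1)/(X^m - 1) as the cofactor, which is `geom m r`.
  core : ∀ r′ → 1 ≤ k → Φ n *ₚ (U (r′ * m) *ₚ U k) ≋ U n *ₚ U m → Φ n ∣ₚ F n r d
  core r′ 1≤k eq = ∣ₚ-intro (geom m r′)
    (*ₚ-cancelʳ (geom m r′ *ₚ Φ n) (F n r d) (U k *ₚ U m)
      (lead-* (U k) (U m) (U-monic k 1≤k) (U-monic m 1≤m)) (begin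
      geom m r′ *ₚ Φ n *ₚ (U k *ₚ U m)
        ≈⟨ ringₚ 4 (λ g f k m → g ⊗ f ⊗ (k ⊗ m) ⊜ f ⊗ ((g ⊗ m) ⊗ k)) ≋-refl (geom m r′) (Φ n) (U k)
            (U m) ⟩
      Φ n *ₚ ((geom m r′ *ₚ U m) *ₚ U k)
        ≈⟨ *ₚ-congˡ (Φ n) (*ₚ-congʳ (U k) (geom-U m r′)) ⟩
      Φ n *ₚ (U (r′ * m) *ₚ U k)
        ≈⟨ eq ⟩
      U n *ₚ U m
        ≈⟨ *ₚ-congʳ (U m) (F-U pr d) ⟨
      F n r d *ₚ U k *ₚ U m
        ≈⟨ *ₚ-assoc (F n r d) (U k) (U m) ⟩
      F n r d *ₚ (U k *ₚ U m) ∎))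
  by : r ≡ p ⊎ r ≡ q → Φ n ∣ₚ F n r d
  by (inj₁ refl) = core p (subst (1 ≤_) k≡ (*-pos (prime-pos pq) 1≤m))
    (subst (λ z → Φ n *ₚ (U (p * m) *ₚ U z) ≋ U n *ₚ U m) k≡ eq)
    where
    k≡ : q * m ≡ k
    k≡ = ℕₚ.*-cancelˡ-≡ (q * m) k p {{prime⇒nonZero pp}} n≡
  by (inj₂ refl) = core q (subst (1 ≤_) k≡ (*-pos (prime-pos pp) 1≤m))
    (≋-trans (*ₚ-congˡ (Φ n) (*ₚ-comm (U (q * m)) (U k)))
      (subst (λ z → Φ n *ₚ (U z *ₚ U (q * m)) ≋ U n *ₚ U m) k≡ eq))
    where
    swap : ∀ p q m → p * (q * m) ≡ q * (p * m)
    swap = solve-∀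
    k≡ : p * m ≡ k
    k≡ = ℕₚ.*-cancelˡ-≡ (p * m) k q {{prime⇒nonZero pq}} (trans (sym (swap p q m)) n≡)

-- Digit classes

∑-cong : ∀ A {f g} → (∀ n → f n ≡ g n) → ∑ A f ≡ ∑ A g
∑-cong []      e = refl
∑-cong (a ∷ A) e = cong₂ ℤ._+_ (e a) (∑-cong A e)

∑-0 : ∀ A → ∑ A (λ _ → 0ℤ) ≡ 0ℤ
∑-0 []      = refl
∑-0 (a ∷ A) = trans (ℤₚ.+-identityˡ _) (∑-0 A)

∑-+ : ∀ A f g → ∑ A (λ n → f n ℤ.+ g n) ≡ ∑ A f ℤ.+ ∑ A g
∑-+ []      f g = refl
∑-+ (a ∷ A) f g rewrite ∑-+ A f g = lem (f a) (g a) (∑ A f) (∑ A g)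
  where
  lem : ∀ x y u v → x ℤ.+ y ℤ.+ (u ℤ.+ v) ≡ x ℤ.+ u ℤ.+ (y ℤ.+ v)
  lem = ℤ-Solver.solve-∀

∑-- : ∀ A f g → ∑ A (λ n → f n ℤ.- g n) ≡ ∑ A f ℤ.- ∑ A g
∑-- []      f g = refl
∑-- (a ∷ A) f g rewrite ∑-- A f g = lem (f a) (g a) (∑ A f) (∑ A g)
  where
  lem : ∀ x y u v → x ℤ.- y ℤ.+ (u ℤ.- v) ≡ x ℤ.+ u ℤ.- (y ℤ.+ v)
  lem = ℤ-Solver.solve-∀

∑-* : ∀ A c f → ∑ A (λ n → c ℤ.* f n) ≡ c ℤ.* ∑ A f
∑-* []      c f = sym (ℤₚ.*-zeroʳ c)
∑-* (a ∷ A) c f rewrite ∑-* A c f = sym (ℤₚ.*-distribˡ-+ c (f a) (∑ A f))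

∑-1 : ∀ A → ∑ A (λ _ → 1ℤ) ≡ ℤ.+ length A
∑-1 []      = refl
∑-1 (a ∷ A) rewrite ∑-1 A = refl

∑-nonneg : ∀ A f → (∀ n → 0ℤ ℤ.≤ f n) → 0ℤ ℤ.≤ ∑ A f
∑-nonneg []      f pos = ℤₚ.≤-refl
∑-nonneg (a ∷ A) f pos = ℤₚ.+-mono-≤ (pos a) (∑-nonneg A f pos)

Σ< : ℕ → (ℕ → ℤ) → ℤ
Σ< zero    f = 0ℤ
Σ< (suc m) f = Σ< m f ℤ.+ f m

Σ<-cong : ∀ m {f g} → (∀ t → t < m → f t ≡ g t) → Σ< m f ≡ Σ< m g
Σ<-cong zero    e = refl
Σ<-cong (suc m) e = cong₂ ℤ._+_ (Σ<-cong m (λ t lt → e t (ℕₚ.m<n⇒m<1+n lt))) (e m (ℕₚ.n<1+n m))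

Σ<-+ : ∀ m f g → Σ< m (λ t → f t ℤ.+ g t) ≡ Σ< m f ℤ.+ Σ< m g
Σ<-+ zero    f g = refl
Σ<-+ (suc m) f g rewrite Σ<-+ m f g = lem (Σ< m f) (Σ< m g) (f m) (g m)
  where
  lem : ∀ x y u v → x ℤ.+ y ℤ.+ (u ℤ.+ v) ≡ x ℤ.+ u ℤ.+ (y ℤ.+ v)
  lem = ℤ-Solver.solve-∀

Σ<-*ˡ : ∀ m c f → Σ< m (λ t → c ℤ.* f t) ≡ c ℤ.* Σ< m f
Σ<-*ˡ zero    c f = sym (ℤₚ.*-zeroʳ c)
Σ<-*ˡ (suc m) c f rewrite Σ<-*ˡ m c f = sym (ℤₚ.*-distribˡ-+ c (Σ< m f) (f m))

Σ<-const : ∀ m c → Σ< m (λ _ → c) ≡ ℤ.+ m ℤ.* c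
Σ<-const zero    c = refl
Σ<-const (suc m) c rewrite Σ<-const m c = trans (ℤₚ.+-comm _ c) (sym (ℤₚ.suc-* (ℤ.+ m) c))

Σ<-0 : ∀ m {f} → (∀ t → t < m → f t ≡ 0ℤ) → Σ< m f ≡ 0ℤ
Σ<-0 m e = trans (Σ<-cong m e) (trans (Σ<-const m 0ℤ) (ℤₚ.*-zeroʳ (ℤ.+ m)))

∑-Σ< : ∀ A m (f : ℕ → ℕ → ℤ) → ∑ A (λ n → Σ< m (λ t → f t n)) ≡ Σ< m (λ t → ∑ A (f t))
∑-Σ< A zero    f = ∑-0 A
∑-Σ< A (suc m) f = trans (∑-+ A (λ n → Σ< m (λ t → f t n)) (f m)) (cong (ℤ._+ ∑ A (f m)) (∑-Σ< A m f))

Σ<-telescope : ∀ m (f : ℕ → ℤ) → Σ< m (λ t → f (suc t) ℤ.- f t) ≡ f m ℤ.- f 0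
Σ<-telescope zero    f = sym (ℤₚ.+-inverseʳ (f 0))
Σ<-telescope (suc m) f rewrite Σ<-telescope m f = lem (f m) (f 0) (f (suc m))
  where
  lem : ∀ x y z → x ℤ.- y ℤ.+ (z ℤ.- x) ≡ z ℤ.- y
  lem = ℤ-Solver.solve-∀

⟦_⟧ : Bool → ℤ
⟦ true  ⟧ = 1ℤ
⟦ false ⟧ = 0ℤ

⟦⟧-nonneg : ∀ b → 0ℤ ℤ.≤ ⟦ b ⟧
⟦⟧-nonneg true  = ℤ.+≤+ z≤n
⟦⟧-nonneg false = ℤ.+≤+ z≤n

≡ᵇ-refl : ∀ n → (n ≡ᵇ n) ≡ true
≡ᵇ-refl zero    = refl
≡ᵇ-refl (suc n) = ≡ᵇ-refl n

≡ᵇ-≢ : ∀ m n → m ≢ n → (m ≡ᵇ n) ≡ false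
≡ᵇ-≢ zero    zero    ne = contradiction refl ne
≡ᵇ-≢ zero    (suc n) ne = refl
≡ᵇ-≢ (suc m) zero    ne = refl
≡ᵇ-≢ (suc m) (suc n) ne = ≡ᵇ-≢ m n (λ e → ne (cong suc e))

≡ᵇ-sym : ∀ m n → (m ≡ᵇ n) ≡ (n ≡ᵇ m)
≡ᵇ-sym zero    zero    = refl
≡ᵇ-sym zero    (suc n) = refl
≡ᵇ-sym (suc m) zero    = refl
≡ᵇ-sym (suc m) (suc n) = ≡ᵇ-sym m n

Σ<-select : ∀ m x (f : ℕ → ℤ) → x < m → Σ< m (λ t → f t ℤ.* ⟦ x ≡ᵇ t ⟧) ≡ f x
Σ<-select (suc m) x f x<1+m with x ℕ.≟ m
... | yes refl rewrite ≡ᵇ-refl x = trans (cong₂ ℤ._+_ (Σ<-0 x (λ t t<x →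
        trans (cong (λ b → f t ℤ.* ⟦ b ⟧) (≡ᵇ-≢ x t (λ e → ℕₚ.<-irrefl (sym e) t<x)))
          (ℤₚ.*-zeroʳ (f t)))) (ℤₚ.*-identityʳ (f x)))
        (ℤₚ.+-identityˡ (f x))
... | no x≢m rewrite ≡ᵇ-≢ x m x≢m =
    trans (cong₂ ℤ._+_ (Σ<-select m x f (ℕₚ.≤∧≢⇒< (ℕₚ.≤-pred x<1+m) x≢m)) (ℤₚ.*-zeroʳ (f m)))
    (ℤₚ.+-identityʳ (f x))

Σ<-⟦≡⟧ : ∀ m x → x < m → Σ< m (λ t → ⟦ x ≡ᵇ t ⟧) ≡ 1ℤ
Σ<-⟦≡⟧ m x x<m = trans (Σ<-cong m (λ t _ → sym (ℤₚ.*-identityˡ ⟦ x ≡ᵇ t ⟧)))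
  (Σ<-select m x (λ _ → 1ℤ) x<m)

∑-filter : ∀ b A f → ∑ (filterᵇ b A) f ≡ ∑ A (λ n → ⟦ b n ⟧ ℤ.* f n)
∑-filter b []      f = refl
∑-filter b (a ∷ A) f with b a
... | true  = cong₂ ℤ._+_ (sym (ℤₚ.*-identityˡ (f a))) (∑-filter b A f)
... | false = trans (∑-filter b A f) (sym (ℤₚ.+-identityˡ _))

length-filter : ∀ b A → ℤ.+ length (filterᵇ b A) ≡ ∑ A (λ n → ⟦ b n ⟧)
length-filter b A =
  trans (sym (∑-1 (filterᵇ b A))) (trans (∑-filter b A _) (∑-cong A (λ n → ℤₚ.*-identityʳ ⟦ b n ⟧)))

-- The i-th base-p digit of n, counting from 0.
digit : ∀ p i .{{_ : NonZero p}} → ℕ → ℕ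
digit p i n = _/_ n (p ^ i) {{ℕₚ.m^n≢0 p i}} % p

hasDigit : ∀ p i .{{_ : NonZero p}} → ℕ → ℕ → Bool
hasDigit p i j n = digit p i n ≡ᵇ j

Digit : ∀ p i .{{_ : NonZero p}} → ℕ → List ℕ → List ℕ
Digit p i j = filterᵇ (hasDigit p i j)

module _ (p i : ℕ) .{{_ : NonZero p}} where

  private instance
    pⁱ≢0 : NonZero (p ^ i)
    pⁱ≢0 = ℕₚ.m^n≢0 p i

  digit< : ∀ n → digit p i n < p
  digit< n = DM.m%n<n (n / p ^ i) p

  shift-/ : ∀ n t → (n + t * p ^ i) / p ^ i ≡ n / p ^ i + t
  shift-/ n t = trans (DM.+-distrib-/-∣ʳ n {t * p ^ i} {p ^ i} (divides t refl))
    (cong (n / p ^ i +_) (DM.m*n/n≡m t (p ^ i)))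
    where open import Data.Nat.Divisibility using (divides)

  digit-shift : ∀ n t → digit p i (n + t * p ^ i) ≡ (n / p ^ i + t) % p
  digit-shift n t = cong (_% p) (shift-/ n t)

  digit-periodic : ∀ n → digit p i (n + p ^ suc i) ≡ digit p i n
  digit-periodic n = trans (digit-shift n p) (DM.[m+n]%n≡m%n (n / p ^ i) p)

  hasDigit-periodic : ∀ j → (p ^ suc i) Periodic (λ n → ⟦ hasDigit p i j n ⟧)
  hasDigit-periodic j n = cong (λ d → ⟦ d ≡ᵇ j ⟧) (digit-periodic n)

  hasDigit-suc : ∀ j → suc j < p → ∀ n → hasDigit p i (suc j) (n + p ^ i) ≡ hasDigit p i j n
  hasDigit-suc j 1+j<p n =
    trans (cong (_≡ᵇ suc j) (trans (cong (digit p i) (cong (n +_) (sym (ℕₚ.*-identityˡ (p ^ i)))))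
    (trans (digit-shift n 1)
      (trans (cong (_% p) (ℕₚ.+-comm (n / p ^ i) 1)) (DM.%-distribˡ-+ 1 (n / p ^ i) p)))))
      (step (digit p i n) (digit< n))
    where
    1<p : 1 < p
    1<p = ℕₚ.≤-trans (s≤s (s≤s z≤n)) 1+j<p
    step : ∀ x → x < p → ((1 % p + x) % p ≡ᵇ suc j) ≡ (x ≡ᵇ j)
    step x x<p rewrite DM.m<n⇒m%n≡m 1<p with suc x ℕ.<? p
    ... | yes 1+x<p rewrite DM.m<n⇒m%n≡m 1+x<p = refl
    -- Here x is p - 1 and the shifted digit wraps around to 0. Both sides are false because 1 + j <
    -- p.
    ... | no 1+x≮p with ℕₚ.≤-antisym x<p (ℕₚ.≮⇒≥ 1+x≮p)
    ...   | refl = trans (cong (_≡ᵇ suc j) (DM.n%n≡0 (suc x)))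
        (sym (≡ᵇ-≢ x j (λ e → ℕₚ.<-irrefl (cong suc (sym e)) 1+j<p)))

  hasDigit-total : ∀ n → Σ< p (λ j → ⟦ hasDigit p i j n ⟧) ≡ 1ℤ
  hasDigit-total n = Σ<-⟦≡⟧ p (digit p i n) (digit< n)

  ∑-Digit : ∀ A f → Σ< p (λ j → ∑ (Digit p i j A) f) ≡ ∑ A f
  ∑-Digit A f = begin
    Σ< p (λ j → ∑ (Digit p i j A) f)
      ≡⟨ Σ<-cong p (λ j _ → trans (∑-filter (hasDigit p i j) A f)
          (∑-cong A (λ n → ℤₚ.*-comm ⟦ hasDigit p i j n ⟧ (f n)))) ⟩
    Σ< p (λ j → ∑ A (λ n → f n ℤ.* ⟦ hasDigit p i j n ⟧))
      ≡⟨ ∑-Σ< A p _ ⟨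
    ∑ A (λ n → Σ< p (λ j → f n ℤ.* ⟦ hasDigit p i j n ⟧))
      ≡⟨ ∑-cong A (λ n → trans (Σ<-*ˡ p (f n) _)
          (trans (cong (f n ℤ.*_) (hasDigit-total n)) (ℤₚ.*-identityʳ (f n)))) ⟩
    ∑ A f ∎
    where open ≡-Reasoning

  -- The indicator of digit j + 1 is an admissible h, and its difference is the indicator of digit j
  -- minus that of digit j + 1. The weight ω lets one argument serve twice: it is 1 for
  -- equidistribution, and a difference taken at the other prime for an exchange identity.
  invariant-digits : ∀ A (ω : ℕ → ℤ) →
    (∀ h → (p ^ suc i) Periodic h → ∑ A (λ n → ω n ℤ.* Δ (p ^ i) h n) ≡ 0ℤ) →
    ∀ j → j < p → ∑ (Digit p i j A) ω ≡ ∑ (Digit p i 0 A) ω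
  invariant-digits A ω inv zero    j<p = refl
  invariant-digits A ω inv (suc j) j<p = trans (sym (ℤₚ.i-j≡0⇒i≡j _ _ (begin
    ∑ (Digit p i j A) ω ℤ.- ∑ (Digit p i (suc j) A) ω
      ≡⟨ cong₂ ℤ._-_ (∑-filter (hasDigit p i j) A ω) (∑-filter (hasDigit p i (suc j)) A ω) ⟩
    ∑ A (λ n → ⟦ hasDigit p i j n ⟧ ℤ.* ω n) ℤ.- ∑ A (λ n → ⟦ hasDigit p i (suc j) n ⟧ ℤ.* ω n)
      ≡⟨ ∑-- A (λ n → ⟦ hasDigit p i j n ⟧ ℤ.* ω n) (λ n → ⟦ hasDigit p i (suc j) n ⟧ ℤ.* ω n) ⟨
    ∑ A (λ n → ⟦ hasDigit p i j n ⟧ ℤ.* ω n ℤ.- ⟦ hasDigit p i (suc j) n ⟧ ℤ.* ω n)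
      ≡⟨ ∑-cong A (λ n → trans (lem (ω n) ⟦ hasDigit p i j n ⟧ ⟦ hasDigit p i (suc j) n ⟧)
           (cong (λ b → ω n ℤ.* (⟦ b ⟧ ℤ.- ⟦ hasDigit p i (suc j) n ⟧)) (sym (hasDigit-suc j j<p n)))) ⟩
    ∑ A (λ n → ω n ℤ.* Δ (p ^ i) (λ n → ⟦ hasDigit p i (suc j) n ⟧) n)
      ≡⟨ inv _ (hasDigit-periodic (suc j)) ⟩
    0ℤ ∎))) (invariant-digits A ω inv j (ℕₚ.<-trans (ℕₚ.n<1+n j) j<p))
    where
    open ≡-Reasoning
    lem : ∀ w x y → x ℤ.* w ℤ.- y ℤ.* w ≡ w ℤ.* (x ℤ.- y)
    lem = ℤ-Solver.solve-∀

  invariant-total : ∀ A (ω : ℕ → ℤ) →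
    (∀ h → (p ^ suc i) Periodic h → ∑ A (λ n → ω n ℤ.* Δ (p ^ i) h n) ≡ 0ℤ) →
    ∑ A ω ≡ ℤ.+ p ℤ.* ∑ (Digit p i 0 A) ω
  invariant-total A ω inv =
    trans (sym (∑-Digit A ω)) (trans (Σ<-cong p (invariant-digits A ω inv)) (Σ<-const p _))

  equidistributed⇒invariant : ∀ A → Equidistributed p i A → ∀ h → (p ^ suc i) Periodic h →
    ∑ A (λ n → 1ℤ ℤ.* Δ (p ^ i) h n) ≡ 0ℤ
  equidistributed⇒invariant A eq h per = trans (∑-cong A (λ n → ℤₚ.*-identityˡ (Δ (p ^ i) h n)))
    (eq h per)

  equidistributed-digits : ∀ A → Equidistributed p i A → ∀ j → j < p →
    length A ≡ p * length (Digit p i j A)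
  equidistributed-digits A eq j j<p = ℤₚ.+-injective (begin
    ℤ.+ length A                                       ≡⟨ ∑-1 A ⟨
    ∑ A (λ _ → 1ℤ)
        ≡⟨ invariant-total A (λ _ → 1ℤ) (equidistributed⇒invariant A eq) ⟩
    ℤ.+ p ℤ.* ∑ (Digit p i 0 A) (λ _ → 1ℤ)
        ≡⟨ cong (ℤ.+ p ℤ.*_) (invariant-digits A (λ _ → 1ℤ) (equidistributed⇒invariant A eq) j j<p) ⟨
    ℤ.+ p ℤ.* ∑ (Digit p i j A) (λ _ → 1ℤ)             ≡⟨ cong (ℤ.+ p ℤ.*_) (∑-1 (Digit p i j A)) ⟩
    ℤ.+ p ℤ.* ℤ.+ length (Digit p i j A)               ≡⟨ ℤₚ.pos-* p (length (Digit p i j A)) ⟨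
    ℤ.+ (p * length (Digit p i j A))                   ∎)
    where open ≡-Reasoning

∑<ℕ : ℕ → (ℕ → ℕ) → ℕ
∑<ℕ zero    c = 0
∑<ℕ (suc m) c = ∑<ℕ m c + c m

+-∑<ℕ : ∀ m c → ℤ.+ ∑<ℕ m c ≡ Σ< m (λ t → ℤ.+ c t)
+-∑<ℕ zero    c = refl
+-∑<ℕ (suc m) c = trans (ℤₚ.pos-+ (∑<ℕ m c) (c m)) (cong (ℤ._+ ℤ.+ c m) (+-∑<ℕ m c))

∑<ℕ-≥ : ∀ m c x → (∀ t → t < m → x ≤ c t) → m * x ≤ ∑<ℕ m c
∑<ℕ-≥ zero    c x b = z≤n
∑<ℕ-≥ (suc m) c x b = subst (_≤ ∑<ℕ m c + c m) (ℕₚ.+-comm (m * x) x)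
  (ℕₚ.+-mono-≤ (∑<ℕ-≥ m c x (λ t lt → b t (ℕₚ.m<n⇒m<1+n lt))) (b m (ℕₚ.n<1+n m)))

∃-min : ∀ m → 1 ≤ m → ∀ (c : ℕ → ℕ) → ∃[ j ] j < m × (∀ t → t < m → c j ≤ c t)
∃-min (suc zero)    _ c = 0 , s≤s z≤n , λ { zero _ → ℕₚ.≤-refl ; (suc t) (s≤s ()) }
∃-min (suc (suc m)) _ c with ∃-min (suc m) (s≤s z≤n) c
... | j , j<m , min with c j ℕ.≤? c (suc m)
...   | yes le = j , ℕₚ.m<n⇒m<1+n j<m , λ t t< →
    [ (λ { (s≤s lt) → min t (s≤s lt) }) , (λ { refl → le }) ]′ (ℕₚ.m≤n⇒m<n∨m≡n (ℕₚ.≤-pred t<))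
...   | no gt  = suc m , ℕₚ.n<1+n (suc m) , λ t t< →
    [ (λ { (s≤s lt) → ℕₚ.≤-trans (ℕₚ.<⇒≤ (ℕₚ.≰⇒> gt)) (min t (s≤s lt)) }) , (λ { refl → ℕₚ.≤-refl }) ]′
    (ℕₚ.m≤n⇒m<n∨m≡n (ℕₚ.≤-pred t<))

Splits : ∀ p i .{{_ : NonZero p}} → List ℕ → Set
Splits p i A = ∀ j → j < p → 1 ≤ length (Digit p i j A)

module _ (p i : ℕ) .{{_ : NonZero p}} where

  length-digits : ∀ A → length A ≡ ∑<ℕ p (λ j → length (Digit p i j A))
  length-digits A = ℤₚ.+-injective (begin
    ℤ.+ length A                                          ≡⟨ ∑-1 A ⟨
    ∑ A (λ _ → 1ℤ)                                        ≡⟨ ∑-Digit p i A (λ _ → 1ℤ) ⟨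
    Σ< p (λ j → ∑ (Digit p i j A) (λ _ → 1ℤ))             ≡⟨ Σ<-cong p (λ j _ → ∑-1 (Digit p i j A)) ⟩
    Σ< p (λ j → ℤ.+ length (Digit p i j A))               ≡⟨ +-∑<ℕ p _ ⟨
    ℤ.+ ∑<ℕ p (λ j → length (Digit p i j A))              ∎)
    where open ≡-Reasoning

  ∃-small-digit : ∀ A → ∃[ j ] j < p × p * length (Digit p i j A) ≤ length A
  ∃-small-digit A with ∃-min p (ℕ.>-nonZero⁻¹ p) (λ j → length (Digit p i j A))
  ... | j , j<p , min = j , j<p , subst (p * length (Digit p i j A) ≤_) (sym (length-digits A))
      (∑<ℕ-≥ p (λ j → length (Digit p i j A)) _ min)

  equidistributed⇒splits : ∀ A → 1 ≤ length A → Equidistributed p i A → Splits p i A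
  equidistributed⇒splits A 1≤ eq j j<p with length (Digit p i j A)
    | equidistributed-digits p i A eq j j<p
  ... | zero  | e = contradiction (subst (1 ≤_) (trans e (ℕₚ.*-zeroʳ p)) 1≤) λ ()
  ... | suc _ | _ = s≤s z≤n

residue : ∀ m .{{_ : NonZero m}} → ℕ → ℕ → ℤ
residue m r n = ⟦ n % m ≡ᵇ r ⟧

residue-periodic : ∀ m .{{_ : NonZero m}} r → m Periodic (residue m r)
residue-periodic m r n = cong (λ x → ⟦ x ≡ᵇ r ⟧) (DM.[m+n]%n≡m%n n m)

periodic-% : ∀ m .{{_ : NonZero m}} {g} → m Periodic g → ∀ n → g n ≡ g (n % m)
periodic-% m {g} per n = trans (cong g (DM.m≡m%n+[m/n]*n n m)) (periodic-* (n / m) per (n % m))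

Δ-residues : ∀ m .{{_ : NonZero m}} k {g} → m Periodic g → ∀ n →
  Δ k g n ≡ Σ< m (λ r → g r ℤ.* Δ k (residue m r) n)
Δ-residues m k {g} per n = begin
  g (n + k) ℤ.- g n
    ≡⟨ cong₂ ℤ._-_ (expand (n + k)) (expand n) ⟩
  Σ< m (λ r → g r ℤ.* residue m r (n + k)) ℤ.- Σ< m (λ r → g r ℤ.* residue m r n)
    ≡⟨ cong (λ z → Σ< m (λ r → g r ℤ.* residue m r (n + k)) ℤ.+ z) (neg (Σ< m _)) ⟩
  Σ< m (λ r → g r ℤ.* residue m r (n + k)) ℤ.+ -1ℤ ℤ.* Σ< m (λ r → g r ℤ.* residue m r n)
    ≡⟨ cong (λ z → Σ< m (λ r → g r ℤ.* residue m r (n + k)) ℤ.+ z) (Σ<-*ˡ m -1ℤ _) ⟨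
  Σ< m (λ r → g r ℤ.* residue m r (n + k)) ℤ.+ Σ< m (λ r → -1ℤ ℤ.* (g r ℤ.* residue m r n))
    ≡⟨ Σ<-+ m _ _ ⟨
  Σ< m (λ r → g r ℤ.* residue m r (n + k) ℤ.+ -1ℤ ℤ.* (g r ℤ.* residue m r n))
    ≡⟨ Σ<-cong m (λ r _ → lem (g r) (residue m r (n + k)) (residue m r n)) ⟩
  Σ< m (λ r → g r ℤ.* Δ k (residue m r) n) ∎
  where
  open ≡-Reasoning
  expand : ∀ n → g n ≡ Σ< m (λ r → g r ℤ.* residue m r n)
  expand n = trans (periodic-% m per n) (sym (Σ<-select m (n % m) g (DM.m%n<n n m)))
  neg : ∀ x → ℤ.- x ≡ -1ℤ ℤ.* x
  neg = ℤ-Solver.solve-∀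
  lem : ∀ g x y → g ℤ.* x ℤ.+ -1ℤ ℤ.* (g ℤ.* y) ≡ g ℤ.* (x ℤ.- y)
  lem = ℤ-Solver.solve-∀

module _ (p i : ℕ) .{{_ : NonZero p}} where

  private instance
    pⁱ⁺¹≢0 : NonZero (p ^ suc i)
    pⁱ⁺¹≢0 = ℕₚ.m^n≢0 p (suc i)

  -- The residue indicators span the periodic functions. So finitely many tests decide
  -- equidistribution, which makes the later case distinctions constructive.
  residues⇒equidistributed : ∀ A →
    (∀ {r} → r < p ^ suc i → ∑ A (Δ (p ^ i) (residue (p ^ suc i) r)) ≡ 0ℤ) →
    Equidistributed p i A
  residues⇒equidistributed A e g per = begin
    ∑ A (Δ (p ^ i) g)
      ≡⟨ ∑-cong A (Δ-residues (p ^ suc i) (p ^ i) per) ⟩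
    ∑ A (λ n → Σ< (p ^ suc i) (λ r → g r ℤ.* Δ (p ^ i) (residue (p ^ suc i) r) n))
      ≡⟨ ∑-Σ< A (p ^ suc i) _ ⟩
    Σ< (p ^ suc i) (λ r → ∑ A (λ n → g r ℤ.* Δ (p ^ i) (residue (p ^ suc i) r) n))
      ≡⟨ Σ<-0 (p ^ suc i)
          (λ r r< → trans (∑-* A (g r) _) (trans (cong (g r ℤ.*_) (e r<)) (ℤₚ.*-zeroʳ (g r)))) ⟩
    0ℤ ∎
    where open ≡-Reasoning

  equidistributed? : ∀ A → Dec (Equidistributed p i A)
  equidistributed? A with ℕₚ.allUpTo? (λ r → ∑ A (Δ (p ^ i) (residue (p ^ suc i) r)) ℤ.≟ 0ℤ) (p ^ suc i)
  ... | yes all = yes (residues⇒equidistributed A all)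
  ... | no ¬all = no λ eq → ¬all λ _ → eq _ (residue-periodic (p ^ suc i) _)

exchange-sym : ∀ {p q i j A} → Exchange p q i j A → Exchange q p j i A
exchange-sym {p} {q} {i} {j} {A} ex g h perg perh =
  trans (∑-cong A (λ n → ℤₚ.*-comm (Δ (q ^ j) g n) (Δ (p ^ i) h n))) (ex h g perh perg)

module _ (p q : ℕ) .{{_ : NonZero p}} .{{_ : NonZero q}} where

  -- A nonzero multiple of q, spread evenly over the q digit classes, meets all of them.
  exchange⇒splits : ∀ i j A → Exchange p q i j A → ¬ Equidistributed p i A → Splits q j A
  exchange⇒splits i j A ex ¬eq t t<q with length (Digit q j t A) in len
  ... | suc _ = s≤s z≤n
  ... | zero  = contradiction (λ g per → vanish g per) ¬eq
    where
    vanish : Equidistributed p i A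
    vanish g per = begin
      ∑ A (Δ (p ^ i) g)
          ≡⟨ invariant-total q j A (Δ (p ^ i) g) (λ h perh → ex g h per perh) ⟩
      ℤ.+ q ℤ.* ∑ (Digit q j 0 A) (Δ (p ^ i) g)
          ≡⟨ cong (ℤ.+ q ℤ.*_)
          (invariant-digits q j A (Δ (p ^ i) g) (λ h perh → ex g h per perh) t t<q) ⟨
      ℤ.+ q ℤ.* ∑ (Digit q j t A) (Δ (p ^ i) g)
          ≡⟨ cong (ℤ.+ q ℤ.*_) (empty (Digit q j t A) len) ⟩
      ℤ.+ q ℤ.* 0ℤ                                       ≡⟨ ℤₚ.*-zeroʳ (ℤ.+ q) ⟩
      0ℤ                                                 ∎
      where
      open ≡-Reasoning
      empty : ∀ A → length A ≡ 0 → ∑ A (Δ (p ^ i) g) ≡ 0ℤ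
      empty [] _ = refl

-- An indicator of period p^i commutes with the difference by p^i, so it can be absorbed into the
-- test function.
equidistributed-filter : ∀ {p i} b A → (p ^ i) Periodic (λ n → ⟦ b n ⟧) →
  Equidistributed p i A → Equidistributed p i (filterᵇ b A)
equidistributed-filter {p} {i} b A per eq g perg = begin
  ∑ (filterᵇ b A) (Δ (p ^ i) g)                     ≡⟨ ∑-filter b A _ ⟩
  ∑ A (λ n → ⟦ b n ⟧ ℤ.* Δ (p ^ i) g n)
      ≡⟨ ∑-cong A (λ n → trans (lem ⟦ b n ⟧ (g (n + p ^ i)) (g n))
                                                        (cong (λ x → x ℤ.* g
                                                          (n + p ^ i) ℤ.- ⟦ b n ⟧ ℤ.* g n)
                                                          (sym (per n)))) ⟩
  ∑ A (Δ (p ^ i) (λ n → ⟦ b n ⟧ ℤ.* g n))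
      ≡⟨ eq _ (λ n → cong₂ ℤ._*_ (periodic-* p per n) (perg n)) ⟩
  0ℤ                                                ∎
  where
  open ≡-Reasoning
  lem : ∀ b x y → b ℤ.* (x ℤ.- y) ≡ b ℤ.* x ℤ.- b ℤ.* y
  lem = ℤ-Solver.solve-∀

exchange-filter : ∀ {p q i j} b A → (p ^ i) Periodic (λ n → ⟦ b n ⟧) →
  Exchange p q i j A → Exchange p q i j (filterᵇ b A)
exchange-filter {p} {q} {i} {j} b A per ex g h perg perh = begin
  ∑ (filterᵇ b A) (λ n → Δ (p ^ i) g n ℤ.* Δ (q ^ j) h n)
    ≡⟨ ∑-filter b A _ ⟩
  ∑ A (λ n → ⟦ b n ⟧ ℤ.* (Δ (p ^ i) g n ℤ.* Δ (q ^ j) h n))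
    ≡⟨ ∑-cong A (λ n → trans (lem ⟦ b n ⟧ (g (n + p ^ i)) (g n) (Δ (q ^ j) h n))
         (cong (λ x → (x ℤ.* g (n + p ^ i) ℤ.- ⟦ b n ⟧ ℤ.* g n) ℤ.* Δ (q ^ j) h n) (sym (per n)))) ⟩
  ∑ A (λ n → Δ (p ^ i) (λ n → ⟦ b n ⟧ ℤ.* g n) n ℤ.* Δ (q ^ j) h n)
    ≡⟨ ex _ h (λ n → cong₂ ℤ._*_ (periodic-* p per n) (perg n)) perh ⟩
  0ℤ ∎
  where
  open ≡-Reasoning
  lem : ∀ b x y d → b ℤ.* ((x ℤ.- y) ℤ.* d) ≡ (b ℤ.* x ℤ.- b ℤ.* y) ℤ.* d
  lem = ℤ-Solver.solve-∀

-- Digit i depends only on n modulo p^(i+1), which divides p^i′. This is why restricting to a class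
-- of digit i preserves the conditions at larger exponents.
hasDigit-periodic-above : ∀ p {i i′} .{{_ : NonZero p}} → i < i′ → ∀ j →
  (p ^ i′) Periodic (λ n → ⟦ hasDigit p i j n ⟧)
hasDigit-periodic-above p {i} {i′} i<i′ j = subst (_Periodic (λ n → ⟦ hasDigit p i j n ⟧)) eq
  (periodic-* (p ^ (i′ ∸ suc i)) (hasDigit-periodic p i j))
  where
  eq : p ^ (i′ ∸ suc i) * p ^ suc i ≡ p ^ i′
  eq = trans (sym (ℕₚ.^-distribˡ-+-* p (i′ ∸ suc i) (suc i))) (cong (p ^_) (ℕₚ.m∸n+n≡m i<i′))

-- Congruences between sizes of digit classes

-- Passing to a digit class divides the size by exactly p and keeps equidistribution at all higher
-- exponents. Hence the exponents are consumed in increasing order.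
equidistributed-chain : ∀ p .{{_ : NonZero p}} E → AllPairs _<_ E → ∀ A →
  All (λ i → Equidistributed p i A) E →
  p ^ length E ∣ length A
equidistributed-chain p []      _            A _          = 1∣ length A
equidistributed-chain p (i ∷ E) (i< ∷ sorted) A (eq ∷ eqs) =
  subst (p ^ suc (length E) ∣_) (sym (equidistributed-digits p i A eq 0 (ℕ.>-nonZero⁻¹ p)))
    (*-monoʳ-∣ p (equidistributed-chain p E sorted (Digit p i 0 A)
      (All.map (λ {i′} (i<i′ , eq′) → equidistributed-filter {p} {i′} (hasDigit p i 0) A
        (hasDigit-periodic-above p i<i′ 0) eq′)
        (All.zip (i< , eqs)))))

Congruent : ℕ → (ℕ → ℕ) → Set
Congruent q c = ∀ t → ∃[ z ] ℤ.+ c (suc t) ℤ.- ℤ.+ c t ≡ ℤ.+ q ℤ.* z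

congruent-total : ∀ q c → Congruent q c → ∀ t → ∃[ z ] ℤ.+ c t ≡ ℤ.+ c 0 ℤ.+ ℤ.+ q ℤ.* z
congruent-total q c cg zero    =
  0ℤ , sym (trans (cong (ℤ._+_ (ℤ.+ c 0)) (ℤₚ.*-zeroʳ (ℤ.+ q))) (ℤₚ.+-identityʳ _))
congruent-total q c cg (suc t) with congruent-total q c cg t | cg t
... | z , e | y , e′ = z ℤ.+ y , (begin
  ℤ.+ c (suc t)                                           ≡⟨ lem (ℤ.+ c (suc t)) (ℤ.+ c t) ⟩
  ℤ.+ c t ℤ.+ (ℤ.+ c (suc t) ℤ.- ℤ.+ c t)                 ≡⟨ cong₂ ℤ._+_ e e′ ⟩
  ℤ.+ c 0 ℤ.+ ℤ.+ q ℤ.* z ℤ.+ ℤ.+ q ℤ.* y                 ≡⟨ lem′ (ℤ.+ c 0) (ℤ.+ q) z y ⟩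
  ℤ.+ c 0 ℤ.+ ℤ.+ q ℤ.* (z ℤ.+ y)                         ∎)
  where
  open ≡-Reasoning
  lem : ∀ x y → x ≡ y ℤ.+ (x ℤ.- y)
  lem = ℤ-Solver.solve-∀
  lem′ : ∀ c q z y → c ℤ.+ q ℤ.* z ℤ.+ q ℤ.* y ≡ c ℤ.+ q ℤ.* (z ℤ.+ y)
  lem′ = ℤ-Solver.solve-∀

congruent-≥ : ∀ q c → Congruent q c → ∀ s t → c s ≤ c t → ∃[ z ] c t ≡ c s + q * z
congruent-≥ q c cg s t s≤t with congruent-total q c cg s | congruent-total q c cg t
... | y , ey | x , ex = ℤ.∣ x ℤ.- y ∣ , trans (sym (ℕₚ.m+[n∸m]≡n s≤t)) (cong (c s +_) (begin
  c t ∸ c s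
      ≡⟨ cong ℤ.∣_∣ (trans (ℤₚ.m-n≡m⊖n (c t) (c s)) (ℤₚ.⊖-≥ s≤t)) ⟨
  ℤ.∣ ℤ.+ c t ℤ.- ℤ.+ c s ∣                               ≡⟨ cong ℤ.∣_∣ (cong₂ ℤ._-_ ex ey) ⟩
  ℤ.∣ ℤ.+ c 0 ℤ.+ ℤ.+ q ℤ.* x ℤ.- (ℤ.+ c 0 ℤ.+ ℤ.+ q ℤ.* y) ∣
      ≡⟨ cong ℤ.∣_∣ (lem (ℤ.+ c 0) (ℤ.+ q) x y) ⟩
  ℤ.∣ ℤ.+ q ℤ.* (x ℤ.- y) ∣                               ≡⟨ ℤₚ.abs-* (ℤ.+ q) (x ℤ.- y) ⟩
  q * ℤ.∣ x ℤ.- y ∣                                       ∎))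
  where
  open ≡-Reasoning
  lem : ∀ c q x y → c ℤ.+ q ℤ.* x ℤ.- (c ℤ.+ q ℤ.* y) ≡ q ℤ.* (x ℤ.- y)
  lem = ℤ-Solver.solve-∀

∑<ℕ-cong : ∀ m {c c′} → (∀ t → t < m → c t ≡ c′ t) → ∑<ℕ m c ≡ ∑<ℕ m c′
∑<ℕ-cong zero    e = refl
∑<ℕ-cong (suc m) e = cong₂ _+_ (∑<ℕ-cong m (λ t lt → e t (ℕₚ.m<n⇒m<1+n lt))) (e m (ℕₚ.n<1+n m))

∑<ℕ-affine : ∀ m x q (z : ℕ → ℕ) → ∑<ℕ m (λ t → x + q * z t) ≡ m * x + q * ∑<ℕ m z
∑<ℕ-affine zero    x q z = sym (ℕₚ.*-zeroʳ q)
∑<ℕ-affine (suc m) x q z rewrite ∑<ℕ-affine m x q z = lem m x q (∑<ℕ m z) (z m)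
  where
  lem : ∀ m x q s y → m * x + q * s + (x + q * y) ≡ x + m * x + q * (s + y)
  lem = solve-∀

∑<ℕ-≡0 : ∀ m c → ∑<ℕ m c ≡ 0 → ∀ t → t < m → c t ≡ 0
∑<ℕ-≡0 (suc m) c e t t<1+m with ℕₚ.m≤n⇒m<n∨m≡n (ℕₚ.≤-pred t<1+m)
... | inj₁ t<m  = ∑<ℕ-≡0 m c (ℕₚ.m+n≡0⇒m≡0 _ e) t t<m
... | inj₂ refl = ℕₚ.m+n≡0⇒n≡0 (∑<ℕ m c) e

∣⇒≡0⊎≤ : ∀ {m n} → m ∣ n → n ≡ 0 ⊎ m ≤ n
∣⇒≡0⊎≤ {n = zero}  d = inj₁ refl
∣⇒≡0⊎≤ {n = suc n} d = inj₂ (∣⇒≤ d)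

-- Subtract the minimum x: each term is x + q z, and since p divides the total and is coprime to q,
-- it divides the sum of the z. That sum is either 0, so that all terms agree, or at least p.
congruent-sum : ∀ {p q} → 1 ≤ p → Coprime p q → ∀ c → Congruent q c → p ∣ ∑<ℕ p c →
  p * c 0 ≡ ∑<ℕ p c ⊎ p * q ≤ ∑<ℕ p c
congruent-sum {p} {q} 1≤p cop c cg p∣ with ∃-min p 1≤p c
... | j , j<p , min = [ (λ z0 → inj₁ (allEqual z0)) , (λ le → inj₂ (large le)) ]′ (∣⇒≡0⊎≤ p∣∑z)
  where
  x = c j
  z : ℕ → ℕ
  z t with x ℕ.≤? c t
  ... | yes le = proj₁ (congruent-≥ q c cg j t le)
  -- Reached only for t ≥ p, since x is the minimum below p.
  ... | no _   = 0
  z≡ : ∀ t → t < p → c t ≡ x + q * z t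
  z≡ t t<p with x ℕ.≤? c t
  ... | yes le = proj₂ (congruent-≥ q c cg j t le)
  ... | no gt  = contradiction (min t t<p) gt
  total : ∑<ℕ p c ≡ p * x + q * ∑<ℕ p z
  total = trans (∑<ℕ-cong p z≡) (∑<ℕ-affine p x q z)
  p∣∑z : p ∣ ∑<ℕ p z
  p∣∑z = coprime-divisor cop (∣m+n∣m⇒∣n (subst (p ∣_) total p∣) (m∣m*n x))
  allEqual : ∑<ℕ p z ≡ 0 → p * c 0 ≡ ∑<ℕ p c
  allEqual z0 = begin
    p * c 0                 ≡⟨ cong (p *_) (z≡ 0 1≤p) ⟩
    p * (x + q * z 0)       ≡⟨ cong (λ y → p * (x + q * y)) (trans (∑<ℕ-≡0 p z z0 0 1≤p) (sym z0)) ⟩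
    p * (x + q * ∑<ℕ p z)   ≡⟨ cong (λ y → p * (x + q * y)) z0 ⟩
    p * (x + q * 0)         ≡⟨ lem p x q ⟩
    p * x + q * 0           ≡⟨ cong (λ y → p * x + q * y) z0 ⟨
    p * x + q * ∑<ℕ p z     ≡⟨ total ⟨
    ∑<ℕ p c                 ∎
    where
    open ≡-Reasoning
    lem : ∀ p x q → p * (x + q * 0) ≡ p * x + q * 0
    lem = solve-∀
  large : p ≤ ∑<ℕ p z → p * q ≤ ∑<ℕ p c
  large le = ℕₚ.≤-trans (subst (p * q ≤_) (ℕₚ.*-comm _ q) (ℕₚ.*-monoˡ-≤ q le))
    (subst (q * ∑<ℕ p z ≤_) (sym total) (ℕₚ.m≤n+m _ (p * x)))

module _ (p q i j : ℕ) .{{_ : NonZero p}} .{{_ : NonZero q}} where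

  exchange⇒∣ : ∀ A → Exchange p q i j A → ∀ {g} → (p ^ suc i) Periodic g →
    ∃[ z ] ∑ A (Δ (p ^ i) g) ≡ ℤ.+ q ℤ.* z
  exchange⇒∣ A ex {g} per = _ , invariant-total q j A (Δ (p ^ i) g) (λ h perh → ex g h per perh)

shift-periodic : ∀ {m} {g} s → m Periodic g → m Periodic (λ n → g (n + s))
shift-periodic {m} {g} s per n = trans (cong g (lem n m s)) (per (n + s))
  where
  lem : ∀ n m s → n + m + s ≡ n + s + m
  lem = solve-∀

module _ (p q i j : ℕ) .{{_ : NonZero p}} .{{_ : NonZero q}} (cop : Coprime p q) where

  private
    k = p ^ i
    instance
      pⁱ≢0 : NonZero (p ^ i)
      pⁱ≢0 = ℕₚ.m^n≢0 p i
      pⁱ⁺¹≢0 : NonZero (p ^ suc i)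
      pⁱ⁺¹≢0 = ℕₚ.m^n≢0 p (suc i)
    1≤p : 1 ≤ p
    1≤p = ℕ.>-nonZero⁻¹ p

  -- Nonnegative integers with sum 1: g is the indicator of a set of residues modulo p^(i+1) that
  -- meets every orbit of the shift by p^i exactly once. Digit classes are examples, but comparing
  -- single residues needs others.
  record Transversal (g : ℕ → ℤ) : Set where
    field
      periodic : (p ^ suc i) Periodic g
      nonneg   : ∀ n → 0ℤ ℤ.≤ g n
      total    : ∀ n → Σ< p (λ t → g (n + t * k)) ≡ 1ℤ

  open Transversal

  -- The sums over A of the p translates of g are congruent modulo q by the exchange identity, and
  -- they add up to |A|, so `congruent-sum` applies.
  transversal-sum : ∀ A → Exchange p q i j A → p ∣ length A → ∀ {g} → Transversal g →
    ℤ.+ p ℤ.* ∑ A g ≡ ℤ.+ length A ⊎ p * q ≤ length A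
  transversal-sum A ex p∣ {g} T =
    [ (λ e → inj₁ (small e)) , (λ le → inj₂ (subst (p * q ≤_) total≡ le)) ]′
    (congruent-sum 1≤p cop c congr (subst (p ∣_) (sym total≡) p∣))
    where
    g′ : ℕ → ℕ → ℤ
    g′ t n = g (n + t * k)
    c : ℕ → ℕ
    c t = ℤ.∣ ∑ A (g′ t) ∣
    c≡ : ∀ t → ℤ.+ c t ≡ ∑ A (g′ t)
    c≡ t = ℤₚ.0≤i⇒+∣i∣≡i (∑-nonneg A (g′ t) (λ n → nonneg T (n + t * k)))
    congr : Congruent q c
    congr t with exchange⇒∣ p q i j A ex (shift-periodic (t * k) (periodic T))
    ... | z , e = z , trans (cong₂ ℤ._-_ (c≡ (suc t)) (c≡ t)) (trans (sym (∑-- A (g′ (suc t)) (g′ t)))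
      (trans (∑-cong A (λ n → cong (λ x → g x ℤ.- g′ t n) (sym (ℕₚ.+-assoc n k (t * k))))) e))
    total≡ : ∑<ℕ p c ≡ length A
    total≡ = ℤₚ.+-injective (begin
      ℤ.+ ∑<ℕ p c                              ≡⟨ +-∑<ℕ p c ⟩
      Σ< p (λ t → ℤ.+ c t)                     ≡⟨ Σ<-cong p (λ t _ → c≡ t) ⟩
      Σ< p (λ t → ∑ A (g′ t))                  ≡⟨ ∑-Σ< A p g′ ⟨
      ∑ A (λ n → Σ< p (λ t → g′ t n))          ≡⟨ ∑-cong A (total T) ⟩
      ∑ A (λ _ → 1ℤ)                           ≡⟨ ∑-1 A ⟩
      ℤ.+ length A                             ∎)
      where open ≡-Reasoning
    small : p * c 0 ≡ ∑<ℕ p c → ℤ.+ p ℤ.* ∑ A g ≡ ℤ.+ length A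
    small e = begin
      ℤ.+ p ℤ.* ∑ A g
          ≡⟨ cong (ℤ.+ p ℤ.*_) (trans (∑-cong A (λ n → cong g (sym (ℕₚ.+-identityʳ n)))) (sym (c≡ 0))) ⟩
      ℤ.+ p ℤ.* ℤ.+ c 0       ≡⟨ ℤₚ.pos-* p (c 0) ⟨
      ℤ.+ (p * c 0)           ≡⟨ cong ℤ.+_ (trans e total≡) ⟩
      ℤ.+ length A            ∎
      where open ≡-Reasoning

  digit-total : ∀ d → d < p → ∀ n → Σ< p (λ t → ⟦ hasDigit p i d (n + t * k) ⟧) ≡ 1ℤ
  digit-total d d<p n = trans (Σ<-cong p (λ t _ → cong (λ x → ⟦ x ≡ᵇ d ⟧) (digit-shift p i n t)))
    (rotate (n / k))
    where
    f : ℕ → ℤ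
    f x = ⟦ x % p ≡ᵇ d ⟧
    rotate : ∀ x → Σ< p (λ t → f (x + t)) ≡ 1ℤ
    rotate zero = trans
      (Σ<-cong p (λ t t<p → cong ⟦_⟧ (trans (cong (_≡ᵇ d) (DM.m<n⇒m%n≡m t<p)) (≡ᵇ-sym t d))))
      (Σ<-⟦≡⟧ p d d<p)
    -- The window moves by one: f (x + p) enters, f (x + 0) leaves, and they agree because f has
    -- period p.
    rotate (suc x) = trans (sym (ℤₚ.i-j≡0⇒i≡j _ _ (begin
      Σ< p (λ t → f (x + t)) ℤ.- Σ< p (λ t → f (suc x + t))
        ≡⟨ cong (λ z → Σ< p (λ t → f (x + t)) ℤ.- z)
            (Σ<-cong p (λ t _ → trans (cong f (sym (ℕₚ.+-suc x t)))
            (lem (f (x + t)) (f (x + suc t))))) ⟩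
      Σ< p (λ t → f (x + t)) ℤ.- Σ< p (λ t → f (x + t) ℤ.+ (f (x + suc t) ℤ.- f (x + t)))
        ≡⟨ cong (λ z → Σ< p (λ t → f (x + t)) ℤ.- z)
            (trans (Σ<-+ p (λ t → f (x + t)) (λ t → f (x + suc t) ℤ.- f (x + t)))
             (cong (λ z → Σ< p (λ t → f (x + t)) ℤ.+ z) (Σ<-telescope p (λ t → f (x + t))))) ⟩
      Σ< p (λ t → f (x + t)) ℤ.- (Σ< p (λ t → f (x + t)) ℤ.+ (f (x + p) ℤ.- f (x + 0)))
        ≡⟨ cong (λ z → Σ< p (λ t → f (x + t)) ℤ.- (Σ< p (λ t → f (x + t)) ℤ.+ (z ℤ.- f (x + 0))))
             (cong (λ y → ⟦ y ≡ᵇ d ⟧)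
               (trans (DM.[m+n]%n≡m%n x p) (cong (_% p) (sym (ℕₚ.+-identityʳ x))))) ⟩
      Σ< p (λ t → f (x + t)) ℤ.- (Σ< p (λ t → f (x + t)) ℤ.+ (f (x + 0) ℤ.- f (x + 0)))
        ≡⟨ lem′ (Σ< p (λ t → f (x + t))) (f (x + 0)) ⟩
      0ℤ ∎))) (rotate x)
      where
      open ≡-Reasoning
      lem : ∀ a b → b ≡ a ℤ.+ (b ℤ.- a)
      lem = ℤ-Solver.solve-∀
      lem′ : ∀ s a → s ℤ.- (s ℤ.+ (a ℤ.- a)) ≡ 0ℤ
      lem′ = ℤ-Solver.solve-∀

  digit-transversal : ∀ d → d < p → Transversal (λ n → ⟦ hasDigit p i d n ⟧)
  digit-transversal d d<p = record
    { periodic = hasDigit-periodic p i d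
    ; nonneg   = λ n → ⟦⟧-nonneg (hasDigit p i d n)
    ; total    = digit-total d d<p
    }

  -- Replace the residue r by r − k in the digit class of r.
  swapped-transversal : ∀ r → r < p ^ suc i →
    Transversal (λ n → ⟦ hasDigit p i (digit p i r) n ⟧ ℤ.+ Δ k (residue (p ^ suc i) r) n)
  swapped-transversal r r<m = record
    { periodic = λ n → cong₂ ℤ._+_ (hasDigit-periodic p i d n)
          (cong₂ ℤ._-_ (shift-periodic k (residue-periodic m r) n) (residue-periodic m r n))
    ; nonneg   = λ n → nonneg′ n (n % m ℕ.≟ r)
    ; total    = λ n →
          trans (Σ<-+ p (λ t → ⟦ hasDigit p i d (n + t * k) ⟧) (λ t → Δ k (residue m r) (n + t * k)))
                   (cong₂ ℤ._+_ (digit-total d (digit< p i r) n) (vanish n))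
    }
    where
    m = p ^ suc i
    d = digit p i r
    vanish : ∀ n → Σ< p (λ t → Δ k (residue m r) (n + t * k)) ≡ 0ℤ
    vanish n = begin
      Σ< p (λ t → Δ k (residue m r) (n + t * k))
        ≡⟨ Σ<-cong p (λ t _ → cong (λ x → residue m r x ℤ.- residue m r (n + t * k))
            (lem n (t * k) k)) ⟩
      Σ< p (λ t → residue m r (n + suc t * k) ℤ.- residue m r (n + t * k))
        ≡⟨ Σ<-telescope p (λ t → residue m r (n + t * k)) ⟩
      residue m r (n + p * k) ℤ.- residue m r (n + 0)
        ≡⟨ cong₂ ℤ._-_ (residue-periodic m r n) (cong (residue m r) (ℕₚ.+-identityʳ n)) ⟩
      residue m r n ℤ.- residue m r n
        ≡⟨ ℤₚ.+-inverseʳ (residue m r n) ⟩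
      0ℤ ∎
      where
      open ≡-Reasoning
      lem : ∀ n s k → n + s + k ≡ n + (k + s)
      lem = solve-∀
    nonneg′ : ∀ n → Dec (n % m ≡ r) → 0ℤ ℤ.≤ ⟦ hasDigit p i d n ⟧ ℤ.+ Δ k (residue m r) n
    -- The only negative contribution is -1 at the residue r, where the digit indicator equals 1.
    nonneg′ n (yes e) = subst₂ (λ b b′ → 0ℤ ℤ.≤ ⟦ b ⟧ ℤ.+ (residue m r (n + k) ℤ.- ⟦ b′ ⟧))
      (sym (trans (cong (_≡ᵇ d) same) (≡ᵇ-refl d))) (sym (trans (cong (_≡ᵇ r) e) (≡ᵇ-refl r)))
      (subst (0ℤ ℤ.≤_) (lem (residue m r (n + k))) (⟦⟧-nonneg ((n + k) % m ≡ᵇ r)))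
      where
      lem : ∀ x → x ≡ 1ℤ ℤ.+ (x ℤ.- 1ℤ)
      lem = ℤ-Solver.solve-∀
      steps : ∀ s x → digit p i (x + s * m) ≡ digit p i x
      steps zero    x = cong (digit p i) (ℕₚ.+-identityʳ x)
      steps (suc s) x = trans (cong (digit p i) (sym (ℕₚ.+-assoc x m (s * m))))
        (trans (steps s (x + m)) (digit-periodic p i x))
      same : digit p i n ≡ d
      same = trans (cong (digit p i) (DM.m≡m%n+[m/n]*n n m))
        (trans (steps (n / m) (n % m)) (cong (digit p i) e))
    nonneg′ n (no ne) = subst (λ b′ → 0ℤ ℤ.≤ ⟦ hasDigit p i d n ⟧ ℤ.+ (residue m r (n + k) ℤ.- ⟦ b′ ⟧))
      (sym (≡ᵇ-≢ (n % m) r ne))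
      (ℤₚ.+-mono-≤ (⟦⟧-nonneg (hasDigit p i d n))
        (subst (0ℤ ℤ.≤_) (sym (ℤₚ.+-identityʳ (residue m r (n + k)))) (⟦⟧-nonneg ((n + k) % m ≡ᵇ r))))

  -- If |A| < p q, every transversal has sum |A|/p. Comparing the digit class of r with its swapped
  -- version isolates the difference of the indicator of r, and these differences suffice for
  -- equidistribution.
  exchange-dichotomy : ∀ A → Exchange p q i j A → p ∣ length A →
    Equidistributed p i A ⊎ p * q ≤ length A
  exchange-dichotomy A ex p∣ with p * q ℕ.≤? length A
  ... | yes le = inj₂ le
  ... | no nle = inj₁ (residues⇒equidistributed p i A vanish)
    where
    exact : ∀ {g} → Transversal g → ℤ.+ p ℤ.* ∑ A g ≡ ℤ.+ length A
    exact T = [ (λ e → e) , (λ le → contradiction le nle) ]′ (transversal-sum A ex p∣ T)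
    vanish : ∀ {r} → r < p ^ suc i → ∑ A (Δ k (residue (p ^ suc i) r)) ≡ 0ℤ
    vanish {r} r< = ℤₚ.*-cancelˡ-≡ (ℤ.+ p) D 0ℤ (begin
      ℤ.+ p ℤ.* D                         ≡⟨ lem (ℤ.+ p) G D ⟩
      ℤ.+ p ℤ.* (G ℤ.+ D) ℤ.- ℤ.+ p ℤ.* G
          ≡⟨ cong (λ z → ℤ.+ p ℤ.* z ℤ.- ℤ.+ p ℤ.* G)
          (∑-+ A (λ n → ⟦ hasDigit p i d n ⟧) (Δ k (residue (p ^ suc i) r))) ⟨
      ℤ.+ p ℤ.* ∑ A (λ n → ⟦ hasDigit p i d n ⟧ ℤ.+ Δ k (residue (p ^ suc i) r) n) ℤ.- ℤ.+ p ℤ.* G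
                                          ≡⟨ cong₂ ℤ._-_ (exact (swapped-transversal r r<))
                                              (exact (digit-transversal d (digit< p i r))) ⟩
      ℤ.+ length A ℤ.- ℤ.+ length A       ≡⟨ ℤₚ.+-inverseʳ (ℤ.+ length A) ⟩
      0ℤ                                  ≡⟨ ℤₚ.*-zeroʳ (ℤ.+ p) ⟨
      ℤ.+ p ℤ.* 0ℤ                        ∎)
      where
      open ≡-Reasoning
      d = digit p i r
      D = ∑ A (Δ k (residue (p ^ suc i) r))
      G = ∑ A (λ n → ⟦ hasDigit p i d n ⟧)
      lem : ∀ p g d → p ℤ.* d ≡ p ℤ.* (g ℤ.+ d) ℤ.- p ℤ.* g
      lem = ℤ-Solver.solve-∀

coprime-*-∣ : ∀ {p q n} → Coprime p q → p ∣ n → q ∣ n → p * q ∣ n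
coprime-*-∣ {p} {q} cop (divides k refl) q∣ =
  subst (p * q ∣_) (ℕₚ.*-comm p k)
    (*-monoʳ-∣ p (coprime-divisor (coprime-sym cop) (subst (q ∣_) (ℕₚ.*-comm k p) q∣)))

exchange-digit : ∀ {p q i j i′} .{{_ : NonZero p}} A t → i′ < i → Exchange p q i j A →
  Exchange p q i j (Digit p i′ t A)
exchange-digit {p} {q} {i} {j} {i′} A t lt = exchange-filter {p} {q} {i} {j} (hasDigit p i′ t) A
  (hasDigit-periodic-above p lt t)

exchange-digitʳ : ∀ {p q i j j′} .{{_ : NonZero q}} A t → j′ < j → Exchange p q i j A →
  Exchange p q i j (Digit q j′ t A)
exchange-digitʳ {p} {q} {i} {j} {j′} A t lt ex =
  exchange-sym {q} {p} {j} {i} {Digit q j′ t A}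
    (exchange-digit {q} {p} {j} {i} A t lt (exchange-sym {p} {q} {i} {j} {A} ex))

equidistributed-digit : ∀ {p i i′} .{{_ : NonZero p}} A t → i′ < i → Equidistributed p i A →
  Equidistributed p i (Digit p i′ t A)
equidistributed-digit {p} {i} {i′} A t lt = equidistributed-filter {p} {i} (hasDigit p i′ t) A
  (hasDigit-periodic-above p lt t)

equidistributed⇒∣ : ∀ {p i} .{{_ : NonZero p}} A → Equidistributed p i A → p ∣ length A
equidistributed⇒∣ {p} {i} A eq =
  subst (p ∣_) (sym (equidistributed-digits p i A eq 0 (ℕ.>-nonZero⁻¹ p)))
    (m∣m*n (length (Digit p i 0 A)))

module _ (p q : ℕ) .{{_ : NonZero p}} .{{_ : NonZero q}} (cop : Coprime p q) where

  -- The classes of the q-digit j′ have |A|/q elements each, still a multiple of p, and keep the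
  -- exchange identity as j′ < j. Either one of them has at least p q elements, or all are
  -- equidistributed at p^(i+1), and then so is their union.
  coarser-dichotomy : ∀ {i j j′} A → j′ < j → Equidistributed q j′ A → p ∣ length A →
    Exchange p q i j A →
    Equidistributed p i A ⊎ q * (p * q) ≤ length A
  coarser-dichotomy {i} {j} {j′} A lt eq p∣ ex with q * (p * q) ℕ.≤? length A
  ... | yes le = inj₂ le
  ... | no nle = inj₁ λ g per → trans (sym (∑-Digit q j′ A (Δ (p ^ i) g)))
                  (Σ<-0 q (λ t t<q → class t t<q g per))
    where
    class : ∀ t → t < q → Equidistributed p i (Digit q j′ t A)
    class t t<q with exchange-dichotomy p q i j cop (Digit q j′ t A)
      (exchange-digitʳ {p} {q} {i} {j} A t lt ex)
                       (coprime-divisor cop (subst (p ∣_) (equidistributed-digits q j′ A eq t t<q) p∣))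
    ... | inj₁ e  = e
    ... | inj₂ le =
        contradiction (subst (q * (p * q) ≤_) (sym (equidistributed-digits q j′ A eq t t<q))
        (ℕₚ.*-monoʳ-≤ q le)) nle

  -- Neighbouring classes differ by the sum of the difference of a digit indicator, which the
  -- exchange identity makes a multiple of q.
  digit-lengths-congruent : ∀ {i j} A → Exchange p q i j A → ∀ t → t < p →
    (ℤ.+ q) ℤᵈ.∣ (ℤ.+ length (Digit p i t A) ℤ.- ℤ.+ length (Digit p i 0 A))
  digit-lengths-congruent {i} {j} A ex zero    t<p =
    ℤᵈ.divides 0ℤ (ℤₚ.+-inverseʳ (ℤ.+ length (Digit p i 0 A)))
  digit-lengths-congruent {i} {j} A ex (suc t) t<p =
    subst (ℤ.+ q ℤᵈ.∣_) (lem (ℤ.+ c (suc t)) (ℤ.+ c t) (ℤ.+ c 0))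
      (ℤᵈ.∣m∣n⇒∣m+n (ℤᵈ.∣m⇒∣-m step)
        (digit-lengths-congruent {i} {j} A ex t (ℕₚ.<-trans (ℕₚ.n<1+n t) t<p)))
    where
    c : ℕ → ℕ
    c t = length (Digit p i t A)
    g : ℕ → ℤ
    g n = ⟦ hasDigit p i (suc t) n ⟧
    step : (ℤ.+ q) ℤᵈ.∣ (ℤ.+ c t ℤ.- ℤ.+ c (suc t))
    step with exchange⇒∣ p q i j A ex (hasDigit-periodic p i (suc t))
    ... | z , e = ℤᵈ.divides z
        (trans (cong₂ ℤ._-_ (length-filter (hasDigit p i t) A) (length-filter (hasDigit p i (suc t)) A))
      (trans (sym (∑-- A (λ n → ⟦ hasDigit p i t n ⟧) g))
      (trans (∑-cong A (λ n → cong (λ b → ⟦ b ⟧ ℤ.- g n) (sym (hasDigit-suc p i t t<p n))))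
      (trans e (ℤₚ.*-comm (ℤ.+ q) z)))))
    lem : ∀ x y z → ℤ.- (y ℤ.- x) ℤ.+ (y ℤ.- z) ≡ x ℤ.- z
    lem = ℤ-Solver.solve-∀

  Σ<-∣ : ∀ m {f} → (∀ t → t < m → (ℤ.+ q) ℤᵈ.∣ f t) → (ℤ.+ q) ℤᵈ.∣ Σ< m f
  Σ<-∣ zero    d = ℤᵈ.divides 0ℤ refl
  Σ<-∣ (suc m) d = ℤᵈ.∣m∣n⇒∣m+n (Σ<-∣ m (λ t lt → d t (ℕₚ.m<n⇒m<1+n lt))) (d m (ℕₚ.n<1+n m))

  -- The sizes of the classes of digit i are congruent modulo q and their sum is a multiple of q. As
  -- p is invertible modulo q, each size is a multiple of q. Each class remains equidistributed at
  -- p^(i′+1), so its size is also a multiple of p; if nonempty, it has at least p q elements.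
  finer-dichotomy : ∀ {i i′ j} A → i < i′ → Equidistributed p i′ A → q ∣ length A → Exchange p q i j A →
    p * (p * q) ≤ length A ⊎ ∃[ t ] t < p × length (Digit p i t A) ≡ 0
  finer-dichotomy {i} {i′} {j} A lt eq q∣ ex with ℕₚ.anyUpTo? (λ t → length (Digit p i t A) ℕ.≟ 0) p
  ... | yes empty = inj₂ empty
  ... | no ¬empty =
      inj₁ (subst (p * (p * q) ≤_) (sym (length-digits p i A)) (∑<ℕ-≥ p c (p * q) λ t t<p →
          [ (λ e → contradiction (t , t<p , e) ¬empty) , (λ le → le) ]′ (∣⇒≡0⊎≤ (pq∣ t t<p))))
    where
    c : ℕ → ℕ
    c t = length (Digit p i t A)
    total : ℤ.+ length A ≡ ℤ.+ (p * c 0) ℤ.+ Σ< p (λ t → ℤ.+ c t ℤ.- ℤ.+ c 0)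
    total = begin
      ℤ.+ length A
          ≡⟨ cong ℤ.+_ (length-digits p i A) ⟩
      ℤ.+ ∑<ℕ p c                                                        ≡⟨ +-∑<ℕ p c ⟩
      Σ< p (λ t → ℤ.+ c t)
          ≡⟨ Σ<-cong p (λ t _ → lem (ℤ.+ c t) (ℤ.+ c 0)) ⟩
      Σ< p (λ t → ℤ.+ c 0 ℤ.+ (ℤ.+ c t ℤ.- ℤ.+ c 0))
          ≡⟨ Σ<-+ p (λ _ → ℤ.+ c 0) (λ t → ℤ.+ c t ℤ.- ℤ.+ c 0) ⟩
      Σ< p (λ _ → ℤ.+ c 0) ℤ.+ Σ< p (λ t → ℤ.+ c t ℤ.- ℤ.+ c 0)
          ≡⟨ cong (ℤ._+ Σ< p (λ t → ℤ.+ c t ℤ.- ℤ.+ c 0))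
          (trans (Σ<-const p (ℤ.+ c 0)) (sym (ℤₚ.pos-* p (c 0)))) ⟩
      ℤ.+ (p * c 0) ℤ.+ Σ< p (λ t → ℤ.+ c t ℤ.- ℤ.+ c 0)                 ∎
      where
      open ≡-Reasoning
      lem : ∀ x y → x ≡ y ℤ.+ (x ℤ.- y)
      lem = ℤ-Solver.solve-∀
    q∣c0 : q ∣ c 0
    q∣c0 = coprime-divisor (coprime-sym cop) (ℤᵈ.∣⇒∣ᵤ {ℤ.+ q} {ℤ.+ (p * c 0)} (ℤᵈ.∣m+n∣n⇒∣m
      {ℤ.+ q} {ℤ.+ (p * c 0)}
      (subst ((ℤ.+ q) ℤᵈ.∣_) total (ℤᵈ.∣ᵤ⇒∣ {ℤ.+ q} {ℤ.+ length A} q∣))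
      (Σ<-∣ p (λ t t<p → digit-lengths-congruent {i} {j} A ex t t<p))))
    q∣c : ∀ t → t < p → q ∣ c t
    q∣c t t<p = ℤᵈ.∣⇒∣ᵤ {ℤ.+ q} {ℤ.+ c t} (subst ((ℤ.+ q) ℤᵈ.∣_) (lem (ℤ.+ c t) (ℤ.+ c 0))
      (ℤᵈ.∣m∣n⇒∣m+n (digit-lengths-congruent {i} {j} A ex t t<p) (ℤᵈ.∣ᵤ⇒∣ {ℤ.+ q} {ℤ.+ c 0} q∣c0)))
      where
      lem : ∀ x y → x ℤ.- y ℤ.+ y ≡ x
      lem = ℤ-Solver.solve-∀
    pq∣ : ∀ t → t < p → p * q ∣ c t
    pq∣ t t<p = coprime-*-∣ cop
      (equidistributed⇒∣ {p} {i′} (Digit p i t A) (equidistributed-digit A t lt eq)) (q∣c t t<p)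

  -- If the shifted product sums B(s,v) vanish for s = 0 and for v = 0, then the exchange
  -- relation propagates this to all s and v, and ΣB = |A|.
  empty-digits⇒empty : ∀ {i j} A → Exchange p q i j A → ∀ t u → t < p → u < q →
    length (Digit p i t A) ≡ 0 → length (Digit q j u A) ≡ 0 → length A ≡ 0
  empty-digits⇒empty {i} {j} A ex t u t<p u<q et eu = ℤₚ.+-injective (begin
    ℤ.+ length A
      ≡⟨ ∑-1 A ⟨
    ∑ A (λ _ → 1ℤ)
      ≡⟨ ∑-cong A (λ n → trans
          (sym (cong₂ ℤ._*_ (digit-total p q i j cop t t<p n)
          (digit-total q p j i (coprime-sym cop) u u<q n)))
           (trans (ℤₚ.*-comm (Σ< p (λ s → G s n)) (Σ< q (λ v → H v n)))
             (sym (Σ<-*ˡ p (Σ< q (λ v → H v n)) (λ s → G s n))))) ⟩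
    ∑ A (λ n → Σ< p (λ s → Σ< q (λ v → H v n) ℤ.* G s n))
      ≡⟨ ∑-Σ< A p (λ s n → Σ< q (λ v → H v n) ℤ.* G s n) ⟩
    Σ< p (λ s → ∑ A (λ n → Σ< q (λ v → H v n) ℤ.* G s n))
      ≡⟨ Σ<-0 p (λ s _ → trans
          (∑-cong A (λ n → trans (ℤₚ.*-comm (Σ< q (λ v → H v n)) (G s n))
          (sym (Σ<-*ˡ q (G s n) (λ v → H v n)))))
           (trans (∑-Σ< A q (λ v n → G s n ℤ.* H v n)) (Σ<-0 q (λ v _ → B≡0 s v)))) ⟩
    0ℤ ∎)
    where
    open ≡-Reasoning
    G : ℕ → ℕ → ℤ
    G s n = ⟦ hasDigit p i t (n + s * p ^ i) ⟧
    H : ℕ → ℕ → ℤ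
    H v n = ⟦ hasDigit q j u (n + v * q ^ j) ⟧
    B : ℕ → ℕ → ℤ
    B s v = ∑ A (λ n → G s n ℤ.* H v n)
    ∑-empty : ∀ D f → length D ≡ 0 → ∑ D f ≡ 0ℤ
    ∑-empty [] f _ = refl
    B0 : ∀ v → B 0 v ≡ 0ℤ
    B0 v = trans (∑-cong A (λ n → cong (λ m → ⟦ hasDigit p i t m ⟧ ℤ.* H v n) (ℕₚ.+-identityʳ n)))
      (trans (sym (∑-filter (hasDigit p i t) A (H v))) (∑-empty (Digit p i t A) (H v) et))
    0B : ∀ s → B s 0 ≡ 0ℤ
    0B s = trans (∑-cong A
      (λ n → trans (ℤₚ.*-comm (G s n) (H 0 n))
      (cong (λ m → ⟦ hasDigit q j u m ⟧ ℤ.* G s n) (ℕₚ.+-identityʳ n))))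
      (trans (sym (∑-filter (hasDigit q j u) A (G s))) (∑-empty (Digit q j u A) (G s) eu))
    square : ∀ s v → B (suc s) (suc v) ℤ.- B (suc s) v ℤ.- (B s (suc v) ℤ.- B s v) ≡ 0ℤ
    square s v = begin
      B (suc s) (suc v) ℤ.- B (suc s) v ℤ.- (B s (suc v) ℤ.- B s v)
        ≡⟨ cong₂ ℤ._-_ (∑-- A (λ n → G (suc s) n ℤ.* H (suc v) n) (λ n → G (suc s) n ℤ.* H v n))
            (∑-- A (λ n → G s n ℤ.* H (suc v) n) (λ n → G s n ℤ.* H v n)) ⟨
      ∑ A (λ n → G (suc s) n ℤ.* H (suc v) n ℤ.- G (suc s) n ℤ.* H v n) ℤ.- ∑ A
        (λ n → G s n ℤ.* H (suc v) n ℤ.- G s n ℤ.* H v n)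
        ≡⟨ ∑-- A (λ n → G (suc s) n ℤ.* H (suc v) n ℤ.- G (suc s) n ℤ.* H v n)
            (λ n → G s n ℤ.* H (suc v) n ℤ.- G s n ℤ.* H v n) ⟨
      ∑ A (λ n → G (suc s) n ℤ.* H (suc v) n ℤ.- G (suc s) n ℤ.* H v n ℤ.-
        (G s n ℤ.* H (suc v) n ℤ.- G s n ℤ.* H v n))
        ≡⟨ ∑-cong A (λ n → trans (lem (G (suc s) n) (H (suc v) n) (H v n) (G s n))
             (cong₂ (λ x y → (x ℤ.- G s n) ℤ.* (y ℤ.- H v n))
               (cong (λ m → ⟦ hasDigit p i t m ⟧) (sym (ℕₚ.+-assoc n (p ^ i) (s * p ^ i))))
               (cong (λ m → ⟦ hasDigit q j u m ⟧) (sym (ℕₚ.+-assoc n (q ^ j) (v * q ^ j)))))) ⟩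
      ∑ A (λ n → Δ (p ^ i) (G s) n ℤ.* Δ (q ^ j) (H v) n)
        ≡⟨ ex (G s) (H v) (shift-periodic (s * p ^ i) (hasDigit-periodic p i t))
            (shift-periodic (v * q ^ j) (hasDigit-periodic q j u)) ⟩
      0ℤ ∎
      where
      lem : ∀ g h h′ g′ → g ℤ.* h ℤ.- g ℤ.* h′ ℤ.- (g′ ℤ.* h ℤ.- g′ ℤ.* h′) ≡ (g ℤ.- g′) ℤ.* (h ℤ.- h′)
      lem = ℤ-Solver.solve-∀
    B≡0 : ∀ s v → B s v ≡ 0ℤ
    B≡0 zero    v       = B0 v
    B≡0 (suc s) zero    = 0B (suc s)
    B≡0 (suc s) (suc v) = trans (lem (B (suc s) (suc v)) (B (suc s) v) (B s (suc v)) (B s v))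
      (trans (cong₂ ℤ._+_ (square s v)
        (cong₂ ℤ._+_ (B≡0 (suc s) v) (cong₂ ℤ._-_ (B≡0 s (suc v)) (B≡0 s v)))) refl)
      where
      lem : ∀ a b c d → a ≡ a ℤ.- b ℤ.- (c ℤ.- d) ℤ.+ (b ℤ.+ (c ℤ.- d))
      lem = ℤ-Solver.solve-∀

-- If the bound fails in both directions, some p-digit class and some q-digit class are empty. The
-- exchange identity rules this out for nonempty A.
finer-bound : ∀ p q .{{_ : NonZero p}} .{{_ : NonZero q}} → Coprime p q → ∀ {i i′ j j′} A →
  1 ≤ length A →
  i < i′ → Equidistributed p i′ A → j < j′ → Equidistributed q j′ A → Exchange p q i j A →
  p * (p * q) ≤ length A ⊎ q * (q * p) ≤ length A
finer-bound p q cop {i} {i′} {j} {j′} A 1≤ i< eqp j< eqq ex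
  with finer-dichotomy p q cop {i} {i′} {j} A i< eqp (equidistributed⇒∣ {q} {j′} A eqq) ex
     | finer-dichotomy q p (coprime-sym cop) {j} {j′} {i} A j< eqq (equidistributed⇒∣ {p} {i′} A eqp)
       (exchange-sym {p} {q} {i} {j} {A} ex)
... | inj₁ le | _ = inj₁ le
... | inj₂ _  | inj₁ le = inj₂ le
... | inj₂ (t , t<p , et) | inj₂ (u , u<q , eu) =
  contradiction (subst (1 ≤_) (empty-digits⇒empty p q cop {i} {j} A ex t u t<p u<q et eu) 1≤) λ ()

-- The lower bound

-- Exponents are shifted: onlyP i, onlyQ j and both i j stand for the scales
-- p^(i+1), q^(j+1) and p^(i+1) q^(j+1).
data Scale : Set where
  onlyP onlyQ : ℕ → Scale
  both        : ℕ → ℕ → Scale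

data PExp (i : ℕ) : Scale → Set where
  onlyP : PExp i (onlyP i)
  both  : ∀ {j} → PExp i (both i j)

data QExp (j : ℕ) : Scale → Set where
  onlyQ : QExp j (onlyQ j)
  both  : ∀ {i} → QExp j (both i j)

Vanishes : ℕ → ℕ → List ℕ → Scale → Set
Vanishes p q A (onlyP i)  = Equidistributed p i A
Vanishes p q A (onlyQ j)  = Equidistributed q j A
Vanishes p q A (both i j) = Exchange p q i j A

-- E and G are the (shifted) exponents at which p-fibers and q-fibers are chosen.
Covers : List ℕ → List ℕ → Scale → Set
Covers E G c = (∃[ i ] i ∈ E × PExp i c) ⊎ (∃[ j ] j ∈ G × QExp j c)

Bound : ℕ → ℕ → List Scale → ℕ → Set
Bound p q S w = ∃[ E ] ∃[ G ] All (Covers E G) S × p ^ length E * q ^ length G ≤ w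

-- Exchanging the primes reduces arguments in direction q to direction p.
transpose : Scale → Scale
transpose (onlyP i)  = onlyQ i
transpose (onlyQ j)  = onlyP j
transpose (both i j) = both j i

vanishes-transpose : ∀ {p q A} c → Vanishes p q A c → Vanishes q p A (transpose c)
vanishes-transpose         (onlyP i)  v = v
vanishes-transpose         (onlyQ j)  v = v
vanishes-transpose {p} {q} {A} (both i j) v = exchange-sym {p} {q} {i} {j} {A} v

covers-transpose : ∀ {E G} c → Covers E G (transpose c) → Covers G E c
covers-transpose (onlyP i)  (inj₂ (_ , i∈ , onlyQ)) = inj₁ (i , i∈ , onlyP)
covers-transpose (onlyQ j)  (inj₁ (_ , j∈ , onlyP)) = inj₂ (j , j∈ , onlyQ)
covers-transpose (both i j) (inj₁ (_ , j∈ , both))  = inj₂ (j , j∈ , both)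
covers-transpose (both i j) (inj₂ (_ , i∈ , both))  = inj₁ (i , i∈ , both)

bound-transpose : ∀ {p q w} S → Bound p q (map transpose S) w → Bound q p S w
bound-transpose {p} {q} {w} S (E , G , cov , le) =
  G , E , All.map (λ {c} → covers-transpose c) (Allₚ.map⁻ cov) , subst (_≤ w)
    (ℕₚ.*-comm (p ^ length E) (q ^ length G)) le

bound-↭ : ∀ {p q w S T} → S ↭ T → Bound p q T w → Bound p q S w
bound-↭ perm (E , G , cov , le) = E , G , All-resp-↭ (↭-sym perm) cov , le

-- The value at `onlyQ` is a dummy: `PLive` also asks for `PExp (pExp c) c`, which has no inhabitant
-- there.
pExp : Scale → ℕ
pExp (onlyP i)  = i
pExp (onlyQ j)  = 0
pExp (both i j) = i

PLive : ∀ p .{{_ : NonZero p}} → List ℕ → Scale → Set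
PLive p A c = PExp (pExp c) c × Splits p (pExp c) A

∃-lowest : ∀ c S → ∃[ c′ ] c′ ∈ c ∷ S × All (λ c″ → pExp c′ ≤ pExp c″) (c ∷ S)
∃-lowest c []       = c , here refl , ℕₚ.≤-refl ∷ []
∃-lowest c (d ∷ S) with ∃-lowest d S
... | l , l∈ , low with pExp c ℕ.≤? pExp l
...   | yes le = c , here refl , ℕₚ.≤-refl ∷ All.map (ℕₚ.≤-trans le) low
...   | no gt  = l , there l∈ , ℕₚ.<⇒≤ (ℕₚ.≰⇒> gt) ∷ low

vanishes-digit : ∀ {p q i t A} .{{_ : NonZero p}} c → PExp (pExp c) c → i < pExp c →
  Vanishes p q A c → Vanishes p q (Digit p i t A) c
vanishes-digit {t = t} {A} (onlyP _) _ lt v = equidistributed-digit A t lt v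
vanishes-digit {p} {q} {t = t} {A} (both i j) _ lt v = exchange-digit {p} {q} {i} {j} A t lt v

LowerBound : ℕ → ℕ → List Scale → Set
LowerBound p q S = ∀ A → 1 ≤ length A → All (Vanishes p q A) S → Bound p q S (length A)

-- A meets all digit classes at the lowest p-exponent i, so the smallest class is nonempty
-- and has size at most |A|/p; the scales with p-exponent above i still vanish on it.
p-live-bound : ∀ p q .{{_ : NonZero p}} → ∀ S → (∀ T → length T < length S → LowerBound p q T) →
  ∀ A → 1 ≤ length A → All (Vanishes p q A) S → All (PLive p A) S → Bound p q S (length A)
p-live-bound p q []       rec A 1≤ van live = [] , [] , [] , 1≤
p-live-bound p q S@(c ∷ S′) rec A 1≤ van live with ∃-lowest c S′
... | l , l∈ , low with ∃-small-digit p (pExp l) A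
...   | t , t<p , small = E′ , G , All.tabulate cover′ , le′
  where
  i = pExp l
  above? = λ c → i ℕ.<? pExp c
  T = filter above? S
  B = Digit p i t A
  T<S : length T < length S
  T<S = Listₚ.filter-notAll above? S (lose l∈ (ℕₚ.<-irrefl refl))
  vanT : All (Vanishes p q B) T
  vanT = All.map (λ {c} ((v , lv) , lt) → vanishes-digit c (proj₁ lv) lt v)
    (All.zip (Allₚ.filter⁺ above? (All.zip (van , live)) , Allₚ.all-filter above? S))
  boundT = rec T T<S B (proj₂ (All.lookup live l∈) t t<p) vanT
  E = proj₁ boundT
  G = proj₁ (proj₂ boundT)
  coverT = proj₁ (proj₂ (proj₂ boundT))
  leT = proj₂ (proj₂ (proj₂ boundT))
  E′ = i ∷ E
  cover′ : ∀ {c} → c ∈ S → Covers E′ G c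
  cover′ {c} c∈ with above? c
  ... | yes i<c = map₁ (λ (j , j∈ , e) → j , there j∈ , e) (All.lookup coverT (∈-filter⁺ above? c∈ i<c))
  -- The exponent is at least the lowest one and not above it, so it equals i and the new element of
  -- E′ covers the scale.
  ... | no i≮c = inj₁
      (i , here refl , subst (λ j → PExp j c) (ℕₚ.≤-antisym (ℕₚ.≮⇒≥ i≮c) (All.lookup low c∈))
      (proj₁ (All.lookup live c∈)))
  le′ : p ^ length E′ * q ^ length G ≤ length A
  le′ = ℕₚ.≤-trans (ℕₚ.≤-reflexive (ℕₚ.*-assoc p (p ^ length E) (q ^ length G)))
    (ℕₚ.≤-trans (ℕₚ.*-monoʳ-≤ p leT) small)

-- Increasing exponent lists; pure and mixed scales

insert : ℕ → List ℕ → List ℕ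
insert i [] = i ∷ []
insert i (k ∷ E) with ℕₚ.<-cmp i k
... | tri< _ _ _ = i ∷ k ∷ E
... | tri≈ _ _ _ = k ∷ E
... | tri> _ _ _ = k ∷ insert i E

All-insert : ∀ {P : ℕ → Set} i E → P i → All P E → All P (insert i E)
All-insert i [] pi [] = pi ∷ []
All-insert i (k ∷ E) pi (pk ∷ pE) with ℕₚ.<-cmp i k
... | tri< _ _ _ = pi ∷ pk ∷ pE
... | tri≈ _ _ _ = pk ∷ pE
... | tri> _ _ _ = pk ∷ All-insert i E pi pE

insert-sorted : ∀ i E → AllPairs _<_ E → AllPairs _<_ (insert i E)
insert-sorted i [] [] = [] ∷ []
insert-sorted i (k ∷ E) (k< ∷ sE) with ℕₚ.<-cmp i k
... | tri< i<k _ _ = (i<k ∷ All.map (ℕₚ.<-trans i<k) k<) ∷ k< ∷ sE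
... | tri≈ _ _ _   = k< ∷ sE
... | tri> _ _ k<i = All-insert i E k<i k< ∷ insert-sorted i E sE

∈-insert : ∀ i E → i ∈ insert i E
∈-insert i [] = here refl
∈-insert i (k ∷ E) with ℕₚ.<-cmp i k
... | tri< _ _ _   = here refl
... | tri≈ _ i≡k _ = here i≡k
... | tri> _ _ _   = there (∈-insert i E)

⊆-insert : ∀ i {k} E → k ∈ E → k ∈ insert i E
⊆-insert i (k ∷ E) k∈ with ℕₚ.<-cmp i k | k∈
... | tri< _ _ _ | _        = there k∈
... | tri≈ _ _ _ | _        = k∈
... | tri> _ _ _ | here e   = here e
... | tri> _ _ _ | there k∈ = there (⊆-insert i E k∈)

coprime-*ˡ : ∀ {a b c} → Coprime a c → Coprime b c → Coprime (a * b) c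
coprime-*ˡ {a} ca cb {d} (d∣ab , d∣c) =
  cb (coprime-divisor (λ (e∣d , e∣a) → ca (e∣a , ∣-trans e∣d d∣c)) d∣ab , d∣c)

coprime-^ˡ : ∀ {a c} n → Coprime a c → Coprime (a ^ n) c
coprime-^ˡ zero    ca (d∣1 , _) = ∣1⇒≡1 d∣1
coprime-^ˡ {a} {c} (suc n) ca = coprime-*ˡ {a} {a ^ n} {c} ca (coprime-^ˡ n ca)

PureP PureQ : ℕ → List ℕ → Scale → Set
PureP p A c = ∃[ i ] PExp i c × Equidistributed p i A
PureQ q A c = ∃[ j ] QExp j c × Equidistributed q j A

data Mixed (p q : ℕ) (A : List ℕ) : Scale → Set where
  mixed : ∀ {i j} → Exchange p q i j A → ¬ Equidistributed p i A → ¬ Equidistributed q j A →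
    Mixed p q A (both i j)

data View (p q : ℕ) (A : List ℕ) (c : Scale) : Set where
  pureP  : PureP p A c → View p q A c
  pureQ  : PureQ q A c → View p q A c
  mixed′ : Mixed p q A c → View p q A c

module _ (p q : ℕ) .{{_ : NonZero p}} .{{_ : NonZero q}} (cop : Coprime p q) where

  -- A scale equidistributed in both directions is filed under `pureP`; either direction could cover
  -- it.
  view : ∀ {A} c → Vanishes p q A c → View p q A c
  view (onlyP i) v = pureP (i , onlyP , v)
  view (onlyQ j) v = pureQ (j , onlyQ , v)
  view {A} (both i j) v with equidistributed? p i A | equidistributed? q j A
  ... | yes e | _      = pureP (i , both , e)
  ... | no _  | yes e  = pureQ (j , both , e)
  ... | no ¬e | no ¬e′ = mixed′ (mixed v ¬e ¬e′)

  pure-covers : ∀ A S → All (λ c → PureP p A c ⊎ PureQ q A c) S → ∃[ E ] ∃[ G ]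
    AllPairs _<_ E × All (λ i → Equidistributed p i A) E × AllPairs _<_ G × All
      (λ j → Equidistributed q j A) G × All (Covers E G) S
  pure-covers A [] [] = [] , [] , [] , [] , [] , [] , []
  pure-covers A (c ∷ S) (pure ∷ pures) with pure-covers A S pures
  pure-covers A (c ∷ S) (inj₁ (i , e , eq) ∷ pures) | E , G , sE , aE , sG , aG , cov =
    insert i E , G , insert-sorted i E sE , All-insert i E eq aE , sG , aG ,
    inj₁ (i , ∈-insert i E , e) ∷ All.map (map₁ (λ (k , k∈ , e) → k , ⊆-insert i E k∈ , e)) cov
  pure-covers A (c ∷ S) (inj₂ (j , e , eq) ∷ pures) | E , G , sE , aE , sG , aG , cov =
    E , insert j G , sE , aE , insert-sorted j G sG , All-insert j G eq aG ,
    inj₂ (j , ∈-insert j G , e) ∷ All.map (map₂ (λ (k , k∈ , e) → k , ⊆-insert j G k∈ , e)) cov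

  -- Here the bound comes from divisibility: p^|E| and q^|G| divide |A| by the two chains, and so
  -- does their product by coprimality.
  pure-bound : ∀ S A → 1 ≤ length A → All (λ c → PureP p A c ⊎ PureQ q A c) S → Bound p q S (length A)
  pure-bound S A 1≤ pures with pure-covers A S pures
  ... | E , G , sE , aE , sG , aG , cov = E , G , cov , ∣⇒≤ {{ℕ.>-nonZero 1≤}}
    (coprime-*-∣ {p ^ length E} {q ^ length G}
      (coprime-^ˡ (length E) (coprime-sym (coprime-^ˡ (length G) (coprime-sym cop))))
      (equidistributed-chain p E sE A aE) (equidistributed-chain q G sG A aG))

  -- The blocked case. Mixedness excludes a = i and b = j. If a or b lies below the corresponding
  -- mixed exponent, `coarser-dichotomy` applies, and its other alternative contradicts mixedness;
  -- if both lie above, `finer-bound` applies. A bound p² q pays for i, a and b; a bound p q² pays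
  -- for a, j and b.
  mixed-bound : ∀ A {m x y} → 1 ≤ length A → Mixed p q A m → PureP p A x → PureQ q A y →
    Bound p q (m ∷ x ∷ y ∷ []) (length A)
  mixed-bound A {both i j} {x} {y} 1≤ (mixed ex ¬ei ¬ej) (a , ax , ea) (b , by , eb) = bound
    where
    coverP : p * (p * q) ≤ length A → Bound p q (both i j ∷ x ∷ y ∷ []) (length A)
    coverP le = i ∷ a ∷ [] , b ∷ [] ,
      inj₁ (i , here refl , both) ∷ inj₁ (a , there (here refl) , ax) ∷ inj₂ (b , here refl , by) ∷ [] ,
      subst (_≤ length A) (lem p q) le
      where
      lem : ∀ p q → p * (p * q) ≡ p * (p * 1) * (q * 1)
      lem = solve-∀
    coverQ : q * (q * p) ≤ length A → Bound p q (both i j ∷ x ∷ y ∷ []) (length A)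
    coverQ le = a ∷ [] , j ∷ b ∷ [] ,
      inj₂ (j , here refl , both) ∷ inj₁ (a , here refl , ax) ∷ inj₂ (b , there (here refl) , by) ∷ [] ,
      subst (_≤ length A) (lem p q) le
      where
      lem : ∀ p q → q * (q * p) ≡ p * 1 * (q * (q * 1))
      lem = solve-∀
    whenAbove : j < b → Bound p q (both i j ∷ x ∷ y ∷ []) (length A)
    whenAbove j<b with ℕₚ.<-cmp a i
    ... | tri≈ _ refl _ = ⊥-elim (¬ei ea)
    ... | tri> _ _ i<a  =
        [ coverP , coverQ ]′ (finer-bound p q cop {i} {a} {j} {b} A 1≤ i<a ea j<b eb ex)
    ... | tri< a<i _ _  =
        [ (λ e → ⊥-elim (¬ej e)) ,
        (λ le → coverP (subst (_≤ length A) (cong (p *_) (ℕₚ.*-comm q p)) le)) ]′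
      (coarser-dichotomy q p (coprime-sym cop) {j} {i} {a} A a<i ea (equidistributed⇒∣ {q} {b} A eb)
        (exchange-sym {p} {q} {i} {j} {A} ex))
    bound : Bound p q (both i j ∷ x ∷ y ∷ []) (length A)
    bound with ℕₚ.<-cmp b j
    ... | tri≈ _ refl _ = ⊥-elim (¬ej eb)
    ... | tri> _ _ j<b  = whenAbove j<b
    ... | tri< b<j _ _  =
        [ (λ e → ⊥-elim (¬ei e)) ,
        (λ le → coverQ (subst (_≤ length A) (cong (q *_) (ℕₚ.*-comm p q)) le)) ]′
      (coarser-dichotomy p q cop {i} {j} {b} A b<j eb (equidistributed⇒∣ {p} {a} A ea) ex)

  mixed-first : ∀ {A} S → All (View p q A) S →
    All (λ c → PureP p A c ⊎ PureQ q A c) S ⊎ (∃[ m ] ∃[ T ] S ↭ m ∷ T × Mixed p q A m)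
  mixed-first [] [] = inj₁ []
  mixed-first (c ∷ S) (mixed′ m ∷ vs) = inj₂ (c , S , ↭-refl , m)
  mixed-first (c ∷ S) (pureP v ∷ vs) with mixed-first S vs
  ... | inj₁ pures = inj₁ (inj₁ v ∷ pures)
  ... | inj₂ (m , T , perm , mx) = inj₂ (m , c ∷ T , ↭-trans (↭-prep c perm) (↭-swap c m ↭-refl) , mx)
  mixed-first (c ∷ S) (pureQ v ∷ vs) with mixed-first S vs
  ... | inj₁ pures = inj₁ (inj₂ v ∷ pures)
  ... | inj₂ (m , T , perm , mx) = inj₂ (m , c ∷ T , ↭-trans (↭-prep c perm) (↭-swap c m ↭-refl) , mx)

  pureP-live : ∀ A {c} → 1 ≤ length A → PureP p A c → PLive p A c
  pureP-live A 1≤ (i , onlyP , e) = onlyP , equidistributed⇒splits p i A 1≤ e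
  pureP-live A 1≤ (i , both , e)  = both , equidistributed⇒splits p i A 1≤ e

  pureQ-live : ∀ A {c} → 1 ≤ length A → PureQ q A c → PLive q A (transpose c)
  pureQ-live A 1≤ (j , onlyQ , e) = onlyP , equidistributed⇒splits q j A 1≤ e
  pureQ-live A 1≤ (j , both , e)  = both , equidistributed⇒splits q j A 1≤ e

  mixed-pLive : ∀ {A c} → Mixed p q A c → PLive p A c
  mixed-pLive {A} (mixed {i} {j} ex _ ¬ej) =
    both , exchange⇒splits q p j i A (exchange-sym {p} {q} {i} {j} {A} ex) ¬ej

  mixed-qLive : ∀ {A c} → Mixed p q A c → PLive q A (transpose c)
  mixed-qLive {A} (mixed {i} {j} ex ¬ei _) = both , exchange⇒splits p q i j A ex ¬ei

  q-live-bound : ∀ S → (∀ T → length T < length S → LowerBound p q T) →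
    ∀ A → 1 ≤ length A → All (Vanishes p q A) S → All (λ c → PLive q A (transpose c)) S →
      Bound p q S (length A)
  q-live-bound S rec A 1≤ van live = bound-transpose S (p-live-bound q p (map transpose S)
    (λ T T< B 1≤B vanT → bound-transpose T (rec (map transpose T)
      (subst₂ _<_ (sym (Listₚ.length-map transpose T)) (Listₚ.length-map transpose S) T<)
      B 1≤B (Allₚ.map⁺ (All.map (λ {c} → vanishes-transpose c) vanT))))
    A 1≤ (Allₚ.map⁺ (All.map (λ {c} → vanishes-transpose c) van)) (Allₚ.map⁺ live))

  -- Once a mixed scale is put in front, at most two scales remain, and the mixed one is live in
  -- either direction. A common live direction therefore exists unless the other two are pure in
  -- opposite directions.
  lower-bound : ∀ n S → length S ≤ n → length S ≤ 3 → LowerBound p q S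
  lower-bound n S ≤n ≤3 A 1≤ van with mixed-first S (All.map (λ {c} → view c) van)
  ... | inj₁ pures = pure-bound S A 1≤ pures
  lower-bound zero [] ≤n ≤3 A 1≤ van | inj₂ (m , T , perm , mx) = contradiction (↭-length perm) λ ()
  lower-bound (suc n) S ≤n ≤3 A 1≤ van | inj₂ (m , T , perm , mx) =
    bound-↭ perm (split T (ℕₚ.≤-pred (subst (_≤ 3) (↭-length perm) ≤3)) rec (All-resp-↭ perm van))
    where
    -- The number n bounds the length, so the appeal to arbitrary shorter lists is structurally
    -- recursive.
    rec : ∀ R → length R < length (m ∷ T) → LowerBound p q R
    rec R R< = lower-bound n R (ℕₚ.≤-pred (ℕₚ.≤-trans R< (subst (_≤ suc n) (↭-length perm) ≤n)))
      (ℕₚ.≤-trans (ℕₚ.<⇒≤ R<) (subst (_≤ 3) (↭-length perm) ≤3))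
    split : ∀ T → length T ≤ 2 → (∀ R → length R < length (m ∷ T) → LowerBound p q R) →
      All (Vanishes p q A) (m ∷ T) → Bound p q (m ∷ T) (length A)
    split [] _ rec vs = p-live-bound p q (m ∷ []) rec A 1≤ vs (mixed-pLive mx ∷ [])
    split (x ∷ []) _ rec vs@(_ ∷ vx ∷ []) with view x vx
    ... | pureP px  =
        p-live-bound p q (m ∷ x ∷ []) rec A 1≤ vs (mixed-pLive mx ∷ pureP-live A 1≤ px ∷ [])
    ... | pureQ qx  = q-live-bound (m ∷ x ∷ []) rec A 1≤ vs (mixed-qLive mx ∷ pureQ-live A 1≤ qx ∷ [])
    ... | mixed′ mx′ = p-live-bound p q (m ∷ x ∷ []) rec A 1≤ vs (mixed-pLive mx ∷ mixed-pLive mx′ ∷ [])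
    split (x ∷ y ∷ []) _ rec vs@(_ ∷ vx ∷ vy ∷ []) with view x vx | view y vy
    ... | pureP px  | pureP py  =
        p-live-bound p q (m ∷ x ∷ y ∷ []) rec A 1≤ vs
        (mixed-pLive mx ∷ pureP-live A 1≤ px ∷ pureP-live A 1≤ py ∷ [])
    ... | pureP px  | mixed′ my =
        p-live-bound p q (m ∷ x ∷ y ∷ []) rec A 1≤ vs
        (mixed-pLive mx ∷ pureP-live A 1≤ px ∷ mixed-pLive my ∷ [])
    ... | mixed′ mx′ | pureP py  =
        p-live-bound p q (m ∷ x ∷ y ∷ []) rec A 1≤ vs
        (mixed-pLive mx ∷ mixed-pLive mx′ ∷ pureP-live A 1≤ py ∷ [])
    ... | mixed′ mx′ | mixed′ my =
        p-live-bound p q (m ∷ x ∷ y ∷ []) rec A 1≤ vs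
        (mixed-pLive mx ∷ mixed-pLive mx′ ∷ mixed-pLive my ∷ [])
    ... | pureQ qx  | pureQ qy  =
        q-live-bound (m ∷ x ∷ y ∷ []) rec A 1≤ vs
        (mixed-qLive mx ∷ pureQ-live A 1≤ qx ∷ pureQ-live A 1≤ qy ∷ [])
    ... | pureQ qx  | mixed′ my =
        q-live-bound (m ∷ x ∷ y ∷ []) rec A 1≤ vs
        (mixed-qLive mx ∷ pureQ-live A 1≤ qx ∷ mixed-qLive my ∷ [])
    ... | mixed′ mx′ | pureQ qy  =
        q-live-bound (m ∷ x ∷ y ∷ []) rec A 1≤ vs
        (mixed-qLive mx ∷ mixed-qLive mx′ ∷ pureQ-live A 1≤ qy ∷ [])
    ... | pureP px  | pureQ qy  = mixed-bound A 1≤ mx px qy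
    ... | pureQ qx  | pureP py  = bound-↭ (↭-prep m (↭-swap x y ↭-refl)) (mixed-bound A 1≤ mx py qx)
    split (_ ∷ _ ∷ _ ∷ _) (s≤s (s≤s ())) rec vs

-- Fibered sets

value : ℕ → ℕ → Scale → ℕ
value p q (onlyP i)  = p ^ suc i
value p q (onlyQ j)  = q ^ suc j
value p q (both i j) = p * (q * (p ^ i * q ^ j))

Φ-^ : ∀ {p} → Prime p → ∀ i → Φ (p ^ suc i) *ₚ U (p ^ i) ≋ U (p ^ suc i)
Φ-^ pp i = proj₁ (Φ-one-prime pp (^-pos i (prime-pos pp)) (λ r pr d → inj₁ (prime-∣-^ pr pp (suc i) d))
  (Full-Φ-^ pp i))

module _ {p q : ℕ} (pp : Prime p) (pq : Prime q) (p≢q : p ≢ q) where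

  pq-pos : ∀ i j → 1 ≤ p ^ i * q ^ j
  pq-pos i j = *-pos (^-pos i (prime-pos pp)) (^-pos j (prime-pos pq))

  Φ∣U : ∀ c → Φ (value p q c) ∣ₚ U (value p q c)
  Φ∣U (onlyP i)  = ∣ₚ-intro (U (p ^ i)) (≋-trans (*ₚ-comm (U (p ^ i)) (Φ (p ^ suc i))) (Φ-^ pp i))
  Φ∣U (onlyQ j)  = ∣ₚ-intro (U (q ^ j)) (≋-trans (*ₚ-comm (U (q ^ j)) (Φ (q ^ suc j))) (Φ-^ pq j))
  Φ∣U (both i j) = proj₂ (proj₂ (Φ-^^ pp pq p≢q i j))

  Φ∣F : ∀ c {r} → Prime r → (d : r ∣ value p q c) → Φ (value p q c) ∣ₚ F (value p q c) r d
  Φ∣F (onlyP i)  =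
    Φ∣F-one-prime pp (^-pos i (prime-pos pp)) (λ r pr d → inj₁ (prime-∣-^ pr pp (suc i) d)) (Φ-^ pp i)
  Φ∣F (onlyQ j)  =
    Φ∣F-one-prime pq (^-pos j (prime-pos pq)) (λ r pr d → inj₁ (prime-∣-^ pr pq (suc j) d)) (Φ-^ pq j)
  Φ∣F (both i j) = Φ∣F-two-primes pp pq (pq-pos i j) (onlyPrimes-both pp pq p≢q i j)
    (proj₁ (Φ-^^ pp pq p≢q i j))

  Φ∣⇒vanishes : ∀ {A} c → Φ (value p q c) ∣ₚ mask A → Vanishes p q A c
  Φ∣⇒vanishes {A} (onlyP i)  d = Φ∣⇒equidistributed {p} {i} {A} (Φ-^ pp i) d
  Φ∣⇒vanishes {A} (onlyQ j)  d = Φ∣⇒equidistributed {q} {j} {A} (Φ-^ pq j) d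
  Φ∣⇒vanishes {A} (both i j) d = Φ∣⇒exchange pp pq p≢q i j {A} (proj₁ (Φ-^^ pp pq p≢q i j)) d

mask-++ : ∀ L M → mask (L ++ M) ≋ mask L +ₚ mask M
mask-++ []      M = ≋-refl
mask-++ (a ∷ L) M = begin
  (X^ a) +ₚ mask (L ++ M)          ≈⟨ +ₚ-cong ≋-refl (mask-++ L M) ⟩
  (X^ a) +ₚ (mask L +ₚ mask M)
      ≈⟨ ringₚ 3 (λ x y z → x ⊕ (y ⊕ z) ⊜ (x ⊕ y) ⊕ z) ≋-refl (X^ a) (mask L) (mask M) ⟩
  (X^ a) +ₚ mask L +ₚ mask M       ∎
  where open SetoidReasoning polySetoid

mask-shift : ∀ a L → mask (map (a +_) L) ≋ (X^ a) *ₚ mask L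
mask-shift a []      = ≋-sym (≋-trans (*ₚ-comm (X^ a) []) ≋-refl)
mask-shift a (b ∷ L) = begin
  (X^ (a + b)) +ₚ mask (map (a +_) L)        ≈⟨ +ₚ-cong (X^-+ a b) (mask-shift a L) ⟩
  (X^ a) *ₚ (X^ b) +ₚ (X^ a) *ₚ mask L       ≈⟨ *ₚ-distribˡ (X^ a) (X^ b) (mask L) ⟨
  (X^ a) *ₚ ((X^ b) +ₚ mask L)               ∎
  where open SetoidReasoning polySetoid

-- Taken with multiplicity, so that mask polynomials multiply exactly; `spread` removes repetitions
-- afterwards.
sumset : List ℕ → List ℕ → List ℕ
sumset []      M = []
sumset (a ∷ L) M = map (a +_) M ++ sumset L M

mask-sumset : ∀ L M → mask (sumset L M) ≋ mask L *ₚ mask M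
mask-sumset []      M = ≋-refl
mask-sumset (a ∷ L) M = begin
  mask (map (a +_) M ++ sumset L M)             ≈⟨ mask-++ (map (a +_) M) (sumset L M) ⟩
  mask (map (a +_) M) +ₚ mask (sumset L M)      ≈⟨ +ₚ-cong (mask-shift a M) (mask-sumset L M) ⟩
  (X^ a) *ₚ mask M +ₚ mask L *ₚ mask M
      ≈⟨ ringₚ 3 (λ x y z → x ⊗ z ⊕ y ⊗ z ⊜ (x ⊕ y) ⊗ z) ≋-refl (X^ a) (mask L) (mask M) ⟩
  ((X^ a) +ₚ mask L) *ₚ mask M                  ∎
  where open SetoidReasoning polySetoid

length-sumset : ∀ L M → length (sumset L M) ≡ length L * length M
length-sumset []      M = refl
length-sumset (a ∷ L) M =
  trans (Listₚ.length-++ (map (a +_) M)) (cong₂ _+_ (Listₚ.length-map (a +_) M) (length-sumset L M))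

progression : ℕ → ℕ → List ℕ
progression k zero    = []
progression k (suc r) = 0 ∷ map (k +_) (progression k r)

length-progression : ∀ k r → length (progression k r) ≡ r
length-progression k zero    = refl
length-progression k (suc r) =
  cong suc (trans (Listₚ.length-map (k +_) (progression k r)) (length-progression k r))

mask-progression : ∀ k r → mask (progression k r) ≋ geom k r
mask-progression k zero    = ≋-refl
mask-progression k (suc r) =
  +ₚ-cong ≋-refl (≋-trans (mask-shift k (progression k r)) (*ₚ-congˡ (X^ k) (mask-progression k r)))

progressions : (ℕ → ℕ) → ℕ → List ℕ → List ℕ
progressions k r []      = 0 ∷ []
progressions k r (i ∷ E) = sumset (progression (k i) r) (progressions k r E)

length-progressions : ∀ k r E → length (progressions k r E) ≡ r ^ length E
length-progressions k r []      = refl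
length-progressions k r (i ∷ E) =
  trans (length-sumset (progression (k i) r) _)
    (cong₂ _*_ (length-progression (k i) r) (length-progressions k r E))

geom∣progressions : ∀ k r {i} E → i ∈ E → ∃[ Q ] Q *ₚ geom (k i) r ≋ mask (progressions k r E)
geom∣progressions k r (i ∷ E) (here refl) = R , (begin
  R *ₚ geom (k i) r                          ≈⟨ *ₚ-comm R (geom (k i) r) ⟩
  geom (k i) r *ₚ R                          ≈⟨ *ₚ-congʳ R (mask-progression (k i) r) ⟨
  mask (progression (k i) r) *ₚ R            ≈⟨ mask-sumset (progression (k i) r) (progressions k r E) ⟨
  mask (progressions k r (i ∷ E))            ∎)
  where
  open SetoidReasoning polySetoid
  R = mask (progressions k r E)
geom∣progressions k r {i′} (i ∷ E) (there i′∈) with geom∣progressions k r E i′∈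
... | Q , e = mask (progression (k i) r) *ₚ Q , (begin
  mask (progression (k i) r) *ₚ Q *ₚ geom (k i′) r
      ≈⟨ *ₚ-assoc (mask (progression (k i) r)) Q (geom (k i′) r) ⟩
  mask (progression (k i) r) *ₚ (Q *ₚ geom (k i′) r)   ≈⟨ *ₚ-congˡ (mask (progression (k i) r)) e ⟩
  mask (progression (k i) r) *ₚ mask (progressions k r E)
      ≈⟨ mask-sumset (progression (k i) r) (progressions k r E) ⟨
  mask (progressions k r (i ∷ E))                      ∎)
  where open SetoidReasoning polySetoid

-- Φ_r(X^m) divides Φ_r(X^(lm)) for l coprime to r: this is `U-product-divides` after cancelling. It
-- lets a single progression serve all scales with the same exponent of r.
F∣geom : ∀ {s r} → Prime r → 1 ≤ s → (d : r ∣ s) → ∀ l → 1 ≤ l → Coprime r l →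
  ∃[ Ψ ] Ψ *ₚ F s r d ≋ geom (l * quotient d) r
F∣geom {s} {r} pr 1≤s d l 1≤l cop with U-product-divides r l (quotient d) cop
... | Ψ , e = Ψ , *ₚ-cancelʳ (Ψ *ₚ F s r d) (geom (l * m) r) (U m *ₚ U (l * m))
    (lead-* (U m) (U (l * m)) (U-monic m 1≤m) (U-monic (l * m) (*-pos 1≤l 1≤m))) (begin
  Ψ *ₚ F s r d *ₚ (U m *ₚ U (l * m))
    ≈⟨ ringₚ 4 (λ a b c d → a ⊗ b ⊗ (c ⊗ d) ⊜ a ⊗ ((b ⊗ c) ⊗ d)) ≋-refl Ψ (F s r d) (U m) (U (l * m)) ⟩
  Ψ *ₚ (F s r d *ₚ U m *ₚ U (l * m))
    ≈⟨ *ₚ-congˡ Ψ (*ₚ-congʳ (U (l * m)) (≋-trans (F-U pr d) (U-cong s≡))) ⟩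
  Ψ *ₚ (U (r * m) *ₚ U (l * m))
    ≈⟨ e ⟩
  U (r * (l * m)) *ₚ U m
    ≈⟨ *ₚ-congʳ (U m) (geom-U (l * m) r) ⟨
  geom (l * m) r *ₚ U (l * m) *ₚ U m
    ≈⟨ ringₚ 3 (λ a b c → a ⊗ b ⊗ c ⊜ a ⊗ (c ⊗ b)) ≋-refl (geom (l * m) r) (U (l * m)) (U m) ⟩
  geom (l * m) r *ₚ (U m *ₚ U (l * m)) ∎)
  where
  open SetoidReasoning polySetoid
  m = quotient d
  s≡ : s ≡ r * m
  s≡ = trans (m∣n⇒n≡quotient*m d) (ℕₚ.*-comm m r)
  1≤m : 1 ≤ m
  1≤m = ℕₚ.n≢0⇒n>0 λ m≡0 → ℕₚ.<-irrefl (sym (trans s≡ (trans (cong (r *_) m≡0) (ℕₚ.*-zeroʳ r)))) 1≤s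

-- Adding multiples of M to the elements of a multiset turns it into a set without
-- changing its mask polynomial modulo X^M − 1.
spread : ∀ M .{{_ : NonZero M}} → ℕ → List ℕ → List ℕ
spread M t []      = []
spread M t (x ∷ L) = x % M + t * M ∷ spread M (suc t) L

length-spread : ∀ M .{{_ : NonZero M}} t L → length (spread M t L) ≡ length L
length-spread M t []      = refl
length-spread M t (x ∷ L) = cong suc (length-spread M (suc t) L)

spread-/ : ∀ M .{{_ : NonZero M}} x t → (x % M + t * M) / M ≡ t
spread-/ M x t = trans (DM.+-distrib-/-∣ʳ (x % M) {t * M} {M} (divides t refl))
  (cong₂ _+_ (DM.m<n⇒m/n≡0 (DM.m%n<n x M)) (DM.m*n/n≡m t M))

spread-above : ∀ M .{{_ : NonZero M}} t L → All (λ y → t ≤ y / M) (spread M t L)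
spread-above M t []      = []
spread-above M t (x ∷ L) = ℕₚ.≤-reflexive (sym (spread-/ M x t)) ∷ All.map ℕₚ.<⇒≤
  (spread-above M (suc t) L)

spread-unique : ∀ M .{{_ : NonZero M}} t L → Unique (spread M t L)
spread-unique M t []      = []
spread-unique M t (x ∷ L) =
  All.map (λ t<y/M e → ℕₚ.<-irrefl (trans (sym (spread-/ M x t)) (cong (_/ M) e)) t<y/M)
    (spread-above M (suc t) L)
  ∷ spread-unique M (suc t) L

X^-mod : ∀ M a t → ∃[ R ] X^ (a + t * M) ≋ (X^ a) +ₚ R *ₚ U M
X^-mod M a t = (X^ a) *ₚ geom M t , (begin
  X^ (a + t * M)                        ≈⟨ X^-+ a (t * M) ⟩
  (X^ a) *ₚ (X^ (t * M))
      ≈⟨ ringₚ 3 (λ x y o → x ⊗ y ⊜ (x ⊗ o) ⊕ x ⊗ (y ⊕ (⊝ o))) ≋-refl (X^ a) (X^ (t * M)) 1ₚ ⟩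
  (X^ a) *ₚ 1ₚ +ₚ (X^ a) *ₚ U (t * M)
      ≈⟨ +ₚ-cong (≋-trans (*ₚ-comm (X^ a) 1ₚ) (*ₚ-identityˡ (X^ a)))
      (*ₚ-congˡ (X^ a) (≋-sym (geom-U M t))) ⟩
  (X^ a) +ₚ (X^ a) *ₚ (geom M t *ₚ U M) ≈⟨ +ₚ-cong ≋-refl (*ₚ-assoc (X^ a) (geom M t) (U M)) ⟨
  (X^ a) +ₚ (X^ a) *ₚ geom M t *ₚ U M   ∎)
  where open SetoidReasoning polySetoid

spread-step : ∀ x q q′ r l u → (x +ₚ q *ₚ u) +ₚ (l +ₚ r *ₚ u) ≋ ((x +ₚ q′ *ₚ u) +ₚ l) +ₚ
  ((q -ₚ q′) +ₚ r) *ₚ u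
spread-step = ringₚ 6 (λ x q q′ r l u → (x ⊕ q ⊗ u) ⊕ (l ⊕ r ⊗ u) ⊜ ((x ⊕ q′ ⊗ u) ⊕ l) ⊕
  ((q ⊕ (⊝ q′)) ⊕ r) ⊗ u) ≋-refl

mask-spread : ∀ M .{{_ : NonZero M}} t L → ∃[ R ] mask (spread M t L) ≋ mask L +ₚ R *ₚ U M
mask-spread M t [] = [] , ≋-refl
mask-spread M t (x ∷ L) = (Q -ₚ Q′) +ₚ R ,
  ≋-trans (+ₚ-cong f e) (≋-trans (spread-step (X^ (x % M)) Q Q′ R (mask L) (U M))
    (+ₚ-cong (+ₚ-cong (≋-trans (≋-sym f′) (≋-reflexive (cong X^_ (sym (DM.m≡m%n+[m/n]*n x M)))))
      (≋-refl {mask L})) (≋-refl {((Q -ₚ Q′) +ₚ R) *ₚ U M})))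
  where
  rec = mask-spread M (suc t) L
  R = proj₁ rec
  e = proj₂ rec
  Q = proj₁ (X^-mod M (x % M) t)
  f = proj₂ (X^-mod M (x % M) t)
  Q′ = proj₁ (X^-mod M (x % M) (x / M))
  f′ = proj₂ (X^-mod M (x % M) (x / M))

-- Minimal covers

infix 4 _⊑_

_⊑_ : List ℕ → List ℕ → Set
E ⊑ E′ = ∀ {x} → x ∈ E → x ∈ E′

unique⊑⇒length≤ : ∀ {E E′ : List ℕ} → Unique E → E ⊑ E′ → length E ≤ length E′
unique⊑⇒length≤ {[]}    _          _   = z≤n
unique⊑⇒length≤ {x ∷ E} {E′} (x≢ ∷ u) sub = ℕₚ.≤-trans
  (s≤s (unique⊑⇒length≤ u (λ y∈ → ∈-filter⁺ (λ y → ¬? (x ℕ.≟ y)) (sub (there y∈)) (All.lookup x≢ y∈))))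
  (Listₚ.filter-notAll (λ y → ¬? (x ℕ.≟ y)) E′ (lose (sub (here refl)) (λ x≢x → x≢x refl)))

∉⇒unique : ∀ {i} {E : List ℕ} → i ∉ E → Unique E → Unique (i ∷ E)
∉⇒unique {E = E} i∉ u = All.tabulate (λ x∈ i≡x → i∉ (subst (_∈ E) (sym i≡x) x∈)) ∷ u

covers-⊑ : ∀ {E E′ G G′} c → E ⊑ E′ → G ⊑ G′ → Covers E G c → Covers E′ G′ c
covers-⊑ c E⊑ G⊑ = map-⊎ (λ (i , i∈ , e) → i , E⊑ i∈ , e) (λ (j , j∈ , e) → j , G⊑ j∈ , e)

module _ (p q : ℕ) .{{_ : NonZero p}} .{{_ : NonZero q}} where

  weight : List ℕ → List ℕ → ℕ
  weight E G = p ^ length E * q ^ length G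

  -- Minimality is relative to a partial choice E, G: only covers extending it compete. This is the
  -- form that recursion on S requires.
  MinimalCover : List Scale → List ℕ → List ℕ → Set
  MinimalCover S E G = ∃[ E′ ] ∃[ G′ ] E ⊑ E′ × G ⊑ G′ × All (Covers E′ G′) S ×
    (∀ E″ G″ → E ⊑ E″ → G ⊑ G″ → All (Covers E″ G″) S → weight E′ G′ ≤ weight E″ G″)

  -- The search branches only at an uncovered scale with two exponents and keeps the lighter result;
  -- at other uncovered scales the new exponent is forced. Only absent exponents are added, so the
  -- lists stay duplicate-free and at the end are no longer than any lists containing them.
  minimalCover : ∀ S E G → Unique E → Unique G → MinimalCover S E G
  minimalCover [] E G uE uG = E , G , (λ z → z) , (λ z → z) , [] , λ E″ G″ E⊑ G⊑ _ →
    ℕₚ.*-mono-≤ (ℕₚ.^-monoʳ-≤ p (unique⊑⇒length≤ uE E⊑)) (ℕₚ.^-monoʳ-≤ q (unique⊑⇒length≤ uG G⊑))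
  minimalCover (c ∷ S) E G uE uG = cases c
    where
    covered : ∀ c → Covers E G c → MinimalCover (c ∷ S) E G
    covered c cov with minimalCover S E G uE uG
    ... | E′ , G′ , E⊑ , G⊑ , covS , min =
      E′ , G′ , E⊑ , G⊑ , covers-⊑ {E} {E′} {G} {G′} c E⊑ G⊑ cov ∷ covS ,
        λ { E″ G″ E⊑″ G⊑″ (_ ∷ covS″) → min E″ G″ E⊑″ G⊑″ covS″ }

    cons : ∀ {i} {L L″ : List ℕ} → i ∈ L″ → L ⊑ L″ → (i ∷ L) ⊑ L″
    cons i∈ sub (here refl) = i∈
    cons i∈ sub (there x∈)  = sub x∈

    chooseP : ∀ {i} c → PExp i c → i ∉ E → (∀ E″ G″ → G ⊑ G″ → Covers E″ G″ c → i ∈ E″) →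
      MinimalCover (c ∷ S) E G
    chooseP {i} c e i∉ forced with minimalCover S (i ∷ E) G (∉⇒unique {E = E} i∉ uE) uG
    ... | E′ , G′ , E⊑ , G⊑ , covS , min =
      E′ , G′ , (λ x∈ → E⊑ (there x∈)) , G⊑ , inj₁ (i , E⊑ (here refl) , e) ∷ covS ,
      λ { E″ G″ E⊑″ G⊑″ (cov ∷ covS″) → min E″ G″ (cons (forced E″ G″ G⊑″ cov) E⊑″) G⊑″ covS″ }

    chooseQ : ∀ {j} c → QExp j c → j ∉ G → (∀ E″ G″ → E ⊑ E″ → Covers E″ G″ c → j ∈ G″) →
      MinimalCover (c ∷ S) E G
    chooseQ {j} c e j∉ forced with minimalCover S E (j ∷ G) uE (∉⇒unique {E = G} j∉ uG)
    ... | E′ , G′ , E⊑ , G⊑ , covS , min =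
      E′ , G′ , E⊑ , (λ x∈ → G⊑ (there x∈)) , inj₂ (j , G⊑ (here refl) , e) ∷ covS ,
      λ { E″ G″ E⊑″ G⊑″ (cov ∷ covS″) → min E″ G″ E⊑″ (cons (forced E″ G″ E⊑″ cov) G⊑″) covS″ }

    chooseEither : ∀ i j → i ∉ E → j ∉ G → MinimalCover (both i j ∷ S) E G
    chooseEither i j i∉ j∉
      with minimalCover S (i ∷ E) G (∉⇒unique {E = E} i∉ uE) uG | minimalCover S E (j ∷ G) uE
        (∉⇒unique {E = G} j∉ uG)
    ... | E₁ , G₁ , E⊑₁ , G⊑₁ , cov₁ , min₁ | E₂ , G₂ , E⊑₂ , G⊑₂ , cov₂ , min₂ with ℕₚ.≤-total
        (weight E₁ G₁) (weight E₂ G₂)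
    ...   | inj₁ le = E₁ , G₁ , (λ x∈ → E⊑₁ (there x∈)) , G⊑₁ , inj₁ (i , E⊑₁ (here refl) , both)
        ∷ cov₁ ,
      λ { E″ G″ E⊑″ G⊑″ (inj₁ (_ , i∈ , both) ∷ covS″) → min₁ E″ G″ (cons i∈ E⊑″) G⊑″ covS″
        ; E″ G″ E⊑″ G⊑″ (inj₂ (_ , j∈ , both) ∷ covS″) →
              ℕₚ.≤-trans le (min₂ E″ G″ E⊑″ (cons j∈ G⊑″) covS″) }
    ...   | inj₂ ge = E₂ , G₂ , E⊑₂ , (λ x∈ → G⊑₂ (there x∈)) , inj₂ (j , G⊑₂ (here refl) , both)
        ∷ cov₂ ,
      λ { E″ G″ E⊑″ G⊑″ (inj₁ (_ , i∈ , both) ∷ covS″) → ℕₚ.≤-trans ge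
        (min₁ E″ G″ (cons i∈ E⊑″) G⊑″ covS″)
        ; E″ G″ E⊑″ G⊑″ (inj₂ (_ , j∈ , both) ∷ covS″) → min₂ E″ G″ E⊑″ (cons j∈ G⊑″) covS″ }

    cases : ∀ c → MinimalCover (c ∷ S) E G
    cases (onlyP i) with i ∈? E
    ... | yes i∈ = covered (onlyP i) (inj₁ (i , i∈ , onlyP))
    ... | no i∉  = chooseP (onlyP i) onlyP i∉ λ { _ _ _ (inj₁ (_ , i∈ , onlyP)) → i∈ }
    cases (onlyQ j) with j ∈? G
    ... | yes j∈ = covered (onlyQ j) (inj₂ (j , j∈ , onlyQ))
    ... | no j∉  = chooseQ (onlyQ j) onlyQ j∉ λ { _ _ _ (inj₂ (_ , j∈ , onlyQ)) → j∈ }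
    cases (both i j) with i ∈? E | j ∈? G
    ... | yes i∈ | _      = covered (both i j) (inj₁ (i , i∈ , both))
    ... | no _   | yes j∈ = covered (both i j) (inj₂ (j , j∈ , both))
    ... | no i∉  | no j∉  = chooseEither i j i∉ j∉

-- The fibered set of a cover

ExpBelow : ℕ → Scale → Set
ExpBelow D (onlyP i)  = i < D
ExpBelow D (onlyQ j)  = j < D
ExpBelow D (both i j) = i < D × j < D

expBelow-mono : ∀ {D D′} c → D ≤ D′ → ExpBelow D c → ExpBelow D′ c
expBelow-mono (onlyP i)  le lt        = ℕₚ.≤-trans lt le
expBelow-mono (onlyQ j)  le lt        = ℕₚ.≤-trans lt le
expBelow-mono (both i j) le (lt , lt′) = ℕₚ.≤-trans lt le , ℕₚ.≤-trans lt′ le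

∃-expBound : ∀ S → ∃[ D ] All (ExpBelow D) S
∃-expBound []      = 0 , []
∃-expBound (c ∷ S) with ∃-expBound S
... | D , all = D ⊔ bound c , expBelow-mono c (ℕₚ.m≤n⊔m D (bound c)) (below c) ∷ All.map
    (λ {c′} → expBelow-mono c′ (ℕₚ.m≤m⊔n D (bound c))) all
  where
  bound : Scale → ℕ
  bound (onlyP i)  = suc i
  bound (onlyQ j)  = suc j
  bound (both i j) = suc i ⊔ suc j
  below : ∀ c → ExpBelow (bound c) c
  below (onlyP i)  = ℕₚ.≤-refl
  below (onlyQ j)  = ℕₚ.≤-refl
  below (both i j) = ℕₚ.m≤m⊔n (suc i) (suc j) , ℕₚ.m≤n⊔m (suc i) (suc j)

U-∣ : ∀ {m n} → m ∣ n → ∃[ V ] V *ₚ U m ≋ U n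
U-∣ {m} (divides k refl) = geom m k , geom-U m k

^-∸ : ∀ p {i D} → i ≤ D → p ^ D ≡ p ^ (D ∸ i) * p ^ i
^-∸ p {i} {D} i≤D = trans (cong (p ^_) (sym (ℕₚ.m∸n+n≡m i≤D))) (ℕₚ.^-distribˡ-+-* p (D ∸ i) i)

^-∣ : ∀ p {i D} → i ≤ D → p ^ i ∣ p ^ D
^-∣ p {i} {D} i≤D = divides (p ^ (D ∸ i)) (^-∸ p i≤D)

module _ {p q : ℕ} (pp : Prime p) (pq : Prime q) (p≢q : p ≢ q) (D : ℕ) where

  private instance
    p≢0 : NonZero p
    p≢0 = prime⇒nonZero pp
    q≢0 : NonZero q
    q≢0 = prime⇒nonZero pq
    N≢0 : NonZero (p ^ D * q ^ D)
    N≢0 = ℕ.>-nonZero (*-pos (^-pos D (prime-pos pp)) (^-pos D (prime-pos pq)))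

  private
    -- With D above all exponents in use, p^i q^D is s/p times a power of q for every scale s with
    -- p-exponent i + 1. That factor is coprime to p, as `F∣geom` demands.
    kp kq : ℕ → ℕ
    kp i = p ^ i * q ^ D
    kq j = p ^ D * q ^ j
    N = p ^ D * q ^ D

  fiberedList : List ℕ → List ℕ → List ℕ
  fiberedList E G = sumset (progressions kp p E) (progressions kq q G)

  fiberedSet : List ℕ → List ℕ → FiniteSet
  fiberedSet E G = record { elements = spread N 0 (fiberedList E G) ; unique =
    spread-unique N 0 (fiberedList E G) }

  fiberedSet-size : ∀ E G → ∣ fiberedSet E G ∣ ≡ p ^ length E * q ^ length G
  fiberedSet-size E G = trans (length-spread N 0 (fiberedList E G))
    (trans (length-sumset (progressions kp p E) (progressions kq q G))
      (cong₂ _*_ (length-progressions kp p E) (length-progressions kq q G)))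

  value∣N : ∀ c → ExpBelow D c → value p q c ∣ N
  value∣N (onlyP i)  lt = ∣-trans (^-∣ p lt) (m∣m*n (q ^ D))
  value∣N (onlyQ j)  lt = ∣-trans (^-∣ q lt) (n∣m*n (p ^ D))
  value∣N (both i j) (lt , lt′) =
    subst (_∣ N) (lem p q (p ^ i) (q ^ j)) (*-pres-∣ (^-∣ p lt) (^-∣ q lt′))
    where
    lem : ∀ p q x y → p * x * (q * y) ≡ p * (q * (x * y))
    lem = solve-∀

  value-pos : ∀ c → 1 ≤ value p q c
  value-pos (onlyP i)  = ^-pos (suc i) (prime-pos pp)
  value-pos (onlyQ j)  = ^-pos (suc j) (prime-pos pq)
  value-pos (both i j) = *-pos (prime-pos pp) (*-pos (prime-pos pq) (pq-pos pp pq p≢q i j))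

  -- Spreading changes the mask by a multiple of X^N - 1, hence of X^s - 1 because s divides N. So a
  -- fiber polynomial dividing the mask before spreading still does so modulo X^s - 1.
  fibered : ∀ E G c → ExpBelow D c → ∀ r → Prime r → (d : r ∣ value p q c) →
    ∃[ Q ] Q *ₚ F (value p q c) r d ≋ mask (fiberedList E G) → FiberedOn (value p q c) (fiberedSet E G)
  fibered E G c below r pr d (Q , e) = r , pr , d , Q , ∣ₚ-intro (R *ₚ V) (begin
    R *ₚ V *ₚ U s                                  ≈⟨ *ₚ-assoc R V (U s) ⟩
    R *ₚ (V *ₚ U s)                                ≈⟨ *ₚ-congˡ R (proj₂ (U-∣ (value∣N c below))) ⟩
    R *ₚ U N
        ≈⟨ ringₚ 2 (λ x y → y ⊜ x ⊕ y ⊕ (⊝ x)) ≋-refl (Q *ₚ Fs) (R *ₚ U N) ⟩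
    (Q *ₚ Fs +ₚ R *ₚ U N) -ₚ Q *ₚ Fs
        ≈⟨ +ₚ-cong (+ₚ-cong e (≋-refl {R *ₚ U N})) (≋-refl { -ₚ (Q *ₚ Fs)}) ⟩
    (mask (fiberedList E G) +ₚ R *ₚ U N) -ₚ Q *ₚ Fs ≈⟨ +ₚ-cong (proj₂ spr) (≋-refl { -ₚ (Q *ₚ Fs)}) ⟨
    mask (spread N 0 (fiberedList E G)) -ₚ Q *ₚ Fs ∎)
    where
    open SetoidReasoning polySetoid
    s = value p q c
    Fs = F s r d
    spr = mask-spread N 0 (fiberedList E G)
    R = proj₁ spr
    V = proj₁ (U-∣ (value∣N c below))

  geomP∣ : ∀ {i} E G → i ∈ E → ∃[ Q ] Q *ₚ geom (kp i) p ≋ mask (fiberedList E G)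
  geomP∣ {i} E G i∈ with geom∣progressions kp p E i∈
  ... | Q , e = Q *ₚ M , (begin
    Q *ₚ M *ₚ geom (kp i) p
        ≈⟨ ringₚ 3 (λ x y z → x ⊗ y ⊗ z ⊜ x ⊗ z ⊗ y) ≋-refl Q M (geom (kp i) p) ⟩
    Q *ₚ geom (kp i) p *ₚ M     ≈⟨ *ₚ-congʳ M e ⟩
    mask (progressions kp p E) *ₚ M ≈⟨ mask-sumset (progressions kp p E) (progressions kq q G) ⟨
    mask (fiberedList E G)      ∎)
    where
    open SetoidReasoning polySetoid
    M = mask (progressions kq q G)

  geomQ∣ : ∀ {j} E G → j ∈ G → ∃[ Q ] Q *ₚ geom (kq j) q ≋ mask (fiberedList E G)
  geomQ∣ {j} E G j∈ with geom∣progressions kq q G j∈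
  ... | Q , e = M *ₚ Q , (begin
    M *ₚ Q *ₚ geom (kq j) q     ≈⟨ *ₚ-assoc M Q (geom (kq j) q) ⟩
    M *ₚ (Q *ₚ geom (kq j) q)   ≈⟨ *ₚ-congˡ M e ⟩
    M *ₚ mask (progressions kq q G) ≈⟨ mask-sumset (progressions kp p E) (progressions kq q G) ⟨
    mask (fiberedList E G)      ∎)
    where
    open SetoidReasoning polySetoid
    M = mask (progressions kp p E)

  fiberVia : ∀ E G c r → ExpBelow D c → Prime r → ∀ m → value p q c ≡ r * m → ∀ l k → l * m ≡ k →
    1 ≤ l → Coprime r l →
    ∃[ Q ] Q *ₚ geom k r ≋ mask (fiberedList E G) → FiberedOn (value p q c) (fiberedSet E G)
  fiberVia E G c r below pr m s≡ l k k≡ 1≤l cop (Q , e) = fibered E G c below r pr d (Q *ₚ Ψ , (begin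
    Q *ₚ Ψ *ₚ Fs                ≈⟨ *ₚ-assoc Q Ψ Fs ⟩
    Q *ₚ (Ψ *ₚ Fs)              ≈⟨ *ₚ-congˡ Q (proj₂ (F∣geom pr (value-pos c) d l 1≤l cop)) ⟩
    Q *ₚ geom (l * m) r         ≈⟨ ≋-reflexive (cong (λ z → Q *ₚ geom z r) k≡) ⟩
    Q *ₚ geom k r               ≈⟨ e ⟩
    mask (fiberedList E G)      ∎))
    where
    open SetoidReasoning polySetoid
    d : r ∣ value p q c
    d = divides m (trans s≡ (ℕₚ.*-comm r m))
    Fs = F (value p q c) r d
    Ψ = proj₁ (F∣geom pr (value-pos c) d l 1≤l cop)

  coprime-q^ : ∀ n → Coprime p (q ^ n)
  coprime-q^ n = coprime-sym (coprime-^ pp pq p≢q n)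

  coprime-p^ : ∀ n → Coprime q (p ^ n)
  coprime-p^ n = coprime-sym (coprime-^ pq pp (λ e → p≢q (sym e)) n)

  covers⇒fibered : ∀ E G c → ExpBelow D c → Covers E G c → FiberedOn (value p q c) (fiberedSet E G)
  covers⇒fibered E G (onlyP i) lt (inj₁ (_ , i∈ , onlyP)) =
    fiberVia E G (onlyP i) p lt pp (p ^ i) refl (q ^ D) (kp i) (ℕₚ.*-comm (q ^ D) (p ^ i))
      (^-pos D (prime-pos pq))
      (coprime-q^ D) (geomP∣ E G i∈)
  covers⇒fibered E G (onlyQ j) lt (inj₂ (_ , j∈ , onlyQ)) =
    fiberVia E G (onlyQ j) q lt pq (q ^ j) refl (p ^ D) (kq j) refl (^-pos D (prime-pos pp))
      (coprime-p^ D) (geomQ∣ E G j∈)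
  covers⇒fibered E G (both i j) lt@(i<D , j<D) (inj₁ (_ , i∈ , both)) =
    fiberVia E G (both i j) p lt pp (q * (p ^ i * q ^ j)) refl (q ^ (D ∸ suc j)) (kp i)
      (trans (lem (q ^ (D ∸ suc j)) q (p ^ i) (q ^ j)) (cong (p ^ i *_) (sym (^-∸ q j<D))))
        (^-pos (D ∸ suc j) (prime-pos pq))
      (coprime-q^ (D ∸ suc j)) (geomP∣ E G i∈)
    where
    lem : ∀ z q x y → z * (q * (x * y)) ≡ x * (z * (q * y))
    lem = solve-∀
  covers⇒fibered E G (both i j) lt@(i<D , j<D) (inj₂ (_ , j∈ , both)) =
    fiberVia E G (both i j) q lt pq (p * (p ^ i * q ^ j)) (swap p q (p ^ i * q ^ j)) (p ^ (D ∸ suc i))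
      (kq j)
      (trans (lem (p ^ (D ∸ suc i)) p (p ^ i) (q ^ j)) (cong (_* q ^ j) (sym (^-∸ p i<D))))
        (^-pos (D ∸ suc i) (prime-pos pp))
      (coprime-p^ (D ∸ suc i)) (geomQ∣ E G j∈)
    where
    lem : ∀ z p x y → z * (p * (x * y)) ≡ z * (p * x) * y
    lem = solve-∀
    swap : ∀ p q z → p * (q * z) ≡ q * (p * z)
    swap = solve-∀

-- From S to scales, and the theorem

factor : ∀ {p q} n → 1 ≤ n → OnlyPrimes p q n → ∃[ a ] ∃[ b ] n ≡ p ^ a * q ^ b
factor {p} {q} n 1≤n only = go n (<-wellFounded n) 1≤n only
  where
  go : ∀ n → Acc _<_ n → 1 ≤ n → OnlyPrimes p q n → ∃[ a ] ∃[ b ] n ≡ p ^ a * q ^ b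
  go (suc zero) _ _ _ = 0 , 0 , refl
  go n@(suc (suc _)) (acc rs) _ only with prime-factor n (s≤s (s≤s z≤n))
  ... | r , pr , divides k eq with go k (rs k<n) 1≤k
      (λ s ps s∣k → only s ps (∣-trans s∣k (divides r (trans eq (ℕₚ.*-comm k r)))))
    where
    1≤k : 1 ≤ k
    1≤k = ℕₚ.n≢0⇒n>0 λ { refl → contradiction eq λ () }
    k<n : k < n
    k<n = subst (k <_) (trans (ℕₚ.*-comm r k) (sym eq)) (m<n*m 1≤k (prime>1 pr))
  ... | a , b , k≡ with only r pr (divides k eq)
  ...   | inj₁ refl = suc a , b , trans eq (trans (cong (_* p) k≡) (lem p (p ^ a) (q ^ b)))
    where
    lem : ∀ p x y → x * y * p ≡ p * x * y
    lem = solve-∀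
  ...   | inj₂ refl = a , suc b , trans eq (trans (cong (_* q) k≡) (lem q (p ^ a) (q ^ b)))
    where
    lem : ∀ q x y → x * y * q ≡ x * (q * y)
    lem = solve-∀

scale : ∀ {p q} n → 1 < n → OnlyPrimes p q n → ∃[ c ] value p q c ≡ n
scale {p} {q} n 1<n only with factor n (ℕₚ.<⇒≤ 1<n) only
... | zero  , zero  , refl = contradiction 1<n (ℕₚ.<-irrefl refl)
... | suc i , zero  , eq   = onlyP i , trans (sym (ℕₚ.*-identityʳ _)) (sym eq)
... | zero  , suc j , eq   = onlyQ j , trans (sym (ℕₚ.*-identityˡ _)) (sym eq)
... | suc i , suc j , eq   = both i j , trans (lem p q (p ^ i) (q ^ j)) (sym eq)
  where
  lem : ∀ p q x y → p * (q * (x * y)) ≡ p * x * (q * y)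
  lem = solve-∀

scales : ∀ {p q} S → (∀ s → s ∈ S → 1 < s) → (∀ s → s ∈ S → OnlyPrimes p q s) →
  ∃[ C ] map (value p q) C ≡ S
scales []      _   _    = [] , refl
scales (s ∷ S) >1 only with scale s (>1 s (here refl)) (only s (here refl))
  | scales S (λ t t∈ → >1 t (there t∈)) (λ t t∈ → only t (there t∈))
... | c , e | C , es = c ∷ C , cong₂ _∷_ e es

∣lcm : ∀ {s} S → s ∈ S → s ∣ foldr lcm 1 S
∣lcm (t ∷ S) (here refl) = m∣lcm[m,n] t _
∣lcm (t ∷ S) (there s∈)  = ∣-trans (∣lcm S s∈) (n∣lcm[m,n] t _)

lcm-pos : ∀ S → (∀ s → s ∈ S → 1 < s) → 1 ≤ foldr lcm 1 S
lcm-pos []      _  = s≤s z≤n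
-- The lcm divides the positive product of s and the remaining lcm, so it cannot be 0.
lcm-pos (s ∷ S) >1 = ℕₚ.n≢0⇒n>0 λ e →
  ℕₚ.<-irrefl (sym (0∣⇒≡0 (subst (_∣ s * L) e (lcm-least {s} (m∣m*n L) (n∣m*n s)))))
  (*-pos (ℕₚ.<⇒≤ (>1 s (here refl))) (lcm-pos S (λ t t∈ → >1 t (there t∈))))
  where L = foldr lcm 1 S

prime[3] : Prime 3
prime[3] = from-yes (prime? 3)

-- Missing primes are filled in with 2 or 3, so that two distinct primes are always at hand.
∃-primes : ∀ n → 1 ≤ n → length (primeDivisors n) ≤ 2 →
  ∃[ p ] ∃[ q ] Prime p × Prime q × p ≢ q × OnlyPrimes p q n
∃-primes n 1≤n ≤2 = pick (primeDivisors n) ≤2 (Uniqueₚ.filter⁺ P? (Uniqueₚ.upTo⁺ (suc n)))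
  (λ r∈ → proj₁ (proj₂ (∈-filter⁻ P? {xs = upTo (suc n)} r∈)))
  (λ r pr d → ∈-filter⁺ P? (∈-upTo⁺ (s≤s (∣⇒≤ {{ℕ.>-nonZero 1≤n}} d))) (pr , d))
  where
  P? = λ r → prime? r ×-dec (r ∣? n)
  pick : ∀ L → length L ≤ 2 → Unique L → (∀ {r} → r ∈ L → Prime r) → (∀ r → Prime r → r ∣ n → r ∈ L) →
    ∃[ p ] ∃[ q ] Prime p × Prime q × p ≢ q × OnlyPrimes p q n
  pick [] _ _ _ mem = 2 , 3 , prime[2] , prime[3] , (λ ()) , λ r pr d → contradiction (mem r pr d) λ ()
  pick (p ∷ []) _ _ prm mem with p ℕ.≟ 2
  ... | yes refl = 2 , 3 , prime[2] , prime[3] , (λ ()) , λ r pr d → inj₁ (single (mem r pr d))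
    where
    single : ∀ {r} → r ∈ 2 ∷ [] → r ≡ 2
    single (here e) = e
  ... | no p≢2 = p , 2 , prm (here refl) , prime[2] , p≢2 , λ r pr d → inj₁ (single (mem r pr d))
    where
    single : ∀ {r} → r ∈ p ∷ [] → r ≡ p
    single (here e) = e
  pick (p ∷ q ∷ []) _ ((p≢q ∷ []) ∷ _) prm mem =
    p , q , prm (here refl) , prm (there (here refl)) , p≢q , λ r pr d → pair (mem r pr d)
    where
    pair : ∀ {r} → r ∈ p ∷ q ∷ [] → r ≡ p ⊎ r ≡ q
    pair (here e)         = inj₁ e
    pair (there (here e)) = inj₂ e
  pick (_ ∷ _ ∷ _ ∷ _) (s≤s (s≤s ())) _ _ _

theorem1p2 : (S : FiniteSet)
    → (∀ s → s ∈ₛ S → 1 < s)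
    → 1 ≤ ∣ S ∣ → ∣ S ∣ ≤ 3
    → length (primeDivisors (lcmₛ S)) ≤ 2
    → ∃[ m ] (MIN S ≔ m) × (FIB S ≔ m)
theorem1p2 S >1 _ ≤3 ≤2 with ∃-primes (lcmₛ S) (lcm-pos (elements S) >1) ≤2
... | p , q , pp , pq , p≢q , only with scales (elements S) >1
    (λ s s∈ r pr d → only r pr (∣-trans d (∣lcm (elements S) s∈)))
...   | C , C≡ with ∃-expBound C | minimalCover p q {{prime⇒nonZero pp}} {{prime⇒nonZero pq}} C [] [] []
    []
...     | D , below | E , G , _ , _ , cov , min =
  p ^ length E * q ^ length G ,
  -- One set attains both minima. It is fibered, hence satisfies the divisibilities, and the lower
  -- bound for fibered sets follows from the one for divisibility in the same way.
  ((A , A-pos , (λ s s∈ → Φ∣ s s∈ A (A-fibered s s∈)) , fiberedSet-size pp pq p≢q D E G) , minimal) ,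
  ((A , A-pos , A-fibered , fiberedSet-size pp pq p≢q D E G) ,
    λ B 1≤B fib → minimal B 1≤B (λ s s∈ → Φ∣ s s∈ B (fib s s∈)))
  where
  A = fiberedSet pp pq p≢q D E G
  A-pos : 1 ≤ ∣ A ∣
  A-pos = subst (1 ≤_) (sym (fiberedSet-size pp pq p≢q D E G))
    (*-pos (^-pos (length E) (prime-pos pp)) (^-pos (length G) (prime-pos pq)))
  asScale : ∀ s → s ∈ₛ S → ∃[ c ] c ∈ C × s ≡ value p q c
  asScale s s∈ = ∈-map⁻ (value p q) (subst (s ∈_) (sym C≡) s∈)
  A-fibered : ∀ s → s ∈ₛ S → FiberedOn s A
  A-fibered s s∈ with asScale s s∈
  ... | c , c∈ , refl = covers⇒fibered pp pq p≢q D E G c (All.lookup below c∈) (All.lookup cov c∈)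
  Φ∣ : ∀ s → s ∈ₛ S → ∀ B → FiberedOn s B → Φ s ∣ₚ maskPoly B
  Φ∣ s s∈ B fib with asScale s s∈
  ... | c , c∈ , refl = fibered⇒Φ∣ {value p q c} {B} (Φ∣U pp pq p≢q c) (Φ∣F pp pq p≢q c) fib
  minimal : ∀ B → 1 ≤ ∣ B ∣ → (∀ s → s ∈ₛ S → Φ s ∣ₚ maskPoly B) → p ^ length E * q ^ length G ≤ ∣ B ∣
  minimal B 1≤B div with lower-bound p q {{prime⇒nonZero pp}} {{prime⇒nonZero pq}}
    (primes-coprime pp pq p≢q) 3 C ≤3′ ≤3′ (elements B) 1≤B
      (All.tabulate λ {c} c∈ → Φ∣⇒vanishes pp pq p≢q c
        (div (value p q c) (subst (value p q c ∈_) C≡ (∈-map⁺ (value p q) c∈))))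
    where
    ≤3′ : length C ≤ 3
    ≤3′ = subst (_≤ 3) (trans (cong length (sym C≡)) (Listₚ.length-map (value p q) C)) ≤3
  ... | E″ , G″ , cov″ , le = ℕₚ.≤-trans (min E″ G″ (λ ()) (λ ()) cov″) le
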